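{- For every real $c> 1$, there is a positive integer $\ell$ and a constant $C(c)\ge 1$ such that for every sufficiently large prime $p$ (large enough in terms of $c$) there is a constant $D(c,p)\ge 1$ such that the following holds for all positive integers $n$. If $A\subseteq \mathbb{F}_p^n$ is a subset of size $|A|\ge D(c,p)\cdot (C(c))^n$ with $|\ell A|\le |A|^c$, then $A$ contains $p$ distinct vectors $x_1,\dots,x_p\in A$ with $x_1+\dots+x_p=0$.
   Context: For a subset $A\subseteq\mathbb{F}_p^n$ and a positive integer $\ell$, $\ell A=\{x_1+\dots+x_\ell\mid x_1,\dots,x_\ell\in A\}$ denotes the $\ell$-fold sumset. -}

module Defs where

open import Data.Nat using (ℕ; zero; suc; _+_; _^_; _≤_; NonZero)
open import Data.Nat.DivMod using (_mod_)
import Data.Fin as Fin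
open Fin using (Fin; toℕ)
import Data.Fin.Properties as FinP
open import Data.Vec using (Vec; zipWith; replicate)
open import Data.Vec.Properties using (≡-dec)
open import Data.List using (List; []; _∷_; map; concatMap; length; deduplicate)
open import Data.Integer using (∣_∣)
open import Data.Rational using (ℚ; ↥_; ↧ₙ_)

-- The field F_p (p prime, hence nonzero) is modelled as Fin p with addition mod p.
_+ₚ_ : {p : ℕ} .{{_ : NonZero p}} → Fin p → Fin p → Fin p
_+ₚ_ {p} a b = (toℕ a + toℕ b) mod p

zeroₚ : {p : ℕ} .{{_ : NonZero p}} → Fin p
zeroₚ {p} = 0 mod p

Vecₚ : ℕ → ℕ → Set
Vecₚ p n = Vec (Fin p) n

_+ᵥ_ : {p n : ℕ} .{{_ : NonZero p}} → Vecₚ p n → Vecₚ p n → Vecₚ p n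
_+ᵥ_ = zipWith _+ₚ_

0ᵥ : {p n : ℕ} .{{_ : NonZero p}} → Vecₚ p n
0ᵥ {n = n} = replicate n zeroₚ

sumFam : {p n : ℕ} .{{_ : NonZero p}} → (k : ℕ) → (Fin k → Vecₚ p n) → Vecₚ p n
sumFam zero f = 0ᵥ
sumFam (suc k) f = f Fin.zero +ᵥ sumFam k (λ i → f (Fin.suc i))


sums : {p n : ℕ} .{{_ : NonZero p}} → ℕ → List (Vecₚ p n) → List (Vecₚ p n)
sums zero A = 0ᵥ ∷ []
sums (suc ℓ) A = concatMap (λ x → map (x +ᵥ_) (sums ℓ A)) A

sumsetCard : {p n : ℕ} .{{_ : NonZero p}} → ℕ → List (Vecₚ p n) → ℕ
sumsetCard ℓ A = length (deduplicate (≡-dec FinP._≟_) (sums ℓ A))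

-- x ≤ y^c for a rational exponent c = a/b (with a = numerator, b = denominator > 0),
-- meaning x^b ≤ y^a (used only for c > 1, so the numerator is positive).
_≤_^^_ : ℕ → ℕ → ℚ → Set
x ≤ y ^^ c = x ^ (↧ₙ c) ≤ y ^ ∣ ↥ c ∣

{-
Call A ⊆ 𝔽ₚⁿ free if no p distinct elements of A sum to zero, and write α = |A|. The induction is on an
exponent κ: if A is free, then for a suitable M no set of α^κ vectors contains the sums of
α^(M - δ) tuples from A^M. Once κ exceeds c, this applied to the set of all sums of M-tuples contradicts
|M A| ≤ α^c.

To raise κ slightly, suppose that T, slightly larger than α^κ, contains the sums of almost all 2M-tuples.
A Balog–Szemerédi–Gowers argument, with the statement for κ ensuring that dense sets of M-tuples have
many sums, gives a dense X ⊆ A inside a translate of a set with small difference set, and Petridis'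
inequality bounds |j X|. Hence a typical j-tuple of X has a popular sum. Typically no element is contained
in a large share of the representations of that sum, for otherwise deleting it would leave a smaller set
of sums with many (j - 1)-tuples, against the statement for κ - 1/2. A random B ⊆ X with Cⁿ elements
contains only such robust tuples.

It remains to find p elements of B with sum zero, repetitions allowed, that can nearly be arranged in
tuples of H distinct elements: the tuples are then replaced by disjoint representations of their sums.
Let Y ⊆ B have all moments of degree at most O(n) divisible by p. If a weighted equation
w₁y₁ + … + w_q y_q = v has many variables, then the number of its solutions in Y is divisible by p. If no
solution had the desired shape, the same would follow for few variables: splitting a variable of large
weight into H distinct ones and applying inclusion–exclusion to the coincidences expresses the number
of solutions through equations with more variables or with H distinct values fixed. But (p - 1) y = -x₀
has exactly one solution.
-}
module Submission where

open import Defs hiding (sums)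
import Defs
open import Algebra.Bundles using (Group)
open import Algebra.Core using (Op₁; Op₂)
open import Algebra.Structures using (IsAbelianGroup; IsCommutativeSemiring)
open import Data.Bool using (if_then_else_; true; false)
open import Data.Empty using (⊥; ⊥-elim)
open import Data.Fin as Fin using (Fin)
import Data.Fin.Properties as Fin
open import Data.Integer as ℤ using (ℤ)
import Data.Integer.Divisibility.Signed as ℤ
import Data.Integer.Properties as ℤ
open import Data.List using (List; []; _∷_; _++_; map; concat; concatMap; length; filter; deduplicate; take; drop; foldr; replicate; upTo; allFin; lookup)
open import Data.List.Membership.Propositional using (_∈_; _∉_; find; lose)
open import Data.List.Membership.Propositional.Properties
open import Data.List.Membership.Propositional.Properties.WithK using (unique∧set⇒bag)
import Data.List.Properties as List
open import Data.List.Relation.Binary.BagAndSetEquality using (∼bag⇒↭)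
open import Data.List.Relation.Binary.Permutation.Propositional as Perm using (_↭_; ↭⇒↭ₛ)
open import Data.List.Relation.Binary.Permutation.Propositional.Properties using (↭-length; shift; All-resp-↭)
import Data.List.Relation.Binary.Permutation.Setoid.Properties as Permutation
open import Data.List.Relation.Binary.Sublist.Propositional using ([]; _∷_; _∷ʳ_; minimum; ⊆-refl; ⊆-trans) renaming (_⊆_ to _⊑_; lookup to ⊑-lookup)
import Data.List.Relation.Binary.Sublist.Propositional.Properties as Sub
open import Data.List.Relation.Unary.All as All using (All; []; _∷_)
import Data.List.Relation.Unary.All.Properties as All
open import Data.List.Relation.Unary.AllPairs using ([]; _∷_)
open import Data.List.Relation.Unary.Any using (here; there; any?)
open import Data.List.Relation.Unary.Unique.DecPropositional using (unique?)
open import Data.List.Relation.Unary.Unique.Propositional using (Unique)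
import Data.List.Relation.Unary.Unique.Propositional.Properties as Unique
open import Data.Nat as ℕ using (ℕ; zero; suc; NonZero; z≤n; s≤s)
import Data.Nat.DivMod as ℕ
import Data.Nat.Properties as ℕ
open import Data.Nat.Primality using (Prime; euclidsLemma; prime⇒nonTrivial; prime⇒nonZero)
import Data.Nat.Tactic.RingSolver as ℕSolver
open import Data.Product using (Σ; ∃; _×_; _,_; proj₁; proj₂)
open import Data.Sum using (_⊎_; inj₁; inj₂; [_,_]′)
open import Data.Vec.Properties using (≡-dec)
open import Function using (_∘_)
open import Function.Bundles using (mk⇔)
open import Function.Definitions using (Injective)
open import Level using (0ℓ)
open import Relation.Binary.Definitions using (DecidableEquality)
open import Relation.Binary.PropositionalEquality
open import Relation.Nullary
open import Relation.Nullary.Decidable using (_×-dec_; ¬?; dec-true; dec-false)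
open import Relation.Unary using (Decidable)

-- The delicate point is that C must not depend on p. The set B has about 2^(n+d) p elements, d
-- being the degree of the moments, while the equations have total weight p. So d can stay O(n) only
-- if "many variables" means a constant proportion of p: at least about p/τ, with τ depending on H
-- alone. With fewer variables some weight is big, and that weight is split. Here H = 2h, and h is
-- one more than the tuple length M of the statement for κ - 1/2. Tuples are cut into halves so that
-- each left-over element can join a half not containing it, which is why both lengths h and h + 1
-- must be robust.
--
-- Petridis' inequality loses about 1 + 4j times the gain in κ, where j depends only on the
-- statement for κ - 1/2. That statement is held fixed while κ climbs by 1/2, so the gain does not
-- shrink during a climb. Deleting one element of a tuple changes the normalisation by a factor α,
-- so any lag well below 1 would do; the lag 1/2 leaves the other half for the losses.
--
-- Real exponents never occur: x ≤ α^(k/N) is stated as x^N ≤ α^k, and a small loss is a power of α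
-- counted in units of 1/N.

module BigSum {R : Set} {_+_ _*_ : Op₂ R} {0# 1# : R}
  (isCSR : IsCommutativeSemiring _≡_ _+_ _*_ 0# 1#) where

  open IsCommutativeSemiring isCSR
    using (+-assoc; +-comm; +-identityˡ; +-identityʳ; zeroʳ; distribˡ)

  private variable
    A B : Set

  ∑ : List A → (A → R) → R
  ∑ []       f = 0#
  ∑ (x ∷ xs) f = f x + ∑ xs f

  +-medial : ∀ a b c d → (a + b) + (c + d) ≡ (a + c) + (b + d)
  +-medial a b c d = begin
    (a + b) + (c + d)  ≡⟨ +-assoc a b (c + d) ⟩
    a + (b + (c + d))  ≡⟨ cong (a +_) (sym (+-assoc b c d)) ⟩
    a + ((b + c) + d)  ≡⟨ cong (λ e → a + (e + d)) (+-comm b c) ⟩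
    a + ((c + b) + d)  ≡⟨ cong (a +_) (+-assoc c b d) ⟩
    a + (c + (b + d))  ≡⟨ sym (+-assoc a c (b + d)) ⟩
    (a + c) + (b + d)  ∎
    where open ≡-Reasoning

  ∑-cong∈ : ∀ (xs : List A) {f g : A → R} → (∀ {x} → x ∈ xs → f x ≡ g x) → ∑ xs f ≡ ∑ xs g
  ∑-cong∈ []       eq = refl
  ∑-cong∈ (x ∷ xs) eq = cong₂ _+_ (eq (here refl)) (∑-cong∈ xs (λ x∈ → eq (there x∈)))

  ∑-cong : ∀ (xs : List A) {f g : A → R} → (∀ x → f x ≡ g x) → ∑ xs f ≡ ∑ xs g
  ∑-cong xs eq = ∑-cong∈ xs (λ {x} _ → eq x)

  ∑-zero : ∀ (xs : List A) → ∑ xs (λ _ → 0#) ≡ 0#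
  ∑-zero []       = refl
  ∑-zero (x ∷ xs) = trans (+-identityˡ _) (∑-zero xs)

  ∑-+ : ∀ (xs : List A) (f g : A → R) → ∑ xs (λ x → f x + g x) ≡ ∑ xs f + ∑ xs g
  ∑-+ []       f g = sym (+-identityˡ 0#)
  ∑-+ (x ∷ xs) f g = trans (cong (_ +_) (∑-+ xs f g)) (+-medial _ _ _ _)

  ∑-* : ∀ (xs : List A) c (f : A → R) → ∑ xs (λ x → c * f x) ≡ c * ∑ xs f
  ∑-* []       c f = sym (zeroʳ c)
  ∑-* (x ∷ xs) c f = trans (cong (_ +_) (∑-* xs c f)) (sym (distribˡ c _ _))

  ∑-++ : ∀ (xs ys : List A) (f : A → R) → ∑ (xs ++ ys) f ≡ ∑ xs f + ∑ ys f
  ∑-++ []       ys f = sym (+-identityˡ _)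
  ∑-++ (x ∷ xs) ys f = trans (cong (_ +_) (∑-++ xs ys f)) (sym (+-assoc _ _ _))

  ∑-map : ∀ (h : A → B) (xs : List A) (f : B → R) → ∑ (map h xs) f ≡ ∑ xs (λ x → f (h x))
  ∑-map h []       f = refl
  ∑-map h (x ∷ xs) f = cong (_ +_) (∑-map h xs f)

  ∑-concatMap : ∀ (h : A → List B) (xs : List A) (f : B → R) →
    ∑ (concatMap h xs) f ≡ ∑ xs (λ x → ∑ (h x) f)
  ∑-concatMap h []       f = refl
  ∑-concatMap h (x ∷ xs) f =
    trans (∑-++ (h x) (concatMap h xs) f) (cong (_ +_) (∑-concatMap h xs f))

  ∑-comm : ∀ (xs : List A) (ys : List B) (f : A → B → R) →
    ∑ xs (λ x → ∑ ys (f x)) ≡ ∑ ys (λ y → ∑ xs (λ x → f x y))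
  ∑-comm []       ys f = sym (∑-zero ys)
  ∑-comm (x ∷ xs) ys f =
    trans (cong (_ +_) (∑-comm xs ys f)) (sym (∑-+ ys (f x) (λ y → ∑ xs (λ x → f x y))))

-- Sublists, and sums of lists in an abelian group.

private variable
  A : Set

subs : List A → List (List A)
subs []       = [] ∷ []
subs (x ∷ xs) = subs xs ++ map (x ∷_) (subs xs)

∈-subs⁺ : ∀ {xs ys : List A} → ys ⊑ xs → ys ∈ subs xs
∈-subs⁺ []          = here refl
∈-subs⁺ (y ∷ʳ ⊆xs)  = ∈-++⁺ˡ (∈-subs⁺ ⊆xs)
∈-subs⁺ {xs = _ ∷ xs} (refl ∷ ⊆xs) = ∈-++⁺ʳ (subs xs) (∈-map⁺ _ (∈-subs⁺ ⊆xs))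

∈-subs⁻ : ∀ {xs ys : List A} → ys ∈ subs xs → ys ⊑ xs
∈-subs⁻ {xs = []}     (here refl) = []
∈-subs⁻ {xs = x ∷ xs} ys∈ with ∈-++⁻ (subs xs) ys∈
... | inj₁ ∈₁ = x ∷ʳ ∈-subs⁻ ∈₁
... | inj₂ ∈₂ with ∈-map⁻ (x ∷_) ∈₂
... | _ , ∈₃ , refl = refl ∷ ∈-subs⁻ ∈₃

unique-⊑ : ∀ {xs ys : List A} → ys ⊑ xs → Unique xs → Unique ys
unique-⊑ []         []       = []
unique-⊑ (y ∷ʳ ⊆xs) (_ ∷ u)  = unique-⊑ ⊆xs u
unique-⊑ (refl ∷ ⊆xs) (x ∷ u) = Sub.All-resp-⊆ ⊆xs x ∷ unique-⊑ ⊆xs u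

module ListSums {E : Set} {_⊕_ : Op₂ E} {0# : E} {⊖_ : Op₁ E}
  (isAb : IsAbelianGroup _≡_ _⊕_ 0# ⊖_) where

  open IsAbelianGroup isAb using (assoc; comm; identityˡ)

  ⊕-left-comm : ∀ x y z → x ⊕ (y ⊕ z) ≡ y ⊕ (x ⊕ z)
  ⊕-left-comm x y z = trans (sym (assoc x y z)) (trans (cong (_⊕ z) (comm x y)) (assoc y x z))

  esum : List E → E
  esum = foldr _⊕_ 0#

  esum-++ : ∀ xs ys → esum (xs ++ ys) ≡ esum xs ⊕ esum ys
  esum-++ []       ys = sym (identityˡ _)
  esum-++ (x ∷ xs) ys = trans (cong (x ⊕_) (esum-++ xs ys)) (sym (assoc x _ _))

  esum-↭ : ∀ {xs ys} → xs ↭ ys → esum xs ≡ esum ys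
  esum-↭ xs↭ys = Permutation.foldr-commMonoid (setoid E) (IsAbelianGroup.isCommutativeMonoid isAb) (↭⇒↭ₛ xs↭ys)

-- Congruences between finite sums and products of integers.

module Modular where

  open import Data.Integer using (+_; -_; _+_; _*_; _-_; 0ℤ; 1ℤ)
  open import Data.Integer.Divisibility.Signed
  import Data.Integer.DivMod as ℤ
  open import Data.Integer.Tactic.RingSolver using (solve-∀)
  import Data.Nat.Divisibility as ℕ
  open import Data.Nat.ListAction using (sum)
  open import Data.Nat.ListAction.Properties using (sum-↭)

  open BigSum ℤ.+-*-isCommutativeSemiring

  private variable
    m : ℤ

  ∏ : List A → (A → ℤ) → ℤ
  ∏ []       f = 1ℤ
  ∏ (x ∷ xs) f = f x * ∏ xs f

  ∣0 : m ∣ 0ℤ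
  ∣0 = divides 0ℤ refl

  ∣-resp-≡ : ∀ {a b} → a ≡ b → m ∣ a → m ∣ b
  ∣-resp-≡ refl d = d

  ∑-∣ : ∀ (xs : List A) {f : A → ℤ} → (∀ {x} → x ∈ xs → m ∣ f x) → m ∣ ∑ xs f
  ∑-∣ []       d = ∣0
  ∑-∣ (x ∷ xs) d = ∣m∣n⇒∣m+n (d (here refl)) (∑-∣ xs (λ x∈ → d (there x∈)))

  ∑-∣-diff : ∀ (xs : List A) {f g : A → ℤ} → (∀ {x} → x ∈ xs → m ∣ f x - g x) →
    m ∣ ∑ xs f - ∑ xs g
  ∑-∣-diff []       d = ∣0
  ∑-∣-diff (x ∷ xs) {f} {g} d = ∣-resp-≡ (lemma (f x) (g x) (∑ xs f) (∑ xs g))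
    (∣m∣n⇒∣m+n (d (here refl)) (∑-∣-diff xs (λ x∈ → d (there x∈))))
    where
    lemma : ∀ a b c d → (a - b) + (c - d) ≡ (a + c) - (b + d)
    lemma = solve-∀

  diff-∣ : ∀ {a b} → m ∣ a - b → m ∣ b → m ∣ a
  diff-∣ {a = a} {b} d e = ∣-resp-≡ (lemma a b) (∣m∣n⇒∣m+n d e)
    where
    lemma : ∀ a b → (a - b) + b ≡ a
    lemma = solve-∀

  diff-sym : ∀ {a b} → m ∣ a - b → m ∣ b - a
  diff-sym {a = a} {b} d = ∣-resp-≡ (lemma a b) (∣m⇒∣-m d)
    where
    lemma : ∀ a b → - (a - b) ≡ b - a
    lemma = solve-∀

  *-∣-diff : ∀ {a b c d} → m ∣ a - b → m ∣ c - d → m ∣ a * c - b * d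
  *-∣-diff {a = a} {b} {c} {d} e f = ∣-resp-≡ (lemma a b c d)
    (∣m∣n⇒∣m+n (∣m⇒∣m*n c e) (∣n⇒∣m*n b f))
    where
    lemma : ∀ a b c d → (a - b) * c + b * (c - d) ≡ a * c - b * d
    lemma = solve-∀

  ∏-∣-diff : ∀ (xs : List A) {f g : A → ℤ} → (∀ x → m ∣ f x - g x) → m ∣ ∏ xs f - ∏ xs g
  ∏-∣-diff []       d = ∣0
  ∏-∣-diff (x ∷ xs) {f} {g} d = *-∣-diff {a = f x} {g x} {∏ xs f} {∏ xs g} (d x) (∏-∣-diff xs d)

  ∏-∣ : ∀ {xs : List A} {f : A → ℤ} {x} → x ∈ xs → m ∣ f x → m ∣ ∏ xs f
  ∏-∣ {xs = x ∷ xs} {f} (here refl) d = ∣m⇒∣m*n (∏ xs f) d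
  ∏-∣ {xs = x ∷ xs} {f} (there x∈)  d = ∣n⇒∣m*n (f x) (∏-∣ x∈ d)

  -- Alternating sums over sublists and polynomials of bounded degree.

  module Cube {E : Set} where

    altSum : List E → (List E → ℤ) → ℤ
    altSum []      g = g []
    altSum (x ∷ B) g = altSum B (λ S → g S - g (x ∷ S))

    altSum-cong : ∀ B {f g} → (∀ S → f S ≡ g S) → altSum B f ≡ altSum B g
    altSum-cong []      eq = eq []
    altSum-cong (x ∷ B) eq = altSum-cong B (λ S → cong₂ _-_ (eq S) (eq (x ∷ S)))

    -- Functions of S in which at most `d` affine functionals are multiplied together. Recording
    -- degree bounds as syntax, without coefficients, lets the difference operator be computed by
    -- recursion; `ext` closes the class under pointwise equality.
    data Poly : ℕ → (List E → ℤ) → Set where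
      const : ∀ {d} c → Poly d (λ _ → c)
      add   : ∀ {d f g} → Poly d f → Poly d g → Poly d (λ S → f S + g S)
      mul   : ∀ {d f} c (ℓ : E → ℤ) → Poly d f → Poly (suc d) (λ S → (c + ∑ S ℓ) * f S)
      ext   : ∀ {d f g} → (∀ S → f S ≡ g S) → Poly d f → Poly d g

    scale : ∀ {d f} k → Poly d f → Poly d (λ S → k * f S)
    scale k (const c)   = const (k * c)
    scale k (add {f = f} {g} P Q) =
      ext (λ S → sym (ℤ.*-distribˡ-+ k (f S) (g S))) (add (scale k P) (scale k Q))
    scale k (mul {f = f} c ℓ P) =
      ext (λ S → lemma k (c + ∑ S ℓ) (f S)) (mul c ℓ (scale k P))
      where
      lemma : ∀ k a b → a * (k * b) ≡ k * (a * b)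
      lemma = solve-∀
    scale k (ext eq P)  = ext (λ S → cong (k *_) (eq S)) (scale k P)

    insert : ∀ {d f} x → Poly d f → Poly d (λ S → f (x ∷ S))
    insert x (const c)   = const c
    insert x (add P Q)   = add (insert x P) (insert x Q)
    insert x (mul {f = f} c ℓ P) =
      ext (λ S → cong (_* f (x ∷ S)) (ℤ.+-assoc c (ℓ x) (∑ S ℓ))) (mul (c + ℓ x) ℓ (insert x P))
    insert x (ext eq P)  = ext (λ S → eq (x ∷ S)) (insert x P)

    const-diff : ∀ {f} x → Poly 0 f → ∀ S → f S - f (x ∷ S) ≡ 0ℤ
    const-diff x (const c) S = ℤ.+-inverseʳ c
    const-diff x (add {f = f} {g} P Q) S =
      trans (lemma (f S) (g S) (f (x ∷ S)) (g (x ∷ S))) (cong₂ _+_ (const-diff x P S) (const-diff x Q S))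
      where
      lemma : ∀ a b c d → (a + b) - (c + d) ≡ (a - c) + (b - d)
      lemma = solve-∀
    const-diff x (ext eq P) S =
      trans (cong₂ _-_ (sym (eq S)) (sym (eq (x ∷ S)))) (const-diff x P S)

    -- Product rule: for a factor c + ∑ S ℓ the difference is (c + ∑ S ℓ) times the difference of f,
    -- minus ℓ x times f (x ∷ S), and the second term has already lost a factor. If f has degree
    -- bound 0, the first term is zero by `const-diff`, since no bound below 0 could be assigned to
    -- it.
    diff : ∀ {d f} x → Poly (suc d) f → Poly d (λ S → f S - f (x ∷ S))
    diff x (const c) = ext (λ _ → sym (ℤ.+-inverseʳ c)) (const 0ℤ)
    diff x (add {f = f} {g} P Q) =
      ext (λ S → lemma (f S) (g S) (f (x ∷ S)) (g (x ∷ S))) (add (diff x P) (diff x Q))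
      where
      lemma : ∀ a b c d → (a - c) + (b - d) ≡ (a + b) - (c + d)
      lemma = solve-∀
    diff x (ext eq P) = ext (λ S → cong₂ _-_ (eq S) (eq (x ∷ S))) (diff x P)
    diff {zero} x (mul {f = f} c ℓ P) =
      ext (λ S → trans (cong (_+ _) (sym (ℤ.*-zeroʳ (c + ∑ S ℓ))))
                (trans (cong (λ z → (c + ∑ S ℓ) * z + - ℓ x * f (x ∷ S)) (sym (const-diff x P S)))
                       (lemma c (∑ S ℓ) (ℓ x) (f S) (f (x ∷ S)))))
          (add (const 0ℤ) (scale (- ℓ x) (insert x P)))
      where
      lemma : ∀ c s l u v → (c + s) * (u - v) + - l * v ≡ (c + s) * u - (c + (l + s)) * v
      lemma = solve-∀
    diff {suc d} x (mul {f = f} c ℓ P) =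
      ext (λ S → lemma c (∑ S ℓ) (ℓ x) (f S) (f (x ∷ S)))
          (add (mul c ℓ (diff x P)) (scale (- ℓ x) (insert x P)))
      where
      lemma : ∀ c s l u v → (c + s) * (u - v) + - l * v ≡ (c + s) * u - (c + (l + s)) * v
      lemma = solve-∀

    -- Each element of `B` applies one difference and lowers the degree by one; the list is long
    -- enough to difference a constant in the end.
    altSum-poly : ∀ B {d f} → Poly d f → d ℕ.< length B → altSum B f ≡ 0ℤ
    altSum-poly (x ∷ B) {zero} P _ =
      trans (altSum-cong B (const-diff x P)) (altSum-zero B)
      where
      altSum-zero : ∀ B → altSum B (λ _ → 0ℤ) ≡ 0ℤ
      altSum-zero []      = refl
      altSum-zero (_ ∷ B) = altSum-zero B
    altSum-poly (x ∷ B) {suc d} P (s≤s d<) = altSum-poly B (diff x P) d<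

    altSum-∣-diff : ∀ B {g} → (∀ {S} → S ⊑ B → S ≢ [] → m ∣ g S) → m ∣ altSum B g - g []
    altSum-∣-diff []      {g} d = ∣-resp-≡ (sym (ℤ.+-inverseʳ (g []))) ∣0
    altSum-∣-diff (x ∷ B) {g} d =
      ∣-resp-≡ (lemma (altSum B (λ S → g S - g (x ∷ S))) (g []) (g (x ∷ [])))
        (∣m∣n⇒∣m-n
          (altSum-∣-diff B (λ S⊆ S≢ → ∣m∣n⇒∣m-n (d (x ∷ʳ S⊆) S≢) (d (refl ∷ S⊆) (λ ()))))
          (d (refl ∷ minimum B) (λ ())))
      where
      lemma : ∀ a b c → (a - (b - c)) - c ≡ a - b
      lemma = solve-∀

  -- Arithmetic modulo a prime, and Olson's theorem on zero-sum sublists.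

  module Modulo (p : ℕ) (isPrime : Prime p) where

    private instance
      p≢0 : ℕ.NonZero p
      p≢0 = prime⇒nonZero isPrime

    P : ℤ
    P = + p

    prime-∣* : ∀ a b → P ∣ a * b → P ∣ a ⊎ P ∣ b
    prime-∣* a b d with euclidsLemma ℤ.∣ a ∣ ℤ.∣ b ∣ isPrime (subst (p ℕ.∣_) (ℤ.abs-* a b) (∣⇒∣ᵤ d))
    ... | inj₁ d₁ = inj₁ (∣ᵤ⇒∣ d₁)
    ... | inj₂ d₂ = inj₂ (∣ᵤ⇒∣ d₂)

    P∤1 : ¬ P ∣ 1ℤ
    P∤1 d = ℕ.>⇒∤ (ℕ.nonTrivial⇒n>1 p {{prime⇒nonTrivial isPrime}}) (∣⇒∣ᵤ d)

    P∤small : ∀ {i} .{{_ : ℕ.NonZero i}} → i ℕ.< p → ¬ P ∣ + i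
    P∤small i<p d = ℕ.>⇒∤ i<p (∣⇒∣ᵤ d)

    P∤∏ : ∀ (xs : List A) {f} → (∀ {x} → x ∈ xs → ¬ P ∣ f x) → ¬ P ∣ ∏ xs f
    P∤∏ []       h d = P∤1 d
    P∤∏ (x ∷ xs) h d with prime-∣* _ _ d
    ... | inj₁ d₁ = h (here refl) d₁
    ... | inj₂ d₂ = P∤∏ xs (λ x∈ → h (there x∈)) d₂

    nonzeroResidues : List ℤ
    nonzeroResidues = map (λ i → + suc i) (upTo (ℕ.pred p))

    -- Up to a nonzero constant, the indicator of divisibility by p (in place of 1 - z^(p-1)).
    ι : ℤ → ℤ
    ι z = ∏ nonzeroResidues (λ r → z - r)

    length-residues : length nonzeroResidues ≡ ℕ.pred p
    length-residues = trans (List.length-map _ (upTo (ℕ.pred p))) (List.length-upTo (ℕ.pred p))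

    ∈-residues⁻ : ∀ {r} → r ∈ nonzeroResidues → ¬ P ∣ r
    ∈-residues⁻ r∈ with ∈-map⁻ _ r∈
    ... | i , i∈ , refl = P∤small (ℕ.≤-<-trans (∈-upTo⁻ i∈) (ℕ.≤-reflexive (ℕ.suc-pred p)))

    ι-zero : ∀ {z} → P ∣ z → ¬ P ∣ ι z
    ι-zero {z} d = P∤∏ nonzeroResidues λ {r} r∈ e →
      ∈-residues⁻ r∈ (∣-resp-≡ (lemma z r) (∣m∣n⇒∣m-n d e))
      where
      lemma : ∀ z r → z - (z - r) ≡ r
      lemma = solve-∀

    ι-nonzero : ∀ {z} → ¬ P ∣ z → P ∣ ι z
    ι-nonzero {z} nd with z ℤ.%ℕ p | z ℤ./ℕ p | ℤ.a≡a%ℕn+[a/ℕn]*n z p | ℤ.n%ℕd<d z p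
    ... | zero  | k | z≡ | _  = ⊥-elim (nd (divides k (trans z≡ (ℤ.+-identityˡ (k * P)))))
    ... | suc r | k | z≡ | r< =
      ∏-∣ (∈-map⁺ _ (∈-upTo⁺ (ℕ.≤-pred (subst (suc r ℕ.<_) (sym (ℕ.suc-pred p)) r<))))
          (divides k (trans (cong (_- (+ suc r)) z≡) (lemma (+ suc r) (k * P))))
      where
      lemma : ∀ a b → (a + b) - a ≡ b
      lemma = solve-∀

    ι-cong : ∀ {a b} → P ∣ a - b → P ∣ ι a - ι b
    ι-cong {a} {b} d = ∏-∣-diff nonzeroResidues (λ r → ∣-resp-≡ (lemma a b r) d)
      where
      lemma : ∀ a b r → a - b ≡ (a - r) - (b - r)
      lemma = solve-∀

    module _ {E : Set} where
      open Cube {E}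

      Vanish : List (E → ℤ) → List E → Set
      Vanish gs X = All (λ g → P ∣ ∑ X g) gs

      vanish? : ∀ gs X → Dec (Vanish gs X)
      vanish? gs X = All.all? (λ g → P ∣? ∑ X g) gs

      private
        χ : List (E → ℤ) → List E → ℤ
        χ gs S = ∏ gs (λ g → ι (∑ S g))

        χ-poly : ∀ gs → Poly (length gs ℕ.* ℕ.pred p) (χ gs)
        χ-poly []       = const 1ℤ
        χ-poly (g ∷ gs) = subst (λ k → Poly (k ℕ.+ length gs ℕ.* ℕ.pred p) (χ (g ∷ gs))) length-residues
                            (forms nonzeroResidues)
          where
          forms : ∀ rs → Poly (length rs ℕ.+ length gs ℕ.* ℕ.pred p)
                           (λ S → ∏ rs (λ r → ∑ S g - r) * χ gs S)
          forms []       = ext (λ S → sym (ℤ.*-identityˡ _)) (χ-poly gs)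
          forms (r ∷ rs) = ext (λ S → lemma r (∑ S g) (∏ rs (λ r → ∑ S g - r)) (χ gs S))
                               (mul (- r) g (forms rs))
            where
            lemma : ∀ r s a b → (- r + s) * (a * b) ≡ ((s - r) * a) * b
            lemma = solve-∀

      -- Otherwise χ would be, up to a constant, the indicator of the empty sublist, whose alternating sum
      -- is 1; but the alternating sum of a polynomial of degree below length B is 0.
      zeroSumSublist : ∀ (gs : List (E → ℤ)) (B : List E) → length gs ℕ.* ℕ.pred p ℕ.< length B →
        ∃ λ X → X ⊑ B × X ≢ [] × Vanish gs X
      zeroSumSublist gs B big with any? (λ X → nonempty? X ×-dec vanish? gs X) (subs B)
        where
        nonempty? : ∀ (X : List E) → Dec (X ≢ [])
        nonempty? []      = no (λ ne → ne refl)
        nonempty? (_ ∷ _) = yes (λ ())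
      ... | yes found = let X , X∈ , ne , v = find found in X , ∈-subs⁻ X∈ , ne , v
      ... | no none = ⊥-elim (P∤∏ gs (λ _ → ι-zero ∣0) (∣-resp-≡ (neg (χ gs []))
                       (∣m⇒∣-m (∣-resp-≡ (cong (_- χ gs []) (altSum-poly B (χ-poly gs) big))
                         (altSum-∣-diff B zeros)))))
        where
        neg : ∀ a → - (0ℤ - a) ≡ a
        neg = solve-∀
        zeros : ∀ {S} → S ⊑ B → S ≢ [] → P ∣ χ gs S
        zeros {S} S⊆ S≢ with All.all? (λ g → P ∣? ∑ S g) gs
        ... | yes v = ⊥-elim (none (lose (∈-subs⁺ S⊆) (S≢ , v)))
        ... | no ¬v = let g , g∈ , nd = find (All.¬All⇒Any¬ (λ g → P ∣? ∑ S g) gs ¬v)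
                      in ∏-∣ g∈ (ι-nonzero nd)

  -- Enumeration of the monomials of bounded degree.

  module Multisets {I : Set} (_≟_ : DecidableEquality I) where

    multisets : List I → ℕ → List (List I)
    multisets []       d       = [] ∷ []
    multisets (c ∷ cs) zero    = [] ∷ []
    multisets (c ∷ cs) (suc d) = multisets cs (suc d) ++ map (c ∷_) (multisets (c ∷ cs) d)

    length-multisets : ∀ cs d → length (multisets cs d) ℕ.≤ 2 ℕ.^ (length cs ℕ.+ d)
    length-multisets []       d       = ℕ.m^n>0 2 d
    length-multisets (c ∷ cs) zero    = ℕ.m^n>0 2 (suc (length cs ℕ.+ 0))
    length-multisets (c ∷ cs) (suc d) = begin
      length (multisets cs (suc d) ++ map (c ∷_) (multisets (c ∷ cs) d))
        ≡⟨ List.length-++ (multisets cs (suc d)) ⟩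
      length (multisets cs (suc d)) ℕ.+ length (map (c ∷_) (multisets (c ∷ cs) d))
        ≡⟨ cong (length (multisets cs (suc d)) ℕ.+_) (List.length-map (c ∷_) (multisets (c ∷ cs) d)) ⟩
      length (multisets cs (suc d)) ℕ.+ length (multisets (c ∷ cs) d)
        ≤⟨ ℕ.+-mono-≤ (length-multisets cs (suc d)) (length-multisets (c ∷ cs) d) ⟩
      2 ℕ.^ (length cs ℕ.+ suc d) ℕ.+ 2 ℕ.^ (suc (length cs) ℕ.+ d)
        ≡⟨ cong (λ k → 2 ℕ.^ (length cs ℕ.+ suc d) ℕ.+ 2 ℕ.^ k) (sym (ℕ.+-suc (length cs) d)) ⟩
      2 ℕ.^ (length cs ℕ.+ suc d) ℕ.+ 2 ℕ.^ (length cs ℕ.+ suc d)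
        ≡⟨ cong (2 ℕ.^ (length cs ℕ.+ suc d) ℕ.+_) (sym (ℕ.+-identityʳ _)) ⟩
      2 ℕ.^ suc (length cs ℕ.+ suc d) ∎
      where open ℕ.≤-Reasoning

    ∏-extract : ∀ {c} {rs : List I} → c ∈ rs →
      ∃ λ rs′ → length rs ≡ suc (length rs′) × (∀ {x} → x ∈ rs′ → x ∈ rs) ×
                (∀ f → ∏ rs f ≡ f c * ∏ rs′ f)
    ∏-extract {rs = r ∷ rs} (here refl) = rs , refl , there , λ f → refl
    ∏-extract {c} {rs = r ∷ rs} (there c∈) with rs′ , len , sub , eq ← ∏-extract c∈ =
      r ∷ rs′ , cong suc len , (λ { (here e) → here e ; (there x∈) → there (sub x∈) }) ,
      λ f → trans (cong (f r *_) (eq f)) (lemma (f r) (f c) (∏ rs′ f))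
      where
      lemma : ∀ a b c → a * (b * c) ≡ b * (a * c)
      lemma = solve-∀

    -- The list found is in general a rearrangement of `rs`; agreement of the products is all that
    -- monomials require.
    multisets-complete : ∀ cs d rs → length rs ℕ.≤ d → (∀ {x} → x ∈ rs → x ∈ cs) →
      ∃ λ ms → ms ∈ multisets cs d × (∀ f → ∏ ms f ≡ ∏ rs f)
    multisets-complete []       d       []       _ _   = [] , here refl , λ f → refl
    multisets-complete []       d       (r ∷ rs) _ sub with () ← sub (here refl)
    multisets-complete (c ∷ cs) = go
      where
      go : ∀ d rs → length rs ℕ.≤ d → (∀ {x} → x ∈ rs → x ∈ c ∷ cs) →
        ∃ λ ms → ms ∈ multisets (c ∷ cs) d × (∀ f → ∏ ms f ≡ ∏ rs f)
      go zero    [] _ _   = [] , here refl , λ f → refl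
      go (suc d) rs l sub with any? (c ≟_) rs
      ... | yes c∈ =
        let rs′ , len , sub′ , eq = ∏-extract c∈
            ms , ms∈ , eq′ = go d rs′ (ℕ.≤-pred (ℕ.≤-trans (ℕ.≤-reflexive (sym len)) l))
                                (λ x∈ → sub (sub′ x∈))
        in c ∷ ms , ∈-++⁺ʳ (multisets cs (suc d)) (∈-map⁺ (c ∷_) ms∈) ,
           λ f → trans (cong (f c *_) (eq′ f)) (sym (eq f))
      ... | no c∉ =
        let ms , ms∈ , eq = multisets-complete cs (suc d) rs l sub′ in ms , ∈-++⁺ˡ ms∈ , eq
        where
        sub′ : ∀ {x} → x ∈ rs → x ∈ cs
        sub′ x∈ with sub x∈
        ... | here refl = ⊥-elim (c∉ x∈)
        ... | there x∈cs = x∈cs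

  -- Sums over the tuples in a weighted equation.

  module WeightedSums {E : Set} {_⊕_ : Op₂ E} {0# : E} {⊖_ : Op₁ E}
    (isAb : IsAbelianGroup _≡_ _⊕_ 0# ⊖_) where

    open IsAbelianGroup isAb public using (assoc; comm; identityˡ; identityʳ; inverseˡ; inverseʳ)

    _•_ : ℕ → E → E
    zero  • x = 0#
    suc k • x = x ⊕ (k • x)

    comb : List ℕ → List E → E
    comb (w ∷ ws) (y ∷ ys) = (w • y) ⊕ comb ws ys
    comb _        _        = 0#

    module _ (X : List E) where

      weightedSum : List ℕ → (E → ℤ) → ℤ
      weightedSum []       f = f 0#
      weightedSum (w ∷ ws) f = ∑ X (λ y → weightedSum ws (λ u → f ((w • y) ⊕ u)))

      weightedSum-cong : ∀ ws {f g} → (∀ u → f u ≡ g u) → weightedSum ws f ≡ weightedSum ws g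
      weightedSum-cong []       eq = eq 0#
      weightedSum-cong (w ∷ ws) eq = ∑-cong X (λ y → weightedSum-cong ws (λ u → eq _))

      weightedSum-linear : ∀ ws k f g →
        weightedSum ws (λ u → k * f u + g u) ≡ k * weightedSum ws f + weightedSum ws g
      weightedSum-linear []       k f g = refl
      weightedSum-linear (w ∷ ws) k f g =
        trans (∑-cong X (λ y → weightedSum-linear ws k _ _))
          (trans (∑-+ X _ _) (cong (_+ _) (∑-* X k _)))

      weightedSum-∣-diff : ∀ {m} ws {f g} → (∀ u → m ∣ f u - g u) →
        m ∣ weightedSum ws f - weightedSum ws g
      weightedSum-∣-diff []       d = d 0#
      weightedSum-∣-diff (w ∷ ws) d = ∑-∣-diff X (λ {y} _ → weightedSum-∣-diff ws (λ u → d _))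

      weightedSum-∣ : ∀ {m} ws {f} →
        (∀ ys → length ys ≡ length ws → (∀ {y} → y ∈ ys → y ∈ X) → m ∣ f (comb ws ys)) →
        m ∣ weightedSum ws f
      weightedSum-∣ []       d = d [] refl (λ ())
      weightedSum-∣ (w ∷ ws) d = ∑-∣ X λ {y} y∈ → weightedSum-∣ ws λ ys len sub →
        d (y ∷ ys) (cong suc len) (λ { (here refl) → y∈ ; (there z∈) → sub z∈ })

  -- Sublists with vanishing moments, and products of few affine forms.

  module Moments (p : ℕ) (isPrime : Prime p) {E : Set} {_⊕_ : Op₂ E} {0# : E} {⊖_ : Op₁ E}
    (isAb : IsAbelianGroup _≡_ _⊕_ 0# ⊖_) (n : ℕ) (φ : Fin n → E → ℤ)
    (φ-+ : ∀ r x y → + p ∣ φ r (x ⊕ y) - (φ r x + φ r y))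
    (φ-0 : ∀ r → + p ∣ φ r 0#)
    (φ-kernel : ∀ x → (∀ r → + p ∣ φ r x) → x ≡ 0#) where

    open Modulo p isPrime
    open WeightedSums isAb
    open Multisets (Fin._≟_ {n})

    φ-• : ∀ r k x → P ∣ φ r (k • x) - + k * φ r x
    φ-• r zero    x = ∣-resp-≡ (sym (ℤ.+-identityʳ _)) (φ-0 r)
    φ-• r (suc k) x = ∣-resp-≡ (lemma (φ r (x ⊕ (k • x))) (φ r x) (φ r (k • x)) (+ k))
      (∣m∣n⇒∣m+n (φ-+ r x (k • x)) (φ-• r k x))
      where
      lemma : ∀ s a b k → (s - (a + b)) + (b - k * a) ≡ s - (1ℤ + k) * a
      lemma = solve-∀

    HasMoments : ℕ → List E → Set
    HasMoments d X = ∀ rs → length rs ℕ.≤ d → P ∣ ∑ X (λ y → ∏ rs (λ r → φ r y))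

    monomials : ℕ → List (E → ℤ)
    monomials d = map (λ ms y → ∏ ms (λ r → φ r y)) (multisets (allFin n) d)

    vanish⇒moments : ∀ {d X} → Vanish (monomials d) X → HasMoments d X
    vanish⇒moments {d} {X} v rs len with multisets-complete (allFin n) d rs len (λ _ → ∈-allFin _)
    ... | ms , ms∈ , eq = ∣-resp-≡ (∑-cong X (λ y → eq (λ r → φ r y))) (All.lookup (All.map⁻ v) ms∈)

    -- Olson's theorem with one linear condition per monomial of degree at most `d` in n
    -- coordinates; there are at most 2^(n+d) of these. The prime enters only as a factor, so for d
    -- = O(n) the base of the exponential in n is free of p.
    momentSublist : ∀ d (B : List E) → 2 ℕ.^ (n ℕ.+ d) ℕ.* p ℕ.≤ length B →
      ∃ λ X → X ⊑ B × X ≢ [] × HasMoments d X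
    momentSublist d B big =
      let X , X⊑ , X≢ , v = zeroSumSublist (monomials d) B bound in X , X⊑ , X≢ , vanish⇒moments {d} {X} v
      where
      instance _ = prime⇒nonZero isPrime
      open ℕ.≤-Reasoning
      bound : length (monomials d) ℕ.* ℕ.pred p ℕ.< length B
      bound = begin-strict
        length (monomials d) ℕ.* ℕ.pred p
          ≡⟨ cong (ℕ._* ℕ.pred p) (List.length-map _ (multisets (allFin n) d)) ⟩
        length (multisets (allFin n) d) ℕ.* ℕ.pred p
          ≤⟨ ℕ.*-monoˡ-≤ (ℕ.pred p) (length-multisets (allFin n) d) ⟩
        2 ℕ.^ (length (allFin n) ℕ.+ d) ℕ.* ℕ.pred p
          ≡⟨ cong (λ k → 2 ℕ.^ (k ℕ.+ d) ℕ.* ℕ.pred p) (List.length-tabulate {n = n} (λ i → i)) ⟩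
        2 ℕ.^ (n ℕ.+ d) ℕ.* ℕ.pred p
          <⟨ ℕ.*-monoʳ-< (2 ℕ.^ (n ℕ.+ d)) {{ℕ.m^n≢0 2 (n ℕ.+ d)}} (ℕ.≤-reflexive (ℕ.suc-pred p)) ⟩
        2 ℕ.^ (n ℕ.+ d) ℕ.* p
          ≤⟨ big ⟩
        length B ∎

    Form : Set
    Form = Fin n × ℤ

    ⟦_⟧ : Form → E → ℤ
    ⟦ r , c ⟧ u = φ r u - c

    module _ {d : ℕ} {X : List E} (moments : HasMoments d X) where

      -- Expanding a product of forms in the first variable, a term either has low degree in it
      -- and vanishes by the moment condition, or leaves a product of low degree in the others.
      lowDegree : ∀ ws fs → length fs ℕ.< length ws ℕ.* suc d →
        P ∣ weightedSum X ws (λ u → ∏ fs (λ f → ⟦ f ⟧ u))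
      expand : ∀ w ws rs fs gs →
        length rs ℕ.+ (length fs ℕ.+ length gs) ℕ.< suc (length ws) ℕ.* suc d →
        P ∣ ∑ X (λ y → ∏ rs (λ r → φ r y) *
              weightedSum X ws (λ u → ∏ fs (λ f → ⟦ f ⟧ ((w • y) ⊕ u)) * ∏ gs (λ f → ⟦ f ⟧ u)))

      lowDegree (w ∷ ws) fs small =
        ∣-resp-≡ (∑-cong X (λ y → trans (ℤ.*-identityˡ _)
                   (weightedSum-cong X ws (λ u → ℤ.*-identityʳ _))))
          (expand w ws [] fs [] (subst (ℕ._< _) (sym (ℕ.+-identityʳ (length fs))) small))

      expand w ws rs [] gs small = ∣-resp-≡ (sym factor) divisible
        where
        R : E → ℤ
        R y = ∏ rs (λ r → φ r y)
        G : E → ℤ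
        G u = ∏ gs (λ f → ⟦ f ⟧ u)
        factor : ∑ X (λ y → R y * weightedSum X ws (λ u → 1ℤ * G u)) ≡ weightedSum X ws G * ∑ X R
        factor = trans
          (∑-cong X (λ y → trans (cong (R y *_) (weightedSum-cong X ws (λ u → ℤ.*-identityˡ _)))
                                 (ℤ.*-comm (R y) _)))
          (∑-* X (weightedSum X ws G) R)
        divisible : P ∣ weightedSum X ws G * ∑ X R
        divisible with length rs ℕ.≤? d
        ... | yes rs≤d = ∣n⇒∣m*n (weightedSum X ws G) (moments rs rs≤d)
        -- More than `d` of the forms were spent on the first variable, so fewer than `length ws` ·
        -- (d + 1) are left for the others.
        ... | no  rs≰d = ∣m⇒∣m*n (∑ X R) (lowDegree ws gs (ℕ.+-cancelˡ-< (suc d) _ _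
                (ℕ.≤-<-trans (ℕ.+-monoˡ-≤ (length gs) (ℕ.≰⇒> rs≰d)) small)))
      -- Modulo p the form at w y + u is w · φ r y + (φ r u - c): the factor φ r y joins `rs`, or
      -- the form in u alone joins `gs`.
      expand w ws rs ((r , c) ∷ fs) gs small =
        diff-∣ (∑-∣-diff X (λ {y} _ → pointwise y))
          (∣-resp-≡ (sym (trans
              (∑-+ X (λ y → + w * ((φ r y * R y) * weightedSum X ws (F y)))
                     (λ y → R y * weightedSum X ws (F′ y)))
              (cong (_+ ∑ X (λ y → R y * weightedSum X ws (F′ y)))
                (∑-* X (+ w) (λ y → (φ r y * R y) * weightedSum X ws (F y))))))
            (∣m∣n⇒∣m+n
              (∣n⇒∣m*n (+ w) (expand w ws (r ∷ rs) fs gs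
                (subst (ℕ._< suc (length ws) ℕ.* suc d) (ℕ.+-suc (length rs) _) small)))
              (expand w ws rs fs ((r , c) ∷ gs)
                (subst (λ k → length rs ℕ.+ k ℕ.< suc (length ws) ℕ.* suc d)
                  (sym (ℕ.+-suc (length fs) (length gs))) small))))
        where
        R : E → ℤ
        R y = ∏ rs (λ r → φ r y)
        F : E → E → ℤ
        F y u = ∏ fs (λ f → ⟦ f ⟧ ((w • y) ⊕ u)) * ∏ gs (λ f → ⟦ f ⟧ u)
        F′ : E → E → ℤ
        F′ y u = ∏ fs (λ f → ⟦ f ⟧ ((w • y) ⊕ u)) * ((φ r u - c) * ∏ gs (λ f → ⟦ f ⟧ u))
        H : E → E → ℤ
        H y u = ((φ r ((w • y) ⊕ u) - c) * ∏ fs (λ f → ⟦ f ⟧ ((w • y) ⊕ u))) * ∏ gs (λ f → ⟦ f ⟧ u)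
        lemma₁ : ∀ s a b c w x f g →
          (s - (a + b)) * (f * g) + (a - w * x) * (f * g) ≡
          ((s - c) * f) * g - ((w * x) * (f * g) + f * ((b - c) * g))
        lemma₁ = solve-∀
        lemma₂ : ∀ t w x u v → t * ((w * x) * u + v) ≡ w * ((x * t) * u) + t * v
        lemma₂ = solve-∀
        lemma₃ : ∀ t a b → t * (a - b) ≡ t * a - t * b
        lemma₃ = solve-∀
        step : ∀ y u → P ∣ H y u - ((+ w * φ r y) * F y u + F′ y u)
        step y u = ∣-resp-≡
          (lemma₁ (φ r ((w • y) ⊕ u)) (φ r (w • y)) (φ r u) c (+ w) (φ r y)
            (∏ fs (λ f → ⟦ f ⟧ ((w • y) ⊕ u))) (∏ gs (λ f → ⟦ f ⟧ u)))
          (∣m∣n⇒∣m+n (∣m⇒∣m*n _ (φ-+ r (w • y) u)) (∣m⇒∣m*n _ (φ-• r w y)))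
        pointwise : ∀ y → P ∣ R y * weightedSum X ws (H y) -
          (+ w * ((φ r y * R y) * weightedSum X ws (F y)) + R y * weightedSum X ws (F′ y))
        pointwise y = ∣-resp-≡
          (trans (lemma₃ (R y) (weightedSum X ws (H y)) _)
            (cong (λ k → R y * weightedSum X ws (H y) - k)
              (trans (cong (R y *_) (weightedSum-linear X ws (+ w * φ r y) (F y) (F′ y)))
                (lemma₂ (R y) (+ w) (φ r y) (weightedSum X ws (F y)) (weightedSum X ws (F′ y))))))
          (∣n⇒∣m*n (R y) (weightedSum-∣-diff X ws (step y)))

  ∑-const : ∀ (xs : List A) c → ∑ xs (λ _ → c) ≡ + length xs * c
  ∑-const []       c = sym (ℤ.*-zeroˡ c)
  ∑-const (x ∷ xs) c = trans (cong (λ k → c + k) (∑-const xs c)) (lemma c (+ length xs))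
    where
    lemma : ∀ c l → c + l * c ≡ (1ℤ + l) * c
    lemma = solve-∀

  -- Sums over tuples of distinct elements, and inclusion-exclusion.

  module Distinct {E : Set} (_≟_ : DecidableEquality E) {_⊕_ : Op₂ E} {0# : E} {⊖_ : Op₁ E}
    (isAb : IsAbelianGroup _≡_ _⊕_ 0# ⊖_) (X : List E) (X-unique : Unique X) where

    open WeightedSums isAb
    open ListSums isAb using (⊕-left-comm)
    open import Data.List.Membership.DecPropositional _≟_ using (_∈?_)

    •-+ : ∀ a b x → (a ℕ.+ b) • x ≡ (a • x) ⊕ (b • x)
    •-+ zero    b x = sym (identityˡ _)
    •-+ (suc a) b x = trans (cong (x ⊕_) (•-+ a b x)) (sym (assoc x (a • x) (b • x)))

    weightedSum-↭ : ∀ {ws ws′} f → ws ↭ ws′ → weightedSum X ws f ≡ weightedSum X ws′ f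
    weightedSum-↭ f Perm.refl = refl
    weightedSum-↭ f (Perm.prep w ↭) = ∑-cong X (λ y → weightedSum-↭ _ ↭)
    weightedSum-↭ f (Perm.swap {xs} {ys} v w ↭) =
      trans (∑-cong X (λ y → ∑-cong X (λ z →
              trans (weightedSum-cong X xs (λ u → cong f (⊕-left-comm _ _ _))) (weightedSum-↭ _ ↭))))
            (∑-comm X X (λ y z → weightedSum X ys (λ u → f ((w • z) ⊕ ((v • y) ⊕ u)))))
    weightedSum-↭ f (Perm.trans ↭₁ ↭₂) = trans (weightedSum-↭ f ↭₁) (weightedSum-↭ f ↭₂)

    restrict : List E → (E → ℤ) → E → ℤ
    restrict ys h y = if does (y ∈? ys) then 0ℤ else h y

    distinctSum : ℕ → (List E → ℤ) → ℤ
    distinctSum zero    g = g []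
    distinctSum (suc j) g = distinctSum j (λ ys → ∑ X (restrict ys (λ y → g (y ∷ ys))))

    record Tuple (j : ℕ) (ys : List E) : Set where
      constructor tuple
      field
        len    : length ys ≡ j
        unique : Unique ys
        subset : ∀ {y} → y ∈ ys → y ∈ X

    extend : ∀ {j ys y} → Tuple j ys → y ∈ X → y ∉ ys → Tuple (suc j) (y ∷ ys)
    extend (tuple len u sub) y∈ y∉ =
      tuple (cong suc len) (All.¬Any⇒All¬ _ y∉ ∷ u) (λ { (here refl) → y∈ ; (there z∈) → sub z∈ })

    restrict-cong : ∀ ys y {g h : E → ℤ} → (y ∉ ys → g y ≡ h y) → restrict ys g y ≡ restrict ys h y
    restrict-cong ys y eq with y ∈? ys
    ... | yes _ = refl
    ... | no y∉ = eq y∉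

    distinctSum-cong : ∀ j {g h} → (∀ {ys} → Tuple j ys → g ys ≡ h ys) →
      distinctSum j g ≡ distinctSum j h
    distinctSum-cong zero    eq = eq (tuple refl [] (λ ()))
    distinctSum-cong (suc j) {g} {h} eq = distinctSum-cong j λ {ys} t → ∑-cong∈ X λ {y} y∈ →
      restrict-cong ys y {λ y → g (y ∷ ys)} {λ y → h (y ∷ ys)} (λ y∉ → eq (extend t y∈ y∉))

    distinctSum-∣ : ∀ {m} j {g} → (∀ {ys} → Tuple j ys → m ∣ g ys) → m ∣ distinctSum j g
    distinctSum-∣ zero    d = d (tuple refl [] (λ ()))
    distinctSum-∣ {m} (suc j) {g} d = distinctSum-∣ j λ {ys} t → ∑-∣ X λ {y} y∈ → pointwise t y∈
      where
      pointwise : ∀ {ys y} → Tuple j ys → y ∈ X → m ∣ restrict ys (λ y → g (y ∷ ys)) y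
      pointwise {ys} {y} t y∈ with y ∈? ys
      ... | yes _ = ∣0
      ... | no y∉ = d (extend t y∈ y∉)

    distinctSum-linear : ∀ j k g h →
      distinctSum j (λ ys → k * g ys + h ys) ≡ k * distinctSum j g + distinctSum j h
    distinctSum-linear zero    k g h = refl
    distinctSum-linear (suc j) k g h = trans
      (distinctSum-cong j (λ {ys} _ → trans (∑-cong X (pointwise ys))
        (trans (∑-+ X _ _) (cong (_+ _) (∑-* X k (restrict ys (λ y → g (y ∷ ys))))))))
      (distinctSum-linear j k _ _)
      where
      pointwise : ∀ ys y → restrict ys (λ y → k * g (y ∷ ys) + h (y ∷ ys)) y ≡
        k * restrict ys (λ y → g (y ∷ ys)) y + restrict ys (λ y → h (y ∷ ys)) y
      pointwise ys y with does (y ∈? ys)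
      ... | true  = sym (trans (ℤ.+-identityʳ _) (ℤ.*-zeroʳ k))
      ... | false = refl

    distinctSum-∑ : ∀ j (xs : List A) (g : A → List E → ℤ) →
      distinctSum j (λ ys → ∑ xs (λ x → g x ys)) ≡ ∑ xs (λ x → distinctSum j (g x))
    distinctSum-∑ j []       g = zeros j
      where
      zeros : ∀ j → distinctSum j (λ _ → 0ℤ) ≡ 0ℤ
      zeros zero    = refl
      zeros (suc j) = trans (distinctSum-cong j (λ {ys} _ → trans (∑-cong X (λ y → if-same ys y)) (∑-zero X)))
                            (zeros j)
        where
        if-same : ∀ ys y → restrict ys (λ _ → 0ℤ) y ≡ 0ℤ
        if-same ys y with does (y ∈? ys)
        ... | true  = refl
        ... | false = refl
    distinctSum-∑ j (x ∷ xs) g = trans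
      (distinctSum-cong j (λ {ys} _ → cong (_+ ∑ xs (λ x → g x ys)) (sym (ℤ.*-identityˡ (g x ys)))))
      (trans (distinctSum-linear j 1ℤ (g x) (λ ys → ∑ xs (λ x → g x ys)))
        (cong₂ _+_ (ℤ.*-identityˡ (distinctSum j (g x))) (distinctSum-∑ j xs g)))

    ∑-≡ : ∀ {ys : List E} {z} → Unique ys → z ∈ ys → ∀ (h : E → ℤ) →
      ∑ ys (λ y → if does (y ≟ z) then h y else 0ℤ) ≡ h z
    ∑-≡ {z ∷ ys} {z} (z∉ ∷ u) (here refl) h rewrite dec-true (z ≟ z) refl =
      trans (cong (λ k → h z + k) (trans (∑-cong∈ ys zero-off) (∑-zero ys))) (ℤ.+-identityʳ _)
      where
      zero-off : ∀ {y} → y ∈ ys → (if does (y ≟ z) then h y else 0ℤ) ≡ 0ℤ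
      zero-off {y} y∈ rewrite dec-false (y ≟ z) (λ e → All.lookup z∉ y∈ (sym e)) = refl
    ∑-≡ {y ∷ ys} {z} (y∉ ∷ u) (there z∈) h
      rewrite dec-false (y ≟ z) (λ e → All.lookup y∉ z∈ e) = trans (ℤ.+-identityˡ _) (∑-≡ u z∈ h)

    ∑-restrict : ∀ {ys} → Unique ys → (∀ {y} → y ∈ ys → y ∈ X) → ∀ h →
      ∑ X (restrict ys h) ≡ ∑ X h - ∑ ys h
    ∑-restrict {[]}     _        _   h = sym (ℤ.+-identityʳ _)
    ∑-restrict {z ∷ ys} (z∉ ∷ u) sub h = begin
      ∑ X (restrict (z ∷ ys) h)
        ≡⟨ ∑-cong X pointwise ⟩
      ∑ X (λ y → restrict ys h y + - 1ℤ * (if does (y ≟ z) then h y else 0ℤ))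
        ≡⟨ ∑-+ X _ _ ⟩
      ∑ X (restrict ys h) + ∑ X (λ y → - 1ℤ * (if does (y ≟ z) then h y else 0ℤ))
        ≡⟨ cong₂ _+_ (∑-restrict u (sub ∘ there) h)
             (trans (∑-* X (- 1ℤ) _) (cong (- 1ℤ *_) (∑-≡ X-unique (sub (here refl)) h))) ⟩
      (∑ X h - ∑ ys h) + - 1ℤ * h z
        ≡⟨ lemma (∑ X h) (∑ ys h) (h z) ⟩
      ∑ X h - (h z + ∑ ys h) ∎
      where
      open ≡-Reasoning
      lemma : ∀ a b c → (a - b) + - 1ℤ * c ≡ a - (c + b)
      lemma = solve-∀
      neg : ∀ a → 0ℤ ≡ a + - 1ℤ * a
      neg = solve-∀
      pointwise : ∀ y → restrict (z ∷ ys) h y ≡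
        restrict ys h y + - 1ℤ * (if does (y ≟ z) then h y else 0ℤ)
      pointwise y with y ≟ z
      ... | yes refl rewrite dec-false (y ∈? ys) (λ y∈ → All.lookup z∉ y∈ refl) = neg (h y)
      ... | no  y≢z with does (y ∈? ys)
      ...   | true  = refl
      ...   | false = sym (ℤ.+-identityʳ _)

    merges : ℕ → List ℕ → List (List ℕ)
    merges a []       = []
    merges a (b ∷ bs) = ((a ℕ.+ b) ∷ bs) ∷ map (b ∷_) (merges a bs)

    length-merges : ∀ a bs → length (merges a bs) ≡ length bs
    length-merges a []       = refl
    length-merges a (b ∷ bs) = cong suc (trans (List.length-map (b ∷_) (merges a bs)) (length-merges a bs))

    ∈-merges : ∀ {a bs cs} → cs ∈ merges a bs → length cs ≡ length bs × sum cs ≡ a ℕ.+ sum bs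
    ∈-merges {a} {b ∷ bs} (here refl) = refl , ℕ.+-assoc a b (sum bs)
    ∈-merges {a} {b ∷ bs} (there cs∈) with ∈-map⁻ (b ∷_) cs∈
    ... | ds , ds∈ , refl with ∈-merges ds∈
    ...   | len , s = cong suc len , trans (cong (b ℕ.+_) s) (lemma b a (sum bs))
      where
      lemma : ∀ b a s → b ℕ.+ (a ℕ.+ s) ≡ a ℕ.+ (b ℕ.+ s)
      lemma = ℕSolver.solve-∀

    merges-positive : ∀ {a bs cs} → All (1 ℕ.≤_) bs → cs ∈ merges a bs → All (1 ℕ.≤_) cs
    merges-positive {a} {b ∷ bs} (b≥1 ∷ bs≥1) (here refl) = ℕ.≤-trans b≥1 (ℕ.m≤n+m b a) ∷ bs≥1
    merges-positive {a} {b ∷ bs} (b≥1 ∷ bs≥1) (there cs∈) with ∈-map⁻ (b ∷_) cs∈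
    ... | ds , ds∈ , refl = b≥1 ∷ merges-positive bs≥1 ds∈

    ∑-merges : ∀ a bs ys (h : E → ℤ) → length ys ≡ length bs →
      ∑ ys (λ y → h ((a • y) ⊕ comb bs ys)) ≡ ∑ (merges a bs) (λ cs → h (comb cs ys))
    ∑-merges a []       []       h len = refl
    ∑-merges a (b ∷ bs) (y ∷ ys) h len = cong₂ _+_
      (cong h (trans (sym (assoc _ _ _)) (cong (_⊕ comb bs ys) (sym (•-+ a b y)))))
      (begin
        ∑ ys (λ z → h ((a • z) ⊕ ((b • y) ⊕ comb bs ys)))
          ≡⟨ ∑-cong ys (λ z → cong h (⊕-left-comm _ _ _)) ⟩
        ∑ ys (λ z → h ((b • y) ⊕ ((a • z) ⊕ comb bs ys)))
          ≡⟨ ∑-merges a bs ys (λ v → h ((b • y) ⊕ v)) (ℕ.suc-injective len) ⟩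
        ∑ (merges a bs) (λ cs → h ((b • y) ⊕ comb cs ys))
          ≡⟨ sym (∑-map (b ∷_) (merges a bs) _) ⟩
        ∑ (map (b ∷_) (merges a bs)) (λ cs → h (comb cs (y ∷ ys))) ∎)
      where open ≡-Reasoning

    module _ (f : E → ℤ) where

      mixedSum : ℕ → List ℕ → List ℕ → ℤ
      mixedSum j as ws = distinctSum j (λ ys → weightedSum X ws (λ u → f (comb as ys ⊕ u)))

      -- Inclusion–exclusion on the last variable: a coincidence with an earlier one adds its weight there.
      mixedSum-step : ∀ j a as ws → length as ≡ j →
        mixedSum (suc j) (a ∷ as) ws ≡
        mixedSum j as (a ∷ ws) - ∑ (merges a as) (λ cs → mixedSum j cs ws)
      mixedSum-step j a as ws len = begin
        distinctSum j (λ ys → ∑ X (restrict ys (λ y → W (comb (a ∷ as) (y ∷ ys)))))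
          ≡⟨ distinctSum-cong j (λ {ys} t → pointwise ys t) ⟩
        distinctSum j (λ ys → - 1ℤ * ∑ (merges a as) (λ cs → W (comb cs ys)) +
                              weightedSum X (a ∷ ws) (λ u → f (comb as ys ⊕ u)))
          ≡⟨ distinctSum-linear j (- 1ℤ) _ _ ⟩
        - 1ℤ * distinctSum j (λ ys → ∑ (merges a as) (λ cs → W (comb cs ys))) + mixedSum j as (a ∷ ws)
          ≡⟨ cong (λ k → - 1ℤ * k + mixedSum j as (a ∷ ws))
               (distinctSum-∑ j (merges a as) (λ cs ys → W (comb cs ys))) ⟩
        - 1ℤ * ∑ (merges a as) (λ cs → mixedSum j cs ws) + mixedSum j as (a ∷ ws)
          ≡⟨ lemma (∑ (merges a as) (λ cs → mixedSum j cs ws)) (mixedSum j as (a ∷ ws)) ⟩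
        mixedSum j as (a ∷ ws) - ∑ (merges a as) (λ cs → mixedSum j cs ws) ∎
        where
        open ≡-Reasoning
        lemma : ∀ x y → - 1ℤ * x + y ≡ y - x
        lemma = solve-∀
        W : E → ℤ
        W v = weightedSum X ws (λ u → f (v ⊕ u))
        pointwise : ∀ ys → Tuple j ys → ∑ X (restrict ys (λ y → W ((a • y) ⊕ comb as ys))) ≡
          - 1ℤ * ∑ (merges a as) (λ cs → W (comb cs ys)) + weightedSum X (a ∷ ws) (λ u → f (comb as ys ⊕ u))
        pointwise ys t = begin
          ∑ X (restrict ys (λ y → W ((a • y) ⊕ comb as ys)))
            ≡⟨ ∑-restrict (Tuple.unique t) (Tuple.subset t) _ ⟩
          ∑ X (λ y → W ((a • y) ⊕ comb as ys)) - ∑ ys (λ y → W ((a • y) ⊕ comb as ys))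
            ≡⟨ cong₂ _-_
                 (∑-cong X (λ y → weightedSum-cong X ws (λ u → cong f
                   (trans (assoc (a • y) (comb as ys) u) (⊕-left-comm _ _ _)))))
                 (∑-merges a as ys W (trans (Tuple.len t) (sym len))) ⟩
          weightedSum X (a ∷ ws) (λ u → f (comb as ys ⊕ u)) - ∑ (merges a as) (λ cs → W (comb cs ys))
            ≡⟨ sym (lemma (∑ (merges a as) (λ cs → W (comb cs ys)))
                          (weightedSum X (a ∷ ws) (λ u → f (comb as ys ⊕ u)))) ⟩
          - 1ℤ * ∑ (merges a as) (λ cs → W (comb cs ys)) +
            weightedSum X (a ∷ ws) (λ u → f (comb as ys ⊕ u)) ∎

      -- This is (-1)^j j!, the Möbius function of the lattice of partitions of j + 1 points between
      -- its bottom and its top, hence the coefficient of the total coincidence of j + 1 variables.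
      -- It is prime to p for j < p.
      signedFactorial : ℕ → ℤ
      signedFactorial zero    = 1ℤ
      signedFactorial (suc j) = - (+ suc j * signedFactorial j)

      -- All terms but the one merging everything refine the weight further, and vanish by assumption.
      mixedSum-≡ : ∀ {m} j as ws → length as ≡ suc j → All (1 ℕ.≤_) as → All (1 ℕ.≤_) ws →
        (∀ vs → All (1 ℕ.≤_) vs → sum vs ≡ sum as ℕ.+ sum ws → 2 ℕ.+ length ws ℕ.≤ length vs →
          m ∣ weightedSum X vs f) →
        m ∣ mixedSum (suc j) as ws - signedFactorial j * weightedSum X (sum as ∷ ws) f
      mixedSum-≡ zero (a ∷ []) ws _ _ _ _ = ∣-resp-≡ (sym (trans (cong₂ _-_ same (ℤ.*-identityˡ _))
                                                (ℤ.+-inverseʳ (weightedSum X ((a ℕ.+ 0) ∷ ws) f)))) ∣0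
        where
        same : mixedSum 1 (a ∷ []) ws ≡ weightedSum X ((a ℕ.+ 0) ∷ ws) f
        same = ∑-cong X (λ y → weightedSum-cong X ws (λ u → cong f (cong (_⊕ u)
                 (trans (identityʳ _) (cong (_• y) (sym (ℕ.+-identityʳ a)))))))
      mixedSum-≡ {m} (suc j) (a ∷ as) ws len (a≥1 ∷ as≥1) ws≥1 fine =
        ∣-resp-≡ (sym rearrange) (∣m∣n⇒∣m-n first second)
        where
        open ≡-Reasoning
        W : ℤ
        W = weightedSum X (sum (a ∷ as) ∷ ws) f
        c : ℤ
        c = signedFactorial j
        len′ : length as ≡ suc j
        len′ = ℕ.suc-injective len
        -- Here `a` has become a free variable. Even when all of `as` merge, 2 + `length ws`
        -- variables remain, so the main term vanishes by `fine`.
        first : m ∣ mixedSum (suc j) as (a ∷ ws)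
        first = diff-∣ (mixedSum-≡ j as (a ∷ ws) len′ as≥1 (a≥1 ∷ ws≥1)
            (λ vs vs≥1 s l → fine vs vs≥1 (trans s (lemma (sum as) a (sum ws))) (ℕ.≤-trans (ℕ.n≤1+n _) l)))
          (∣n⇒∣m*n c (fine (sum as ∷ a ∷ ws) (positive len′ as≥1 ∷ a≥1 ∷ ws≥1)
            (lemma (sum as) a (sum ws)) ℕ.≤-refl))
          where
          lemma : ∀ s a w → s ℕ.+ (a ℕ.+ w) ≡ (a ℕ.+ s) ℕ.+ w
          lemma = ℕSolver.solve-∀
          positive : ∀ {as j} → length as ≡ suc j → All (1 ℕ.≤_) as → 1 ℕ.≤ sum as
          positive {b ∷ bs} _ (b≥1 ∷ _) = ℕ.≤-trans b≥1 (ℕ.m≤m+n b (sum bs))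
        -- Each of the `suc j` merges contributes c · W, which turns `signedFactorial j` into
        -- `signedFactorial (suc j)`.
        second : m ∣ ∑ (merges a as) (λ cs → mixedSum (suc j) cs ws) - ∑ (merges a as) (λ _ → c * W)
        second = ∑-∣-diff (merges a as) λ {cs} cs∈ → let l , s = ∈-merges cs∈ in
          subst (λ w → m ∣ mixedSum (suc j) cs ws - c * weightedSum X (w ∷ ws) f) s
            (mixedSum-≡ j cs ws (trans l len′) (merges-positive as≥1 cs∈) ws≥1
              (λ vs vs≥1 sv lv → fine vs vs≥1 (trans sv (cong (ℕ._+ sum ws) s)) lv))
        rearrange : mixedSum (suc (suc j)) (a ∷ as) ws - signedFactorial (suc j) * W ≡
          mixedSum (suc j) as (a ∷ ws) -
            (∑ (merges a as) (λ cs → mixedSum (suc j) cs ws) - ∑ (merges a as) (λ _ → c * W))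
        rearrange = trans
          (cong (_- (- (+ suc j * c) * W)) (mixedSum-step (suc j) a as ws len′))
          (trans (lemma (mixedSum (suc j) as (a ∷ ws)) (∑ (merges a as) (λ cs → mixedSum (suc j) cs ws)) (+ suc j) c W)
            (cong (λ k → mixedSum (suc j) as (a ∷ ws) - (∑ (merges a as) (λ cs → mixedSum (suc j) cs ws) - k))
              (sym (trans (∑-const (merges a as) (c * W))
                (cong (λ k → + k * (c * W)) (trans (length-merges a as) len′))))))
          where
          lemma : ∀ x y k c w → (x - y) - (- (k * c) * w) ≡ x - (y - k * (c * w))
          lemma = solve-∀

  -- Counting solutions of weighted equations modulo p.

  module GoodSolutions (p : ℕ) (isPrime : Prime p) {E : Set} (_≟_ : DecidableEquality E)
    {_⊕_ : Op₂ E} {0# : E} {⊖_ : Op₁ E}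
    (isAb : IsAbelianGroup _≡_ _⊕_ 0# ⊖_) (n : ℕ) (φ : Fin n → E → ℤ)
    (φ-+ : ∀ r x y → + p ∣ φ r (x ⊕ y) - (φ r x + φ r y))
    (φ-0 : ∀ r → + p ∣ φ r 0#)
    (φ-kernel : ∀ x → (∀ r → + p ∣ φ r x) → x ≡ 0#) where

    open Modulo p isPrime
    open WeightedSums isAb
    open ListSums isAb
    open Moments p isPrime isAb n φ φ-+ φ-0 φ-kernel

    δ : E → ℤ
    δ x = if does (x ≟ 0#) then 1ℤ else 0ℤ

    δ-zero : ∀ {x} → x ≡ 0# → δ x ≡ 1ℤ
    δ-zero {x} x≡0 rewrite dec-true (x ≟ 0#) x≡0 = refl

    δ-nonzero : ∀ {x} → x ≢ 0# → δ x ≡ 0ℤ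
    δ-nonzero {x} x≢0 rewrite dec-false (x ≟ 0#) x≢0 = refl

    private
      K : ℤ
      K = ∏ (allFin n) (λ _ → ι 0ℤ)

      P∤K : ¬ P ∣ K
      P∤K = P∤∏ (allFin n) (λ _ → ι-zero ∣0)

      ∏-++ : ∀ {A : Set} (xs ys : List A) (f : A → ℤ) → ∏ (xs ++ ys) f ≡ ∏ xs f * ∏ ys f
      ∏-++ []       ys f = sym (ℤ.*-identityˡ _)
      ∏-++ (x ∷ xs) ys f = trans (cong (f x *_) (∏-++ xs ys f)) (sym (ℤ.*-assoc (f x) _ _))

      ∏-map : ∀ {A B : Set} (g : A → B) (xs : List A) (f : B → ℤ) → ∏ (map g xs) f ≡ ∏ xs (f ∘ g)
      ∏-map g []       f = refl
      ∏-map g (x ∷ xs) f = cong (f (g x) *_) (∏-map g xs f)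

      forms : E → List (Fin n) → List Form
      forms z []       = []
      forms z (r ∷ rs) = map (λ c → r , c - φ r z) nonzeroResidues ++ forms z rs

      length-forms : ∀ z rs → length (forms z rs) ≡ length rs ℕ.* ℕ.pred p
      length-forms z []       = refl
      length-forms z (r ∷ rs) = trans (List.length-++ (map _ nonzeroResidues))
        (cong₂ ℕ._+_ (trans (List.length-map _ nonzeroResidues) length-residues) (length-forms z rs))

      factor : E → E → Fin n → ℤ
      factor z u r = ∏ nonzeroResidues (λ c → φ r u - (c - φ r z))

      ∏-forms : ∀ z u rs → ∏ (forms z rs) (λ f → ⟦ f ⟧ u) ≡ ∏ rs (factor z u)
      ∏-forms z u []       = refl
      ∏-forms z u (r ∷ rs) = trans (∏-++ (map (λ c → r , c - φ r z) nonzeroResidues) (forms z rs) _)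
        (cong₂ _*_ (∏-map (λ c → r , c - φ r z) nonzeroResidues _) (∏-forms z u rs))

      factor-ι : ∀ z u r → P ∣ factor z u r - ι (φ r (z ⊕ u))
      factor-ι z u r = ∏-∣-diff nonzeroResidues λ c →
        ∣-resp-≡ (lemma (φ r (z ⊕ u)) (φ r z) (φ r u) c) (∣m⇒∣-m (φ-+ r z u))
        where
        lemma : ∀ s a b c → - (s - (a + b)) ≡ (b - (c - a)) - (s - c)
        lemma = solve-∀

      -- If z + u is not zero, some coordinate of it is nonzero modulo p by `φ-kernel`, and its
      -- factor vanishes; otherwise each factor is ι 0. So the product is the indicator times the
      -- unit `K`, in the place where 1 - x^(p-1) would give 1. The shape with - K is the one
      -- `weightedSum-linear` takes.
      indicator : ∀ z u → P ∣ - K * δ (z ⊕ u) + ∏ (forms z (allFin n)) (λ f → ⟦ f ⟧ u)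
      indicator z u = subst (λ k → P ∣ - K * δ (z ⊕ u) + k) (sym (∏-forms z u (allFin n))) value
        where
        lemma₁ : ∀ k a → a - k ≡ - k * 1ℤ + a
        lemma₁ = solve-∀
        lemma₂ : ∀ k a → a ≡ - k * 0ℤ + a
        lemma₂ = solve-∀
        lemma₃ : ∀ a b c → (a - b) + (b - c) ≡ a - c
        lemma₃ = solve-∀
        value : P ∣ - K * δ (z ⊕ u) + ∏ (allFin n) (factor z u)
        value with (z ⊕ u) ≟ 0#
        ... | yes z⊕u≡0 = ∣-resp-≡ (lemma₁ K (∏ (allFin n) (factor z u))) (∏-∣-diff (allFin n) λ r →
                ∣-resp-≡ (lemma₃ (factor z u r) (ι (φ r (z ⊕ u))) (ι 0ℤ))
                  (∣m∣n⇒∣m+n (factor-ι z u r)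
                    (ι-cong {φ r (z ⊕ u)} {0ℤ} (∣-resp-≡ (sym (ℤ.+-identityʳ _)) (subst (λ x → P ∣ φ r x) (sym z⊕u≡0) (φ-0 r))))))
        ... | no  z⊕u≢0 with Fin.¬∀⟶∃¬ n _ (λ r → P ∣? φ r (z ⊕ u)) (λ all → z⊕u≢0 (φ-kernel _ all))
        ...   | r , nd = ∣-resp-≡ (lemma₂ K (∏ (allFin n) (factor z u)))
                (∏-∣ (∈-allFin r) (diff-∣ (factor-ι z u r) (ι-nonzero nd)))

    -- Modulo p and up to the unit `K`, the indicator of the equation is a product of n (p - 1)
    -- affine forms, so `lowDegree` applies. This is the case of many variables.
    solutions-lowDegree : ∀ {d X} → HasMoments d X → ∀ ws z →
      n ℕ.* ℕ.pred p ℕ.< length ws ℕ.* suc d → P ∣ weightedSum X ws (λ u → δ (z ⊕ u))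
    solutions-lowDegree {d} {X} moments ws z small
      with prime-∣* (- K) (weightedSum X ws (λ u → δ (z ⊕ u)))
             (∣m+n∣n⇒∣m {m = - K * weightedSum X ws (λ u → δ (z ⊕ u))}
               (∣-resp-≡ (weightedSum-linear X ws (- K) (λ u → δ (z ⊕ u)) G)
                 (weightedSum-∣ X ws (λ ys _ _ → indicator z (comb ws ys))))
               (lowDegree {d} {X} moments ws (forms z (allFin n)) few))
      where
      G : E → ℤ
      G u = ∏ (forms z (allFin n)) (λ f → ⟦ f ⟧ u)
      few : length (forms z (allFin n)) ℕ.< length ws ℕ.* suc d
      few = subst (ℕ._< _) (sym (trans (length-forms z (allFin n))
              (cong (ℕ._* ℕ.pred p) (List.length-tabulate {n = n} (λ i → i))))) small
    ... | inj₁ d₁ = ⊥-elim (P∤K (∣-resp-≡ (ℤ.neg-involutive K) (∣m⇒∣-m d₁)))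
    ... | inj₂ d₂ = d₂

    -- The three thresholds: from `q₀` variables on, the degree argument applies; with fewer
    -- variables and total weight above `U₀`, some weight is at least 4H² by `split`; a total weight
    -- up to `U₀` is negligible against p by `large` and can be left ungrouped.
    module _ (X : List E) (X-unique : Unique X) {d : ℕ} (moments : HasMoments d X)
      (h q₀ U₀ : ℕ)
      (low   : n ℕ.* ℕ.pred p ℕ.< q₀ ℕ.* suc d)
      (split : q₀ ℕ.* (4 ℕ.* (suc h ℕ.* suc h)) ℕ.≤ U₀)
      (large : 8 ℕ.* suc (suc h) ℕ.* suc U₀ ℕ.≤ p)
      where

      private
        H = suc h

      open Distinct _≟_ isAb X X-unique

      -- The assumption to be refuted: no zero sum of p elements has the desired shape. Each tuple
      -- has distinct entries, but tuples may overlap or coincide.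
      Good : Set
      Good = ∀ tups left → All (Tuple H) tups → (∀ {y} → y ∈ left → y ∈ X) →
        H ℕ.* length tups ℕ.+ length left ≡ p → length left ℕ.≤ length tups →
        esum (concat tups ++ left) ≢ 0#

      private
        esum-replicate : ∀ k x → esum (replicate k x) ≡ k • x
        esum-replicate zero    x = refl
        esum-replicate (suc k) x = cong (x ⊕_) (esum-replicate k x)

        esum-concat-replicate : ∀ b ys → esum (concat (replicate b ys)) ≡ b • esum ys
        esum-concat-replicate zero    ys = refl
        esum-concat-replicate (suc b) ys =
          trans (esum-++ ys _) (cong (esum ys ⊕_) (esum-concat-replicate b ys))

        •-⊕ : ∀ b x y → b • (x ⊕ y) ≡ (b • x) ⊕ (b • y)
        •-⊕ zero    x y = sym (identityˡ 0#)
        •-⊕ (suc b) x y = begin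
          (x ⊕ y) ⊕ (b • (x ⊕ y))          ≡⟨ cong ((x ⊕ y) ⊕_) (•-⊕ b x y) ⟩
          (x ⊕ y) ⊕ ((b • x) ⊕ (b • y))    ≡⟨ assoc x y _ ⟩
          x ⊕ (y ⊕ ((b • x) ⊕ (b • y)))    ≡⟨ cong (x ⊕_) (⊕-left-comm y (b • x) (b • y)) ⟩
          x ⊕ ((b • x) ⊕ (y ⊕ (b • y)))    ≡⟨ sym (assoc x _ _) ⟩
          (x ⊕ (b • x)) ⊕ (y ⊕ (b • y))    ∎
          where open ≡-Reasoning

        •-0# : ∀ b → b • 0# ≡ 0#
        •-0# zero    = refl
        •-0# (suc b) = trans (identityˡ _) (•-0# b)

        comb-replicate : ∀ b ys → comb (replicate (length ys) b) ys ≡ b • esum ys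
        comb-replicate b []       = sym (•-0# b)
        comb-replicate b (y ∷ ys) = trans (cong ((b • y) ⊕_) (comb-replicate b ys)) (sym (•-⊕ b y (esum ys)))

        repeats : List ℕ → List E → List E
        repeats (w ∷ ws) (y ∷ ys) = replicate w y ++ repeats ws ys
        repeats _        _        = []

        esum-repeats : ∀ ws ys → esum (repeats ws ys) ≡ comb ws ys
        esum-repeats []       ys       = refl
        esum-repeats (w ∷ ws) []       = refl
        esum-repeats (w ∷ ws) (y ∷ ys) =
          trans (esum-++ (replicate w y) _) (cong₂ _⊕_ (esum-replicate w y) (esum-repeats ws ys))

        length-repeats : ∀ ws ys → length ys ≡ length ws → length (repeats ws ys) ≡ sum ws
        length-repeats []       []       _   = refl
        length-repeats (w ∷ ws) (y ∷ ys) len = trans (List.length-++ (replicate w y))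
          (cong₂ ℕ._+_ (List.length-replicate w) (length-repeats ws ys (ℕ.suc-injective len)))

        ∈-replicate⁻ : ∀ {A : Set} w {y x : A} → x ∈ replicate w y → x ≡ y
        ∈-replicate⁻ (suc w) (here e)   = e
        ∈-replicate⁻ (suc w) (there x∈) = ∈-replicate⁻ w x∈

        ∈-repeats : ∀ ws ys {x} → x ∈ repeats ws ys → x ∈ ys
        ∈-repeats (w ∷ ws) (y ∷ ys) x∈ with ∈-++⁻ (replicate w y) x∈
        ... | inj₁ x∈₁ = here (∈-replicate⁻ w x∈₁)
        ... | inj₂ x∈₂ = there (∈-repeats ws ys x∈₂)

        ∑-length≤ : ∀ {ws b} → All (ℕ._≤ b) ws → sum ws ℕ.≤ length ws ℕ.* b
        ∑-length≤ []       = z≤n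
        ∑-length≤ (w ∷ ws) = ℕ.+-mono-≤ w (∑-length≤ ws)

        length≤∑ : ∀ {ws} → All (1 ℕ.≤_) ws → length ws ℕ.≤ sum ws
        length≤∑ []       = z≤n
        length≤∑ (w ∷ ws) = ℕ.+-mono-≤ w (length≤∑ ws)

        -- If l + s > t, then 4l ≤ t + 4 forces 3t ≤ 4U₀. All of H t, l and s are then bounded in
        -- terms of H U₀, and their sum would fall below p by `large`.
        fewLeft : ∀ {t l s} → H ℕ.* t ℕ.+ l ℕ.+ s ≡ p → s ℕ.≤ U₀ → 4 ℕ.* l ℕ.≤ t ℕ.+ 4 → l ℕ.+ s ℕ.≤ t
        fewLeft {t} {l} {s} total s≤ l≤ with l ℕ.+ s ℕ.≤? t
        ... | yes ok = ok
        ... | no  bad = ⊥-elim (ℕ.<-irrefl refl (begin-strict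
          12 ℕ.* p
            ≡⟨ cong (12 ℕ.*_) (sym total) ⟩
          12 ℕ.* (H ℕ.* t ℕ.+ l ℕ.+ s)
            ≡⟨ lemma₁ H t l s ⟩
          4 ℕ.* H ℕ.* (3 ℕ.* t) ℕ.+ 3 ℕ.* (4 ℕ.* l) ℕ.+ 12 ℕ.* s
            ≤⟨ ℕ.+-mono-≤ (ℕ.+-mono-≤ (ℕ.*-monoʳ-≤ (4 ℕ.* H) 3t≤) (ℕ.*-monoʳ-≤ 3 l≤)) (ℕ.*-monoʳ-≤ 12 s≤) ⟩
          4 ℕ.* H ℕ.* (4 ℕ.* U₀) ℕ.+ 3 ℕ.* (t ℕ.+ 4) ℕ.+ 12 ℕ.* U₀
            ≡⟨ cong (λ k → 4 ℕ.* H ℕ.* (4 ℕ.* U₀) ℕ.+ k ℕ.+ 12 ℕ.* U₀) (ℕ.*-distribˡ-+ 3 t 4) ⟩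
          4 ℕ.* H ℕ.* (4 ℕ.* U₀) ℕ.+ (3 ℕ.* t ℕ.+ 12) ℕ.+ 12 ℕ.* U₀
            ≤⟨ ℕ.+-monoˡ-≤ (12 ℕ.* U₀) (ℕ.+-monoʳ-≤ (4 ℕ.* H ℕ.* (4 ℕ.* U₀)) (ℕ.+-monoˡ-≤ 12 3t≤)) ⟩
          4 ℕ.* H ℕ.* (4 ℕ.* U₀) ℕ.+ (4 ℕ.* U₀ ℕ.+ 12) ℕ.+ 12 ℕ.* U₀
            ≤⟨ ℕ.m≤m+n _ _ ⟩
          -- The added terms complete the expansion of 96 (H + 1)(U₀ + 1), up to one.
          (4 ℕ.* H ℕ.* (4 ℕ.* U₀) ℕ.+ (4 ℕ.* U₀ ℕ.+ 12) ℕ.+ 12 ℕ.* U₀) ℕ.+ (80 ℕ.* (H ℕ.* U₀) ℕ.+ 80 ℕ.* U₀ ℕ.+ 96 ℕ.* H ℕ.+ 83)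
            <⟨ ℕ.n<1+n _ ⟩
          suc ((4 ℕ.* H ℕ.* (4 ℕ.* U₀) ℕ.+ (4 ℕ.* U₀ ℕ.+ 12) ℕ.+ 12 ℕ.* U₀) ℕ.+ (80 ℕ.* (H ℕ.* U₀) ℕ.+ 80 ℕ.* U₀ ℕ.+ 96 ℕ.* H ℕ.+ 83))
            ≡⟨ lemma₂ H U₀ ⟩
          12 ℕ.* (8 ℕ.* suc H ℕ.* suc U₀)
            ≤⟨ ℕ.*-monoʳ-≤ 12 large ⟩
          12 ℕ.* p ∎))
          where
          open ℕ.≤-Reasoning
          lemma₁ : ∀ H t l s → 12 ℕ.* (H ℕ.* t ℕ.+ l ℕ.+ s) ≡
            4 ℕ.* H ℕ.* (3 ℕ.* t) ℕ.+ 3 ℕ.* (4 ℕ.* l) ℕ.+ 12 ℕ.* s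
          lemma₁ = ℕSolver.solve-∀
          lemma₂ : ∀ H U → suc ((4 ℕ.* H ℕ.* (4 ℕ.* U) ℕ.+ (4 ℕ.* U ℕ.+ 12) ℕ.+ 12 ℕ.* U) ℕ.+
            (80 ℕ.* (H ℕ.* U) ℕ.+ 80 ℕ.* U ℕ.+ 96 ℕ.* H ℕ.+ 83)) ≡ 12 ℕ.* (8 ℕ.* suc H ℕ.* suc U)
          lemma₂ = ℕSolver.solve-∀
          3t≤ : 3 ℕ.* t ℕ.≤ 4 ℕ.* U₀
          3t≤ = ℕ.+-cancelˡ-≤ (t ℕ.+ 4) _ _ (begin
            (t ℕ.+ 4) ℕ.+ 3 ℕ.* t      ≡⟨ lemma₃ t ⟩
            4 ℕ.* suc t                ≤⟨ ℕ.*-monoʳ-≤ 4 (ℕ.≰⇒> bad) ⟩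
            4 ℕ.* (l ℕ.+ s)            ≡⟨ ℕ.*-distribˡ-+ 4 l s ⟩
            4 ℕ.* l ℕ.+ 4 ℕ.* s        ≤⟨ ℕ.+-mono-≤ l≤ (ℕ.*-monoʳ-≤ 4 s≤) ⟩
            (t ℕ.+ 4) ℕ.+ 4 ℕ.* U₀     ∎)
            where
            lemma₃ : ∀ t → (t ℕ.+ 4) ℕ.+ 3 ℕ.* t ≡ 4 ℕ.* suc t
            lemma₃ = ℕSolver.solve-∀

        bigWeight : ∀ {ws} → length ws ℕ.< q₀ → U₀ ℕ.< sum ws →
          ∃ λ w → w ∈ ws × 4 ℕ.* (H ℕ.* H) ℕ.≤ w
        bigWeight {ws} few many with any? (4 ℕ.* (H ℕ.* H) ℕ.≤?_) ws
        ... | yes found = find found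
        ... | no  none  = ⊥-elim (ℕ.<⇒≱ many (begin
          sum ws                              ≤⟨ ∑-length≤ (All.map (λ w → ℕ.≰⇒≥ w) (All.¬Any⇒All¬ ws none)) ⟩
          length ws ℕ.* (4 ℕ.* (H ℕ.* H))     ≤⟨ ℕ.*-monoˡ-≤ _ (ℕ.<⇒≤ few) ⟩
          q₀ ℕ.* (4 ℕ.* (H ℕ.* H))            ≤⟨ split ⟩
          U₀                                  ∎))
          where open ℕ.≤-Reasoning

      module _ (good : Good) where

        private
          factorial-unit : ∀ (f : E → ℤ) j → j ℕ.< p → ¬ P ∣ signedFactorial f j
          factorial-unit f zero    _   d = P∤1 d
          factorial-unit f (suc j) j<p d =
            [ P∤small j<p , factorial-unit f j (ℕ.<-trans (ℕ.n<1+n j) j<p) ]′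
              (prime-∣* (+ suc j) (signedFactorial f j) (∣-resp-≡ (ℤ.neg-involutive _) (∣m⇒∣-m d)))

          h<p : h ℕ.< p
          h<p = ℕ.≤-trans (ℕ.≤-trans (ℕ.n≤1+n H) (ℕ.m≤n*m (suc H) 8))
                  (ℕ.≤-trans (ℕ.m≤m*n (8 ℕ.* suc H) (suc U₀)) large)

          state : List (List E) → List E → E
          state tups left = esum (concat tups ++ left)

          -- Reads `mixedSum-≡` backwards: the sum over distinct H-tuples vanishes by the last
          -- assumption, and it is congruent to a signed factorial, a unit since h < p, times the
          -- sum in question. The weight is cut into H equal parts, the first of which also takes
          -- the remainder of the division by H.
          splitWeight : ∀ f w ws → 4 ℕ.* (H ℕ.* H) ℕ.≤ w → All (1 ℕ.≤_) ws →
            (∀ vs → All (1 ℕ.≤_) vs → sum vs ≡ w ℕ.+ sum ws → 2 ℕ.+ length ws ℕ.≤ length vs →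
              P ∣ weightedSum X vs f) →
            (∀ {ys} → Tuple H ys → P ∣ weightedSum X ws (λ u → f (comb (((w ℕ.% H) ℕ.+ w ℕ./ H) ∷ replicate h (w ℕ./ H)) ys ⊕ u))) →
            P ∣ weightedSum X (w ∷ ws) f
          splitWeight f w ws w≥ ws≥1 fine covered = [ (λ u → ⊥-elim (factorial-unit f h h<p u)) , (λ e → e) ]′
              (prime-∣* (signedFactorial f h) (weightedSum X (w ∷ ws) f) product)
            where
            b = w ℕ./ H
            ρ = w ℕ.% H
            parts = (ρ ℕ.+ b) ∷ replicate h b
            sum-replicate : ∀ k → sum (replicate k b) ≡ k ℕ.* b
            sum-replicate zero    = refl
            sum-replicate (suc k) = cong (b ℕ.+_) (sum-replicate k)
            sum-parts : sum parts ≡ w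
            sum-parts = trans (cong ((ρ ℕ.+ b) ℕ.+_) (sum-replicate h))
              (trans (ℕ.+-assoc ρ b (h ℕ.* b))
                (trans (cong (ρ ℕ.+_) (ℕ.*-comm H b)) (sym (ℕ.m≡m%n+[m/n]*n w H))))
            b≥1 : 1 ℕ.≤ b
            b≥1 = ℕ.m≥n⇒m/n>0 (ℕ.≤-trans (ℕ.≤-trans (ℕ.m≤m*n H H) (ℕ.m≤n*m (H ℕ.* H) 4)) w≥)
            parts≥1 : 1 ℕ.≤ ρ ℕ.+ b
            parts≥1 = ℕ.≤-trans b≥1 (ℕ.m≤n+m b ρ)
            merged : P ∣ mixedSum f H parts ws - signedFactorial f h * weightedSum X (sum parts ∷ ws) f
            merged = mixedSum-≡ f h parts ws (cong suc (List.length-replicate h))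
              (parts≥1 ∷ All.replicate⁺ h b≥1) ws≥1
              (λ vs vs≥1 s → fine vs vs≥1 (trans s (cong (ℕ._+ sum ws) sum-parts)))
            vanishing : P ∣ mixedSum f H parts ws
            vanishing = distinctSum-∣ H covered
            product′ : P ∣ signedFactorial f h * weightedSum X (sum parts ∷ ws) f
            product′ = diff-∣ (diff-sym {a = mixedSum f H parts ws} merged) vanishing
            product : P ∣ signedFactorial f h * weightedSum X (w ∷ ws) f
            product = subst (λ v → P ∣ signedFactorial f h * weightedSum X (v ∷ ws) f) sum-parts product′

        -- Induction on 2 · (total weight) - (number of variables), which decreases both when a
        -- variable is split and when its parts become fixed elements.
        noSolutions : ∀ k ws tups left → All (1 ℕ.≤_) ws → All (Tuple H) tups →
          (∀ {y} → y ∈ left → y ∈ X) → H ℕ.* length tups ℕ.+ length left ℕ.+ sum ws ≡ p →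
          4 ℕ.* length left ℕ.≤ length tups ℕ.+ 4 → 2 ℕ.* sum ws ℕ.≤ k ℕ.+ length ws →
          P ∣ weightedSum X ws (λ u → δ (state tups left ⊕ u))
        noSolutions k ws tups left ws≥1 tuples left⊆ total few fuel with q₀ ℕ.≤? length ws
        ... | yes many = solutions-lowDegree {d} {X} moments ws (state tups left)
                           (ℕ.<-≤-trans low (ℕ.*-monoˡ-≤ (suc d) many))
        ... | no ¬many with sum ws ℕ.≤? U₀
        -- Each variable y of weight w turns into w left-over copies of y. By `fewLeft` the result
        -- has the shape excluded by `good`, so every term is zero.
        ...   | yes small = weightedSum-∣ X ws λ ys len sub → ∣-resp-≡ (sym (vanish ys len sub)) ∣0
          where
          vanish : ∀ ys → length ys ≡ length ws → (∀ {y} → y ∈ ys → y ∈ X) →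
            δ (state tups left ⊕ comb ws ys) ≡ 0ℤ
          vanish ys len sub = δ-nonzero (λ eq →
              good tups (left ++ repeats ws ys) tuples left′⊆
                (trans (cong (H ℕ.* length tups ℕ.+_) length-left′)
                  (trans (sym (ℕ.+-assoc (H ℕ.* length tups) (length left) (sum ws))) total))
                (subst (ℕ._≤ length tups) (sym length-left′) (fewLeft {length tups} {length left} total small few))
                (trans state′ eq))
            where
            left′⊆ : ∀ {y} → y ∈ left ++ repeats ws ys → y ∈ X
            left′⊆ y∈ with ∈-++⁻ left y∈
            ... | inj₁ y∈₁ = left⊆ y∈₁
            ... | inj₂ y∈₂ = sub (∈-repeats ws ys y∈₂)
            length-left′ : length (left ++ repeats ws ys) ≡ length left ℕ.+ sum ws
            length-left′ = trans (List.length-++ left) (cong (length left ℕ.+_) (length-repeats ws ys len))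
            state′ : esum (concat tups ++ left ++ repeats ws ys) ≡ state tups left ⊕ comb ws ys
            state′ = trans (cong esum (sym (List.++-assoc (concat tups) left (repeats ws ys))))
              (trans (esum-++ (concat tups ++ left) _) (cong (state tups left ⊕_) (esum-repeats ws ys)))
        ...   | no ¬small with bigWeight {ws} (ℕ.≰⇒> ¬many) (ℕ.≰⇒> ¬small)
        ...     | w , w∈ , w≥ with ∈-∃++ w∈
        ...       | as , bs , refl = ∣-resp-≡ (sym (weightedSum-↭ _ ws↭)) (shrink k fuel)
          where
          ws′ = as ++ bs
          f : E → ℤ
          f u = δ (state tups left ⊕ u)
          ws↭ : as ++ w ∷ bs ↭ w ∷ ws′
          ws↭ = shift w as bs
          pos : All (1 ℕ.≤_) (w ∷ ws′)
          pos = All-resp-↭ ws↭ ws≥1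
          sum-ws : sum (as ++ w ∷ bs) ≡ w ℕ.+ sum ws′
          sum-ws = sum-↭ ws↭
          length-ws : length (as ++ w ∷ bs) ≡ suc (length ws′)
          length-ws = ↭-length ws↭
          b = w ℕ./ H
          ρ = w ℕ.% H
          shrink : ∀ k → 2 ℕ.* sum (as ++ w ∷ bs) ℕ.≤ k ℕ.+ length (as ++ w ∷ bs) → P ∣ weightedSum X (w ∷ ws′) f
          shrink zero fuel = ⊥-elim (ℕ.<⇒≱ (ℕ.≤-<-trans z≤n (ℕ.≰⇒> ¬small))
            (ℕ.+-cancelˡ-≤ (sum (as ++ w ∷ bs)) _ _ (begin
              sum (as ++ w ∷ bs) ℕ.+ sum (as ++ w ∷ bs)   ≡⟨ cong (sum (as ++ w ∷ bs) ℕ.+_) (sym (ℕ.+-identityʳ _)) ⟩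
              2 ℕ.* sum (as ++ w ∷ bs)                    ≤⟨ fuel ⟩
              length (as ++ w ∷ bs)                       ≤⟨ length≤∑ ws≥1 ⟩
              sum (as ++ w ∷ bs)                          ≡⟨ sym (ℕ.+-identityʳ _) ⟩
              sum (as ++ w ∷ bs) ℕ.+ 0                    ∎)))
            where open ℕ.≤-Reasoning
          shrink (suc k) fuel = splitWeight f w ws′ w≥ (All.tail pos)
            (λ vs vs≥1 s len → noSolutions k vs tups left vs≥1 tuples left⊆
              (trans (cong (H ℕ.* length tups ℕ.+ length left ℕ.+_) (trans s (sym sum-ws))) total) few
              (begin
                2 ℕ.* sum vs                    ≡⟨ cong (2 ℕ.*_) (trans s (sym sum-ws)) ⟩
                2 ℕ.* sum (as ++ w ∷ bs)        ≤⟨ fuel ⟩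
                suc k ℕ.+ length (as ++ w ∷ bs) ≡⟨ cong (suc k ℕ.+_) length-ws ⟩
                suc k ℕ.+ suc (length ws′)      ≡⟨ sym (ℕ.+-suc k (suc (length ws′))) ⟩
                k ℕ.+ (2 ℕ.+ length ws′)        ≤⟨ ℕ.+-monoʳ-≤ k len ⟩
                k ℕ.+ length vs                 ∎))
            covered
            where
            open ℕ.≤-Reasoning
            covered : ∀ {ys} → Tuple H ys → P ∣ weightedSum X ws′ (λ u → f (comb ((ρ ℕ.+ b) ∷ replicate h b) ys ⊕ u))
            covered {y ∷ ys} t@(tuple len _ sub) =
              ∣-resp-≡ (weightedSum-cong X ws′ (λ u → cong δ (trans (cong (_⊕ u) moved) (assoc _ _ u))))
                (noSolutions k ws′ tups′ left′ (All.tail pos) (All.++⁺ (All.replicate⁺ b t) tuples) left′⊆ total′ few′ fuel′)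
              where
              -- The fixed entries contribute ρ y + b (y + ∑ ys): `b` copies of the whole tuple, and
              -- `ρ` left-over copies of its first entry.
              tups′ = replicate b (y ∷ ys) ++ tups
              left′ = replicate ρ y ++ left
              c = comb ((ρ ℕ.+ b) ∷ replicate h b) (y ∷ ys)
              left′⊆ : ∀ {x} → x ∈ left′ → x ∈ X
              left′⊆ x∈ with ∈-++⁻ (replicate ρ y) x∈
              ... | inj₁ x∈₁ = subst (_∈ X) (sym (∈-replicate⁻ ρ x∈₁)) (sub (here refl))
              ... | inj₂ x∈₂ = left⊆ x∈₂
              length-tups′ : length tups′ ≡ b ℕ.+ length tups
              length-tups′ = trans (List.length-++ (replicate b (y ∷ ys))) (cong (ℕ._+ length tups) (List.length-replicate b))
              length-left′ : length left′ ≡ ρ ℕ.+ length left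
              length-left′ = trans (List.length-++ (replicate ρ y)) (cong (ℕ._+ length left) (List.length-replicate ρ))
              comb≡ : c ≡ (ρ • y) ⊕ (b • esum (y ∷ ys))
              comb≡ = trans (cong₂ _⊕_ (•-+ ρ b y) (trans (cong (λ l → comb (replicate l b) ys) (sym (ℕ.suc-injective len))) (comb-replicate b ys)))
                (trans (assoc (ρ • y) (b • y) (b • esum ys)) (cong ((ρ • y) ⊕_) (sym (•-⊕ b y (esum ys)))))
              moved : state tups′ left′ ≡ state tups left ⊕ c
              moved = trans (esum-++ (concat tups′) left′) (trans (cong₂ _⊕_
                  (trans (cong esum (sym (List.concat-++ (replicate b (y ∷ ys)) tups)))
                    (trans (esum-++ (concat (replicate b (y ∷ ys))) (concat tups)) (cong (_⊕ esum (concat tups)) (esum-concat-replicate b (y ∷ ys)))))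
                  (trans (esum-++ (replicate ρ y) left) (cong (_⊕ esum left) (esum-replicate ρ y))))
                (trans (rearrange (b • esum (y ∷ ys)) (esum (concat tups)) (ρ • y) (esum left))
                  (sym (cong₂ _⊕_ (esum-++ (concat tups) left) comb≡))))
                where
                rearrange : ∀ s t r l → (s ⊕ t) ⊕ (r ⊕ l) ≡ (t ⊕ l) ⊕ (r ⊕ s)
                rearrange s t r l = trans (cong (_⊕ (r ⊕ l)) (comm s t)) (trans (assoc t s _)
                  (trans (cong (t ⊕_) (trans (cong (s ⊕_) (comm r l)) (trans (⊕-left-comm s l r) (cong (l ⊕_) (comm s r)))))
                    (sym (assoc t l _))))
              total′ : H ℕ.* length tups′ ℕ.+ length left′ ℕ.+ sum ws′ ≡ p
              total′ = begin-equality
                H ℕ.* length tups′ ℕ.+ length left′ ℕ.+ sum ws′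
                  ≡⟨ cong₂ (λ t l → H ℕ.* t ℕ.+ l ℕ.+ sum ws′) length-tups′ length-left′ ⟩
                H ℕ.* (b ℕ.+ length tups) ℕ.+ (ρ ℕ.+ length left) ℕ.+ sum ws′
                  ≡⟨ lemma H b (length tups) ρ (length left) (sum ws′) ⟩
                H ℕ.* length tups ℕ.+ length left ℕ.+ ((ρ ℕ.+ b ℕ.* H) ℕ.+ sum ws′)
                  ≡⟨ cong (λ v → H ℕ.* length tups ℕ.+ length left ℕ.+ (v ℕ.+ sum ws′)) (sym (ℕ.m≡m%n+[m/n]*n w H)) ⟩
                H ℕ.* length tups ℕ.+ length left ℕ.+ (w ℕ.+ sum ws′)
                  ≡⟨ cong (H ℕ.* length tups ℕ.+ length left ℕ.+_) (sym sum-ws) ⟩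
                H ℕ.* length tups ℕ.+ length left ℕ.+ sum (as ++ w ∷ bs)
                  ≡⟨ total ⟩
                p ∎
                where
                lemma : ∀ H b t r l s → H ℕ.* (b ℕ.+ t) ℕ.+ (r ℕ.+ l) ℕ.+ s ≡ H ℕ.* t ℕ.+ l ℕ.+ ((r ℕ.+ b ℕ.* H) ℕ.+ s)
                lemma = ℕSolver.solve-∀
              -- From w ≥ 4H² the quotient is at least 4H, and ρ < H. This keeps the left-over
              -- elements at about a quarter of the tuples.
              4ρ≤b : 4 ℕ.* ρ ℕ.≤ b
              4ρ≤b = begin
                4 ℕ.* ρ                          ≤⟨ ℕ.*-monoʳ-≤ 4 (ℕ.<⇒≤ (ℕ.m%n<n w H)) ⟩
                4 ℕ.* H                          ≡⟨ sym (ℕ.m*n/n≡m (4 ℕ.* H) H) ⟩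
                (4 ℕ.* H ℕ.* H) ℕ./ H            ≤⟨ ℕ./-monoˡ-≤ H (ℕ.≤-trans (ℕ.≤-reflexive (ℕ.*-assoc 4 H H)) w≥) ⟩
                b                                ∎
              few′ : 4 ℕ.* length left′ ℕ.≤ length tups′ ℕ.+ 4
              few′ = begin
                4 ℕ.* length left′                 ≡⟨ cong (4 ℕ.*_) length-left′ ⟩
                4 ℕ.* (ρ ℕ.+ length left)          ≡⟨ ℕ.*-distribˡ-+ 4 ρ (length left) ⟩
                4 ℕ.* ρ ℕ.+ 4 ℕ.* length left      ≤⟨ ℕ.+-mono-≤ 4ρ≤b few ⟩
                b ℕ.+ (length tups ℕ.+ 4)          ≡⟨ sym (ℕ.+-assoc b (length tups) 4) ⟩
                b ℕ.+ length tups ℕ.+ 4            ≡⟨ cong (ℕ._+ 4) (sym length-tups′) ⟩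
                length tups′ ℕ.+ 4                 ∎
              fuel′ : 2 ℕ.* sum ws′ ℕ.≤ k ℕ.+ length ws′
              fuel′ = ℕ.+-cancelˡ-≤ 2 _ _ (begin
                2 ℕ.+ 2 ℕ.* sum ws′              ≤⟨ ℕ.+-monoˡ-≤ (2 ℕ.* sum ws′) (ℕ.*-monoʳ-≤ 2 (All.head pos)) ⟩
                2 ℕ.* w ℕ.+ 2 ℕ.* sum ws′        ≡⟨ sym (ℕ.*-distribˡ-+ 2 w (sum ws′)) ⟩
                2 ℕ.* (w ℕ.+ sum ws′)            ≡⟨ cong (2 ℕ.*_) (sym sum-ws) ⟩
                2 ℕ.* sum (as ++ w ∷ bs)         ≤⟨ fuel ⟩
                suc k ℕ.+ length (as ++ w ∷ bs)  ≡⟨ cong (suc k ℕ.+_) length-ws ⟩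
                suc k ℕ.+ suc (length ws′)       ≡⟨ cong suc (ℕ.+-suc k (length ws′)) ⟩
                2 ℕ.+ (k ℕ.+ length ws′)         ∎)

        private
          p•≡0# : ∀ x → p • x ≡ 0#
          p•≡0# x = φ-kernel _ λ r → diff-∣ (φ-• r p x) (divides (φ r x) (ℤ.*-comm P (φ r x)))

        -- Starts `noSolutions` with one variable of weight p - 1 and with `x₀` as the only
        -- left-over element. That element, present before there is any tuple, is the reason for the
        -- summand 4 in the invariant. Since p x = 0 throughout, y = x₀ is the only solution.
        noGood : ∀ {x₀} → x₀ ∈ X → ⊥
        noGood {x₀} x₀∈ = P∤1 (∣-resp-≡ count
                (noSolutions (2 ℕ.* ℕ.pred p) (ℕ.pred p ∷ []) [] (x₀ ∷ []) (1≤pred ∷ []) []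
                  (λ { (here refl) → x₀∈ }) total ℕ.≤-refl fuel))
          where
          instance _ = prime⇒nonZero isPrime
          1≤pred : 1 ℕ.≤ ℕ.pred p
          1≤pred = ℕ.<⇒≤pred (ℕ.nonTrivial⇒n>1 p {{prime⇒nonTrivial isPrime}})
          total : H ℕ.* 0 ℕ.+ 1 ℕ.+ (ℕ.pred p ℕ.+ 0) ≡ p
          total = trans (cong₂ (λ a b → a ℕ.+ 1 ℕ.+ b) (ℕ.*-zeroʳ H) (ℕ.+-identityʳ (ℕ.pred p))) (ℕ.suc-pred p)
          fuel : 2 ℕ.* (ℕ.pred p ℕ.+ 0) ℕ.≤ 2 ℕ.* ℕ.pred p ℕ.+ 1
          fuel = ℕ.≤-trans (ℕ.≤-reflexive (cong (2 ℕ.*_) (ℕ.+-identityʳ (ℕ.pred p)))) (ℕ.m≤m+n _ 1)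
          sum-to-p : ∀ y → y ⊕ (ℕ.pred p • y) ≡ 0#
          sum-to-p y = trans (cong (_• y) (ℕ.suc-pred p)) (p•≡0# y)
          value : ∀ y → δ ((x₀ ⊕ 0#) ⊕ ((ℕ.pred p • y) ⊕ 0#)) ≡ (if does (y ≟ x₀) then 1ℤ else 0ℤ)
          value y with y ≟ x₀
          ... | yes refl = δ-zero (trans (cong₂ _⊕_ (identityʳ y) (identityʳ _)) (sum-to-p y))
          ... | no y≢ = δ-nonzero (λ e → y≢ (sym (cancel
                          (trans (sym (cong₂ _⊕_ (identityʳ x₀) (identityʳ _))) e))))
            where
            cancel : x₀ ⊕ (ℕ.pred p • y) ≡ 0# → x₀ ≡ y
            cancel e = begin
              x₀                                    ≡⟨ sym (identityʳ x₀) ⟩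
              x₀ ⊕ 0#                               ≡⟨ cong (x₀ ⊕_) (sym (trans (comm _ y) (sum-to-p y))) ⟩
              x₀ ⊕ ((ℕ.pred p • y) ⊕ y)             ≡⟨ sym (assoc x₀ _ y) ⟩
              (x₀ ⊕ (ℕ.pred p • y)) ⊕ y             ≡⟨ cong (_⊕ y) e ⟩
              0# ⊕ y                                ≡⟨ identityˡ y ⟩
              y                                     ∎
              where open ≡-Reasoning
          count : weightedSum X (ℕ.pred p ∷ []) (λ u → δ ((x₀ ⊕ 0#) ⊕ u)) ≡ 1ℤ
          count = trans (∑-cong X value) (∑-≡ X-unique x₀∈ (λ _ → 1ℤ))

-- The vectors over the prime field as an abelian group with integer coordinates.

module VectorGroup where

  open import Data.Integer.Tactic.RingSolver using (solve-∀)
  open import Data.Fin using (toℕ)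
  open import Data.Nat
  open import Data.Nat.Divisibility using (n∣m⇒m%n≡0)
  open import Data.Nat.DivMod
  open import Data.Nat.Properties
  open import Data.Vec as Vec using (Vec; tabulate)
  open import Data.Vec.Properties

  module VectorSpace (p : ℕ) .{{_ : NonZero p}} where

    toℕ-mod : ∀ m → toℕ (m mod p) ≡ m % p
    toℕ-mod m = Fin.toℕ-fromℕ< (m%n<n m p)

    toℕ-+ₚ : ∀ (a b : Fin p) → toℕ (a +ₚ b) ≡ (toℕ a + toℕ b) % p
    toℕ-+ₚ a b = toℕ-mod (toℕ a + toℕ b)

    private
      reduce : ∀ (a : Fin p) → toℕ a % p ≡ toℕ a
      reduce a = m<n⇒m%n≡m (Fin.toℕ<n a)

      %-+ˡ : ∀ x y → (x % p + y) % p ≡ (x + y) % p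
      %-+ˡ x y = trans (%-distribˡ-+ (x % p) y p)
        (trans (cong (λ k → (k + y % p) % p) (m%n%n≡m%n x p)) (sym (%-distribˡ-+ x y p)))

    +ₚ-comm : ∀ (a b : Fin p) → a +ₚ b ≡ b +ₚ a
    +ₚ-comm a b = cong (_mod p) (+-comm (toℕ a) (toℕ b))

    +ₚ-assoc : ∀ (a b c : Fin p) → (a +ₚ b) +ₚ c ≡ a +ₚ (b +ₚ c)
    +ₚ-assoc a b c = Fin.toℕ-injective (begin
      toℕ ((a +ₚ b) +ₚ c)                   ≡⟨ trans (toℕ-+ₚ (a +ₚ b) c) (cong (λ k → (k + toℕ c) % p) (toℕ-+ₚ a b)) ⟩
      ((toℕ a + toℕ b) % p + toℕ c) % p     ≡⟨ %-+ˡ (toℕ a + toℕ b) (toℕ c) ⟩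
      (toℕ a + toℕ b + toℕ c) % p           ≡⟨ cong (_% p) (trans (+-assoc (toℕ a) (toℕ b) (toℕ c)) (+-comm (toℕ a) _)) ⟩
      (toℕ b + toℕ c + toℕ a) % p           ≡⟨ sym (%-+ˡ (toℕ b + toℕ c) (toℕ a)) ⟩
      ((toℕ b + toℕ c) % p + toℕ a) % p     ≡⟨ cong (_% p) (+-comm _ (toℕ a)) ⟩
      (toℕ a + (toℕ b + toℕ c) % p) % p     ≡⟨ sym (trans (toℕ-+ₚ a (b +ₚ c)) (cong (λ k → (toℕ a + k) % p) (toℕ-+ₚ b c))) ⟩
      toℕ (a +ₚ (b +ₚ c))                   ∎)
      where open ≡-Reasoning

    toℕ-zeroₚ : toℕ (zeroₚ {p}) ≡ 0
    toℕ-zeroₚ = trans (toℕ-mod 0) (m<n⇒m%n≡m (>-nonZero⁻¹ p))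

    +ₚ-identityˡ : ∀ (a : Fin p) → zeroₚ +ₚ a ≡ a
    +ₚ-identityˡ a = Fin.toℕ-injective
      (trans (toℕ-+ₚ zeroₚ a) (trans (cong (λ k → (k + toℕ a) % p) toℕ-zeroₚ) (reduce a)))

    -ₚ_ : Fin p → Fin p
    -ₚ a = (p ∸ toℕ a) mod p

    +ₚ-inverseˡ : ∀ (a : Fin p) → (-ₚ a) +ₚ a ≡ zeroₚ
    +ₚ-inverseˡ a = Fin.toℕ-injective (begin
      toℕ ((-ₚ a) +ₚ a)                   ≡⟨ trans (toℕ-+ₚ (-ₚ a) a) (cong (λ k → (k + toℕ a) % p) (toℕ-mod (p ∸ toℕ a))) ⟩
      ((p ∸ toℕ a) % p + toℕ a) % p       ≡⟨ %-+ˡ (p ∸ toℕ a) (toℕ a) ⟩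
      (p ∸ toℕ a + toℕ a) % p             ≡⟨ cong (_% p) (m∸n+n≡m (<⇒≤ (Fin.toℕ<n a))) ⟩
      p % p                               ≡⟨ n%n≡0 p ⟩
      0                                   ≡⟨ sym toℕ-zeroₚ ⟩
      toℕ (zeroₚ {p})                     ∎)
      where open ≡-Reasoning

    module _ (n : ℕ) where

      -ᵥ_ : Vecₚ p n → Vecₚ p n
      -ᵥ_ = Vec.map -ₚ_

      +ᵥ-comm : ∀ (x y : Vecₚ p n) → x +ᵥ y ≡ y +ᵥ x
      +ᵥ-comm = zipWith-comm +ₚ-comm

      +ᵥ-isAbelianGroup : IsAbelianGroup _≡_ _+ᵥ_ (0ᵥ {p} {n}) -ᵥ_
      +ᵥ-isAbelianGroup = record
        { isGroup = record
          { isMonoid = record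
            { isSemigroup = record
              { isMagma = record { isEquivalence = isEquivalence ; ∙-cong = cong₂ _+ᵥ_ }
              ; assoc = zipWith-assoc +ₚ-assoc }
            ; identity = identityˡ , λ x → trans (+ᵥ-comm x 0ᵥ) (identityˡ x) }
          ; inverse = inverseˡ , λ x → trans (+ᵥ-comm x (-ᵥ x)) (inverseˡ x)
          ; ⁻¹-cong = cong -ᵥ_ }
        ; comm = +ᵥ-comm }
        where
        identityˡ : ∀ x → 0ᵥ +ᵥ x ≡ x
        identityˡ = zipWith-identityˡ +ₚ-identityˡ
        inverseˡ : ∀ x → (-ᵥ x) +ᵥ x ≡ 0ᵥ
        inverseˡ = zipWith-inverseˡ +ₚ-inverseˡ

      coord : Fin n → Vecₚ p n → ℤ
      coord r x = ℤ.+ toℕ (Vec.lookup x r)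

      coord-+ : ∀ r x y → ℤ.+ p ℤ.∣ coord r (x +ᵥ y) ℤ.- (coord r x ℤ.+ coord r y)
      coord-+ r x y = ℤ.divides (ℤ.- (ℤ.+ (s / p))) (begin
        coord r (x +ᵥ y) ℤ.- (coord r x ℤ.+ coord r y)
          ≡⟨ cong (λ k → ℤ.+ k ℤ.- (coord r x ℤ.+ coord r y)) (trans (cong toℕ (lookup-zipWith _+ₚ_ r x y)) (toℕ-+ₚ a b)) ⟩
        ℤ.+ (s % p) ℤ.- ℤ.+ s
          ≡⟨ cong (λ k → ℤ.+ (s % p) ℤ.- ℤ.+ k) (m≡m%n+[m/n]*n s p) ⟩
        ℤ.+ (s % p) ℤ.- (ℤ.+ (s % p) ℤ.+ ℤ.+ (s / p * p))
          ≡⟨ cong (λ k → ℤ.+ (s % p) ℤ.- (ℤ.+ (s % p) ℤ.+ k)) (ℤ.pos-* (s / p) p) ⟩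
        ℤ.+ (s % p) ℤ.- (ℤ.+ (s % p) ℤ.+ ℤ.+ (s / p) ℤ.* ℤ.+ p)
          ≡⟨ lemma (ℤ.+ (s % p)) (ℤ.+ (s / p)) (ℤ.+ p) ⟩
        ℤ.- (ℤ.+ (s / p)) ℤ.* ℤ.+ p ∎)
        where
        open ≡-Reasoning
        a = Vec.lookup x r
        b = Vec.lookup y r
        s = toℕ a + toℕ b
        lemma : ∀ a q p → a ℤ.- (a ℤ.+ q ℤ.* p) ≡ ℤ.- q ℤ.* p
        lemma = solve-∀

      coord-0 : ∀ r → ℤ.+ p ℤ.∣ coord r 0ᵥ
      coord-0 r = ℤ.divides ℤ.0ℤ (cong ℤ.+_ (trans (cong toℕ (lookup-replicate r zeroₚ)) toℕ-zeroₚ))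

      coord-kernel : ∀ x → (∀ r → ℤ.+ p ℤ.∣ coord r x) → x ≡ 0ᵥ
      coord-kernel x zeros = begin
        x                              ≡⟨ sym (tabulate∘lookup x) ⟩
        tabulate (Vec.lookup x)   ≡⟨ tabulate-cong (λ r → trans (coordinate r) (sym (lookup-replicate r zeroₚ))) ⟩
        tabulate (Vec.lookup (0ᵥ {p} {n}))   ≡⟨ tabulate∘lookup 0ᵥ ⟩
        0ᵥ                             ∎
        where
        open ≡-Reasoning
        coordinate : ∀ r → Vec.lookup x r ≡ zeroₚ
        coordinate r = Fin.toℕ-injective (trans (sym (reduce (Vec.lookup x r)))
          (trans (n∣m⇒m%n≡0 _ p (ℤ.∣⇒∣ᵤ (zeros r))) (sym toℕ-zeroₚ)))

-- Indicators, counting, and inequalities between powers.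

module Additive where

  open import Data.Nat hiding (_/_; _%_)
  open import Data.Nat.DivMod using (_/_; _%_; m/n*n≤m; m≡m%n+[m/n]*n; m%n<n; m≥n⇒m/n>0)
  open import Data.Nat.Properties
  open import Data.Nat.Tactic.RingSolver using (solve-∀)

  open BigSum +-*-isCommutativeSemiring

  private variable
    B : Set

  𝟙 : ∀ {P : Set} → Dec P → ℕ
  𝟙 P? = if does P? then 1 else 0

  𝟙-yes : ∀ {P : Set} (P? : Dec P) → P → 𝟙 P? ≡ 1
  𝟙-yes (yes _) _  = refl
  𝟙-yes (no ¬p) p = ⊥-elim (¬p p)

  𝟙-no : ∀ {P : Set} (P? : Dec P) → ¬ P → 𝟙 P? ≡ 0
  𝟙-no (yes p) ¬p = ⊥-elim (¬p p)
  𝟙-no (no _)  _  = refl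

  𝟙-positive : ∀ {P : Set} (P? : Dec P) → 0 < 𝟙 P? → P
  𝟙-positive (yes p) _ = p

  𝟙≤1 : ∀ {P : Set} (P? : Dec P) → 𝟙 P? ≤ 1
  𝟙≤1 (yes _) = ≤-refl
  𝟙≤1 (no _)  = z≤n

  𝟙-mono : ∀ {P Q : Set} (P? : Dec P) (Q? : Dec Q) → (P → Q) → 𝟙 P? ≤ 𝟙 Q?
  𝟙-mono (no _)  Q? f = z≤n
  𝟙-mono (yes p) Q? f = ≤-reflexive (sym (𝟙-yes Q? (f p)))

  ∑-mono : ∀ (xs : List A) {f g : A → ℕ} → (∀ {x} → x ∈ xs → f x ≤ g x) → ∑ xs f ≤ ∑ xs g
  ∑-mono []       le = z≤n
  ∑-mono (x ∷ xs) le = +-mono-≤ (le (here refl)) (∑-mono xs (λ x∈ → le (there x∈)))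

  ∑-const : ∀ (xs : List A) c → ∑ xs (λ _ → c) ≡ length xs * c
  ∑-const []       c = refl
  ∑-const (x ∷ xs) c = cong (c +_) (∑-const xs c)

  ∑-∈ : ∀ {xs : List A} {x} (f : A → ℕ) → x ∈ xs → f x ≤ ∑ xs f
  ∑-∈ f (here refl) = m≤m+n _ _
  ∑-∈ {xs = y ∷ _} f (there x∈) = ≤-trans (∑-∈ f x∈) (m≤n+m _ (f y))

  length-filter : ∀ {p} {R : A → Set p} (R? : Decidable R) (xs : List A) →
    length (filter R? xs) ≡ ∑ xs (λ x → if does (R? x) then 1 else 0)
  length-filter R? []       = refl
  length-filter R? (x ∷ xs) with does (R? x)
  ... | true  = cong suc (length-filter R? xs)
  ... | false = length-filter R? xs

  ∑-filter : ∀ {p} {R : A → Set p} (R? : Decidable R) (xs : List A) (f : A → ℕ) →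
    ∑ (filter R? xs) f ≡ ∑ xs (λ x → (if does (R? x) then 1 else 0) * f x)
  ∑-filter R? []       f = refl
  ∑-filter R? (x ∷ xs) f with does (R? x)
  ... | true  = cong₂ _+_ (sym (+-identityʳ (f x))) (∑-filter R? xs f)
  ... | false = ∑-filter R? xs f

  unique-⊆⇒length≤ : ∀ {xs ys : List A} → Unique xs → (∀ {x} → x ∈ xs → x ∈ ys) → length xs ≤ length ys
  unique-⊆⇒length≤ []        sub = z≤n
  unique-⊆⇒length≤ {xs = x ∷ xs} {ys} (x∉ ∷ u) sub with ∈-∃++ (sub (here refl))
  ... | as , bs , refl = begin
    suc (length xs)          ≤⟨ s≤s (unique-⊆⇒length≤ u sub′) ⟩
    suc (length (as ++ bs))  ≡⟨ cong suc (List.length-++ as) ⟩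
    suc (length as + length bs) ≡⟨ sym (+-suc (length as) (length bs)) ⟩
    length as + suc (length bs) ≡⟨ sym (List.length-++ as) ⟩
    length (as ++ x ∷ bs)    ∎
    where
    open ≤-Reasoning
    sub′ : ∀ {z} → z ∈ xs → z ∈ as ++ bs
    sub′ z∈ with ∈-++⁻ as (sub (there z∈))
    ... | inj₁ z∈as         = ∈-++⁺ˡ z∈as
    ... | inj₂ (here refl)  = ⊥-elim (All.lookup x∉ z∈ refl)
    ... | inj₂ (there z∈bs) = ∈-++⁺ʳ as z∈bs

  ∑-max : ∀ (xs : List A) (f : A → ℕ) {x₀} → x₀ ∈ xs → ∃ λ x → x ∈ xs × ∑ xs f ≤ length xs * f x
  ∑-max (x ∷ [])     f _ = x , here refl , ≤-refl
  ∑-max (x ∷ y ∷ xs) f _ with ∑-max (y ∷ xs) f (here refl)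
  ... | z , z∈ , le with f x ≤? f z
  ...   | yes x≤z = z , there z∈ , +-mono-≤ x≤z le
  ...   | no  x≰z = x , here refl , +-monoʳ-≤ (f x) (≤-trans le (*-monoʳ-≤ (length (y ∷ xs)) (≰⇒≥ x≰z)))

  ∑-min : ∀ (xs : List A) (f : A → ℕ) {x₀} → x₀ ∈ xs → ∃ λ x → x ∈ xs × length xs * f x ≤ ∑ xs f
  ∑-min (x ∷ [])     f _ = x , here refl , ≤-refl
  ∑-min (x ∷ y ∷ xs) f _ with ∑-min (y ∷ xs) f (here refl)
  ... | z , z∈ , le with f x ≤? f z
  ...   | yes x≤z = x , here refl , +-monoʳ-≤ (f x) (≤-trans (*-monoʳ-≤ (length (y ∷ xs)) x≤z) le)
  ...   | no  x≰z = z , there z∈ , +-mono-≤ (≰⇒≥ x≰z) le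

  ^-distrib-* : ∀ a b n → (a * b) ^ n ≡ a ^ n * b ^ n
  ^-distrib-* a b zero    = refl
  ^-distrib-* a b (suc n) = begin
    a * b * (a * b) ^ n       ≡⟨ cong (a * b *_) (^-distrib-* a b n) ⟩
    a * b * (a ^ n * b ^ n)   ≡⟨ [m*n]*[o*p]≡[m*o]*[n*p] a b (a ^ n) (b ^ n) ⟩
    (a * a ^ n) * (b * b ^ n) ∎
    where open ≡-Reasoning

  -- The inequality ∑ f ≤ |xs| c^(1/N) without roots. As `c` need not be an N-th power, the terms
  -- are compared with the largest of them; `∑^-lower` uses the smallest in the same way.
  ∑^-upper : ∀ N .{{_ : NonZero N}} (xs : List A) (f : A → ℕ) {c} → (∀ {x} → x ∈ xs → f x ^ N ≤ c) →
    ∑ xs f ^ N ≤ length xs ^ N * c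
  ∑^-upper (suc N) []       f h = z≤n
  ∑^-upper N (x ∷ xs) f {c} h with ∑-max (x ∷ xs) f (here refl)
  ... | z , z∈ , le = begin
    ∑ (x ∷ xs) f ^ N                     ≤⟨ ^-monoˡ-≤ N le ⟩
    (length (x ∷ xs) * f z) ^ N          ≡⟨ ^-distrib-* (length (x ∷ xs)) (f z) N ⟩
    length (x ∷ xs) ^ N * f z ^ N        ≤⟨ *-monoʳ-≤ (length (x ∷ xs) ^ N) (h z∈) ⟩
    length (x ∷ xs) ^ N * c              ∎
    where open ≤-Reasoning

  ∑^-lower : ∀ N .{{_ : NonZero N}} (xs : List A) (f : A → ℕ) {c} → (∀ {x} → x ∈ xs → c ≤ f x ^ N) →
    length xs ^ N * c ≤ ∑ xs f ^ N
  ∑^-lower (suc N) []       f h = z≤n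
  ∑^-lower N (x ∷ xs) f {c} h with ∑-min (x ∷ xs) f (here refl)
  ... | z , z∈ , le = begin
    length (x ∷ xs) ^ N * c              ≤⟨ *-monoʳ-≤ (length (x ∷ xs) ^ N) (h z∈) ⟩
    length (x ∷ xs) ^ N * f z ^ N        ≡⟨ sym (^-distrib-* (length (x ∷ xs)) (f z) N) ⟩
    (length (x ∷ xs) * f z) ^ N          ≤⟨ ^-monoˡ-≤ N le ⟩
    ∑ (x ∷ xs) f ^ N                     ∎
    where open ≤-Reasoning

  length-filter-split : ∀ {A : Set} {R : A → Set} (R? : Decidable R) xs →
    length (filter R? xs) + length (filter (¬? ∘ R?) xs) ≡ length xs
  length-filter-split R? []       = refl
  length-filter-split R? (x ∷ xs) with does (R? x)
  ... | true  = cong suc (length-filter-split R? xs)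
  ... | false = trans (+-suc (length (filter R? xs)) _) (cong suc (length-filter-split R? xs))

  leastRatio : ∀ {A : Set} (a b : A → ℕ) (xs : List A) {x₀} → x₀ ∈ xs → (∀ {x} → x ∈ xs → 1 ≤ b x) →
    ∃ λ x → x ∈ xs × (∀ {y} → y ∈ xs → a x * b y ≤ a y * b x)
  leastRatio a b (x ∷ [])     _ pos = x , here refl , λ { (here refl) → ≤-refl }
  leastRatio a b (x ∷ y ∷ xs) _ pos with leastRatio a b (y ∷ xs) (here refl) (pos ∘ there)
  ... | z , z∈ , least with a x * b z ≤? a z * b x
  ...   | no  x≰z = z , there z∈ , λ { (here refl) → ≰⇒≥ x≰z ; (there w∈) → least w∈ }
  ...   | yes x≤z = x , here refl , λ { (here refl) → ≤-refl ; (there w∈) → transitive w∈ }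
    where
    open ≤-Reasoning
    transitive : ∀ {w} → w ∈ y ∷ xs → a x * b w ≤ a w * b x
    transitive {w} w∈ = *-cancelʳ-≤ _ _ (b z) {{>-nonZero (pos (there z∈))}} (begin
      a x * b w * b z   ≡⟨ lemma (a x) (b w) (b z) ⟩
      a x * b z * b w   ≤⟨ *-monoˡ-≤ (b w) x≤z ⟩
      a z * b x * b w   ≡⟨ lemma (a z) (b x) (b w) ⟩
      a z * b w * b x   ≤⟨ *-monoˡ-≤ (b x) (least w∈) ⟩
      a w * b z * b x   ≡⟨ lemma (a w) (b z) (b x) ⟩
      a w * b x * b z   ∎)
      where
      lemma : ∀ a b c → a * b * c ≡ a * c * b
      lemma = solve-∀

  -- Sumsets and Petridis' inequality.

  module Sumsets {E : Set} (_≟_ : DecidableEquality E) {_⊕_ : Op₂ E} {0# : E} {⊖_ : Op₁ E}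
    (isAb : IsAbelianGroup _≡_ _⊕_ 0# ⊖_) where

    open IsAbelianGroup isAb public using (assoc; comm; identityˡ; identityʳ; inverseˡ; inverseʳ; isGroup)
    private
      group : Group 0ℓ 0ℓ
      group = record { isGroup = isGroup }

    open import Algebra.Properties.Group group public
      using () renaming (∙-cancelˡ to ⊕-cancelˡ; ∙-cancelʳ to ⊕-cancelʳ; ⁻¹-injective to ⊖-injective; ⁻¹-involutive to ⊖-involutive)
    open import Data.List.Membership.DecPropositional _≟_ public using (_∈?_)
    open import Data.List.Relation.Unary.Unique.DecPropositional.Properties _≟_ public using (deduplicate-!)

    dedup : List E → List E
    dedup = deduplicate _≟_

    card : List E → ℕ
    card xs = length (dedup xs)

    ∈-dedup⁺ : ∀ {x xs} → x ∈ xs → x ∈ dedup xs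
    ∈-dedup⁺ = ∈-deduplicate⁺ _≟_

    ∈-dedup⁻ : ∀ {x} xs → x ∈ dedup xs → x ∈ xs
    ∈-dedup⁻ xs = ∈-deduplicate⁻ _≟_ xs

    card-mono : ∀ {xs ys} → (∀ {x} → x ∈ xs → x ∈ ys) → card xs ≤ card ys
    card-mono {xs} sub = unique-⊆⇒length≤ (deduplicate-! xs) (λ x∈ → ∈-dedup⁺ (sub (∈-dedup⁻ xs x∈)))

    unique⇒card : ∀ {xs} → Unique xs → length xs ≤ card xs
    unique⇒card u = unique-⊆⇒length≤ u ∈-dedup⁺

    card≤length : ∀ {xs ys} → (∀ {x} → x ∈ xs → x ∈ ys) → card xs ≤ length ys
    card≤length {xs} sub = unique-⊆⇒length≤ (deduplicate-! xs) (λ x∈ → sub (∈-dedup⁻ xs x∈))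

    card-++ : ∀ xs ys → card (xs ++ ys) ≡ length (filter (¬? ∘ (_∈? ys)) (dedup xs)) + card ys
    card-++ xs ys = trans (≤-antisym
        (unique-⊆⇒length≤ (deduplicate-! (xs ++ ys)) to)
        (unique-⊆⇒length≤ (Unique.++⁺ (Unique.filter⁺ (¬? ∘ (_∈? ys)) (deduplicate-! xs)) (deduplicate-! ys) disjoint) from))
      (List.length-++ new)
      where
      new = filter (¬? ∘ (_∈? ys)) (dedup xs)
      to : ∀ {x} → x ∈ dedup (xs ++ ys) → x ∈ new ++ dedup ys
      to {x} x∈ with x ∈? ys | ∈-++⁻ xs (∈-dedup⁻ (xs ++ ys) x∈)
      ... | yes x∈ys | _          = ∈-++⁺ʳ new (∈-dedup⁺ x∈ys)
      ... | no x∉ys  | inj₁ x∈xs  = ∈-++⁺ˡ (∈-filter⁺ (¬? ∘ (_∈? ys)) (∈-dedup⁺ x∈xs) x∉ys)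
      ... | no x∉ys  | inj₂ x∈ys  = ⊥-elim (x∉ys x∈ys)
      from : ∀ {x} → x ∈ new ++ dedup ys → x ∈ dedup (xs ++ ys)
      from x∈ with ∈-++⁻ new x∈
      ... | inj₁ x∈₁ = ∈-dedup⁺ (∈-++⁺ˡ (∈-dedup⁻ xs (proj₁ (∈-filter⁻ (¬? ∘ (_∈? ys)) {xs = dedup xs} x∈₁))))
      ... | inj₂ x∈₂ = ∈-dedup⁺ (∈-++⁺ʳ xs (∈-dedup⁻ ys x∈₂))
      disjoint : ∀ {x} → ¬ (x ∈ new × x ∈ dedup ys)
      disjoint (x∈₁ , x∈₂) = proj₂ (∈-filter⁻ (¬? ∘ (_∈? ys)) {xs = dedup xs} x∈₁) (∈-dedup⁻ ys x∈₂)

    infixl 6 _⊞_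

    -- Multiplicities are kept: there is one entry for each pair, hence one entry of `sums ℓ A` for
    -- each ℓ-tuple. Summing over such a list counts tuples, while `card` counts distinct sums.
    _⊞_ : List E → List E → List E
    X ⊞ Y = concatMap (λ x → map (x ⊕_) Y) X

    ∈-⊞⁺ : ∀ {X Y x y} → x ∈ X → y ∈ Y → x ⊕ y ∈ X ⊞ Y
    ∈-⊞⁺ {X} {Y} {x} x∈ y∈ = ∈-concatMap⁺ (λ x → map (x ⊕_) Y) (lose x∈ (∈-map⁺ (x ⊕_) y∈))

    ∈-⊞⁻ : ∀ X Y {z} → z ∈ X ⊞ Y → ∃ λ x → ∃ λ y → x ∈ X × y ∈ Y × z ≡ x ⊕ y
    ∈-⊞⁻ X Y z∈ with find (∈-concatMap⁻ (λ x → map (x ⊕_) Y) {xs = X} z∈)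
    ... | x , x∈ , z∈map with ∈-map⁻ (x ⊕_) z∈map
    ...   | y , y∈ , z≡ = x , y , x∈ , y∈ , z≡

    sums : ℕ → List E → List E
    sums zero    A = 0# ∷ []
    sums (suc ℓ) A = A ⊞ sums ℓ A

    length-⊞ : ∀ X Y → length (X ⊞ Y) ≡ length X * length Y
    length-⊞ []      Y = refl
    length-⊞ (x ∷ X) Y = trans (List.length-++ (map (x ⊕_) Y)) (cong₂ _+_ (List.length-map (x ⊕_) Y) (length-⊞ X Y))

    length-sums : ∀ ℓ A → length (sums ℓ A) ≡ length A ^ ℓ
    length-sums zero    A = refl
    length-sums (suc ℓ) A = trans (length-⊞ A (sums ℓ A)) (cong (length A *_) (length-sums ℓ A))

    ∑-⊞ : ∀ X Y (f : E → ℕ) → ∑ (X ⊞ Y) f ≡ ∑ X (λ x → ∑ Y (λ y → f (x ⊕ y)))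
    ∑-⊞ X Y f = trans (∑-concatMap (λ x → map (x ⊕_) Y) X f) (∑-cong X (λ x → ∑-map (x ⊕_) Y f))

    -- Petridis' argument: a subset X of least expansion under B does not lose under further sums.
    module _ (B : List E) where

      expansion : List E → ℕ
      expansion X = card (X ⊞ B)

      module _ (X : List E) (X-unique : Unique X)
        (least : ∀ {R : E → Set} (R? : Decidable R) →
          expansion X * length (filter R? X) ≤ expansion (filter R? X) * length X) where

        -- Induction on `C`. Let X₁ consist of the x for which c + x + B is already covered. A new c
        -- adds at most |X + B| - |X₁ + B| sums on the left, and at least |X| - |X₁| on the right,
        -- because c + x in C + X implies that x lies in X₁. Minimality applied to X₁ compares the
        -- two.
        petridis : ∀ C → card (C ⊞ dedup (X ⊞ B)) * length X ≤ expansion X * card (C ⊞ X)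
        petridis []      = z≤n
        petridis (c ∷ C) = +-cancelʳ-≤ (expansion X * length X₁) _ _ (begin
          card (Y ++ Z) * length X + expansion X * length X₁
            ≤⟨ +-monoʳ-≤ _ (least stays?) ⟩
          card (Y ++ Z) * length X + expansion X₁ * length X
            ≡⟨ sym (*-distribʳ-+ (length X) (card (Y ++ Z)) (expansion X₁)) ⟩
          (card (Y ++ Z) + expansion X₁) * length X
            ≤⟨ *-monoˡ-≤ (length X) upper ⟩
          (card Z + expansion X) * length X
            ≡⟨ *-distribʳ-+ (length X) (card Z) (expansion X) ⟩
          card Z * length X + expansion X * length X
            ≤⟨ +-monoˡ-≤ _ (petridis C) ⟩
          expansion X * card (C ⊞ X) + expansion X * length X
            ≡⟨ sym (*-distribˡ-+ (expansion X) (card (C ⊞ X)) (length X)) ⟩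
          expansion X * (card (C ⊞ X) + length X)
            ≤⟨ *-monoʳ-≤ (expansion X) lower ⟩
          expansion X * (card (map (c ⊕_) X ++ C ⊞ X) + length X₁)
            ≡⟨ *-distribˡ-+ (expansion X) _ (length X₁) ⟩
          expansion X * card (map (c ⊕_) X ++ C ⊞ X) + expansion X * length X₁ ∎)
          where
          open ≤-Reasoning
          XB = dedup (X ⊞ B)
          Y = map (c ⊕_) XB
          Z = C ⊞ XB
          stays? : Decidable (λ x → All (λ b → c ⊕ (x ⊕ b) ∈ Z) B)
          stays? x = All.all? (λ b → (c ⊕ (x ⊕ b)) ∈? Z) B
          X₁ = filter stays? X
          kept = filter (_∈? Z) (dedup Y)
          gone = filter (¬? ∘ (_∈? Z)) (dedup Y)
          X₁-kept : expansion X₁ ≤ length kept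
          X₁-kept = begin
            length (dedup (X₁ ⊞ B))                ≡⟨ sym (List.length-map (c ⊕_) (dedup (X₁ ⊞ B))) ⟩
            length (map (c ⊕_) (dedup (X₁ ⊞ B)))   ≤⟨ unique-⊆⇒length≤ (Unique.map⁺ (⊕-cancelˡ c _ _) (deduplicate-! (X₁ ⊞ B))) sub ⟩
            length kept                            ∎
            where
            sub : ∀ {z} → z ∈ map (c ⊕_) (dedup (X₁ ⊞ B)) → z ∈ kept
            sub z∈ with ∈-map⁻ (c ⊕_) z∈
            ... | y , y∈ , refl with ∈-⊞⁻ X₁ B (∈-dedup⁻ (X₁ ⊞ B) y∈)
            ...   | x , b , x∈ , b∈ , refl with ∈-filter⁻ stays? {xs = X} x∈
            ...     | x∈X , stays = ∈-filter⁺ (_∈? Z) (∈-dedup⁺ (∈-map⁺ (c ⊕_) (∈-dedup⁺ (∈-⊞⁺ x∈X b∈)))) (All.lookup stays b∈)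
          upper : card (Y ++ Z) + expansion X₁ ≤ card Z + expansion X
          upper = begin
            card (Y ++ Z) + expansion X₁          ≡⟨ cong (_+ expansion X₁) (card-++ Y Z) ⟩
            length gone + card Z + expansion X₁   ≤⟨ +-monoʳ-≤ (length gone + card Z) X₁-kept ⟩
            length gone + card Z + length kept    ≡⟨ lemma (length gone) (card Z) (length kept) ⟩
            card Z + (length kept + length gone)  ≡⟨ cong (card Z +_) (length-filter-split (_∈? Z) (dedup Y)) ⟩
            card Z + card Y                       ≤⟨ +-monoʳ-≤ (card Z) (≤-trans (card≤length {ys = Y} (λ y∈ → y∈)) (≤-reflexive (List.length-map (c ⊕_) XB))) ⟩
            card Z + expansion X                  ∎
            where
            lemma : ∀ g z k → g + z + k ≡ z + (k + g)
            lemma = solve-∀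
          cX = map (c ⊕_) X
          cX-unique : Unique cX
          cX-unique = Unique.map⁺ (⊕-cancelˡ c _ _) X-unique
          new = filter (¬? ∘ (_∈? (C ⊞ X))) (dedup cX)
          old = filter (_∈? (C ⊞ X)) (dedup cX)
          old≤ : length old ≤ length X₁
          old≤ = begin
            length old               ≤⟨ unique-⊆⇒length≤ (Unique.filter⁺ (_∈? (C ⊞ X)) (deduplicate-! cX)) sub ⟩
            length (map (c ⊕_) X₁)   ≡⟨ List.length-map (c ⊕_) X₁ ⟩
            length X₁                ∎
            where
            sub : ∀ {z} → z ∈ old → z ∈ map (c ⊕_) X₁
            sub z∈ with ∈-filter⁻ (_∈? (C ⊞ X)) {xs = dedup cX} z∈
            ... | z∈₁ , z∈CX with ∈-map⁻ (c ⊕_) (∈-dedup⁻ cX z∈₁)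
            ...   | x , x∈ , refl with ∈-⊞⁻ C X z∈CX
            ...     | c′ , x′ , c′∈ , x′∈ , eq = ∈-map⁺ (c ⊕_) (∈-filter⁺ stays? x∈ (All.tabulate λ {b} b∈ →
                        subst (_∈ Z) (trans (sym (assoc c′ x′ b)) (trans (cong (_⊕ b) (sym eq)) (assoc c x b)))
                          (∈-⊞⁺ c′∈ (∈-dedup⁺ (∈-⊞⁺ x′∈ b∈)))))
          lower : card (C ⊞ X) + length X ≤ card (cX ++ C ⊞ X) + length X₁
          lower = begin
            card (C ⊞ X) + length X                    ≡⟨ cong (card (C ⊞ X) +_) (sym (List.length-map (c ⊕_) X)) ⟩
            card (C ⊞ X) + length cX                   ≤⟨ +-monoʳ-≤ (card (C ⊞ X)) (unique⇒card cX-unique) ⟩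
            card (C ⊞ X) + card cX                     ≡⟨ cong (card (C ⊞ X) +_) (sym (length-filter-split (_∈? (C ⊞ X)) (dedup cX))) ⟩
            card (C ⊞ X) + (length old + length new)   ≡⟨ lemma (card (C ⊞ X)) (length old) (length new) ⟩
            (length new + card (C ⊞ X)) + length old   ≡⟨ cong (_+ length old) (sym (card-++ cX (C ⊞ X))) ⟩
            card (cX ++ C ⊞ X) + length old            ≤⟨ +-monoʳ-≤ (card (cX ++ C ⊞ X)) old≤ ⟩
            card (cX ++ C ⊞ X) + length X₁             ∎
            where
            lemma : ∀ c o n → c + (o + n) ≡ n + c + o
            lemma = solve-∀

        iterate : ∀ j → card (sums j B ⊞ X) * length X ^ j ≤ expansion X ^ j * length X
        iterate zero = begin
          card (sums 0 B ⊞ X) * 1   ≡⟨ *-identityʳ _ ⟩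
          card (sums 0 B ⊞ X)       ≤⟨ card≤length {ys = X} sub ⟩
          length X                  ≡⟨ sym (+-identityʳ _) ⟩
          1 * length X              ∎
          where
          open ≤-Reasoning
          sub : ∀ {z} → z ∈ sums 0 B ⊞ X → z ∈ X
          sub z∈ with ∈-⊞⁻ (sums 0 B) X z∈
          ... | _ , x , here refl , x∈ , refl = subst (_∈ X) (sym (identityˡ x)) x∈
        iterate (suc j) = begin
          card (sums (suc j) B ⊞ X) * (length X * length X ^ j)
            ≤⟨ *-monoˡ-≤ (length X * length X ^ j) (card-mono sub) ⟩
          card (sums j B ⊞ dedup (X ⊞ B)) * (length X * length X ^ j)
            ≡⟨ sym (*-assoc (card (sums j B ⊞ dedup (X ⊞ B))) (length X) (length X ^ j)) ⟩
          card (sums j B ⊞ dedup (X ⊞ B)) * length X * length X ^ j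
            ≤⟨ *-monoˡ-≤ (length X ^ j) (petridis (sums j B)) ⟩
          expansion X * card (sums j B ⊞ X) * length X ^ j
            ≡⟨ *-assoc (expansion X) _ (length X ^ j) ⟩
          expansion X * (card (sums j B ⊞ X) * length X ^ j)
            ≤⟨ *-monoʳ-≤ (expansion X) (iterate j) ⟩
          expansion X * (expansion X ^ j * length X)
            ≡⟨ sym (*-assoc (expansion X) _ (length X)) ⟩
          expansion X ^ suc j * length X ∎
          where
          open ≤-Reasoning
          sub : ∀ {z} → z ∈ sums (suc j) B ⊞ X → z ∈ sums j B ⊞ dedup (X ⊞ B)
          sub z∈ with ∈-⊞⁻ (sums (suc j) B) X z∈
          ... | s , x , s∈ , x∈ , refl with ∈-⊞⁻ B (sums j B) s∈
          ...   | b , u , b∈ , u∈ , refl = subst (_∈ sums j B ⊞ dedup (X ⊞ B))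
                    (trans (sym (assoc u x b)) (trans (comm (u ⊕ x) b) (sym (assoc b u x)))) (∈-⊞⁺ u∈ (∈-dedup⁺ (∈-⊞⁺ x∈ b∈)))

      -- Plünnecke's inequality for iterated sums: take a nonempty sublist X of `P` minimising |X +
      -- B| / |X|, iterate `petridis`, and bound |jB| by |jB + X|.
      iteratedSumset : ∀ P {x₀} → x₀ ∈ P → Unique P → ∀ j →
        card (sums j B) * length P ^ j ≤ expansion P ^ j * length P
      iteratedSumset P x₀∈ P-unique j = conclude (leastRatio expansion length candidates P-candidate nonempty)
        where
        nonempty? : Decidable (λ (X : List E) → 1 ≤ length X)
        nonempty? X = 1 ≤? length X
        candidates = filter nonempty? (subs P)
        nonempty : ∀ {X} → X ∈ candidates → 1 ≤ length X
        nonempty X∈ = proj₂ (∈-filter⁻ nonempty? {xs = subs P} X∈)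
        sub-P : ∀ {X} → X ∈ candidates → X ⊑ P
        sub-P X∈ = ∈-subs⁻ (proj₁ (∈-filter⁻ nonempty? {xs = subs P} X∈))
        P-candidate : P ∈ candidates
        P-candidate = ∈-filter⁺ nonempty? (∈-subs⁺ ⊆-refl) (∈-length x₀∈)
        conclude : (∃ λ X → X ∈ candidates × (∀ {Y} → Y ∈ candidates → expansion X * length Y ≤ expansion Y * length X)) →
          card (sums j B) * length P ^ j ≤ expansion P ^ j * length P
        conclude ([] , X∈ , _) with () ← nonempty X∈
        conclude (X@(x ∷ _) , X∈ , least) = *-cancelʳ-≤ _ _ (length X ^ j) {{m^n≢0 (length X) j}} (begin
          card (sums j B) * length P ^ j * length X ^ j
            ≡⟨ lemma (card (sums j B)) (length P ^ j) (length X ^ j) ⟩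
          card (sums j B) * length X ^ j * length P ^ j
            ≤⟨ *-monoˡ-≤ (length P ^ j) (*-monoˡ-≤ (length X ^ j) shifted) ⟩
          card (sums j B ⊞ X) * length X ^ j * length P ^ j
            ≤⟨ *-monoˡ-≤ (length P ^ j) (iterate X X-unique least-filter j) ⟩
          expansion X ^ j * length X * length P ^ j
            ≡⟨ lemma (expansion X ^ j) (length X) (length P ^ j) ⟩
          expansion X ^ j * length P ^ j * length X
            ≡⟨ cong (_* length X) (sym (^-distrib-* (expansion X) (length P) j)) ⟩
          (expansion X * length P) ^ j * length X
            ≤⟨ *-mono-≤ (^-monoˡ-≤ j (least P-candidate)) (Sub.length-mono-≤ (sub-P X∈)) ⟩
          (expansion P * length X) ^ j * length P
            ≡⟨ cong (_* length P) (^-distrib-* (expansion P) (length X) j) ⟩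
          expansion P ^ j * length X ^ j * length P
            ≡⟨ lemma (expansion P ^ j) (length X ^ j) (length P) ⟩
          expansion P ^ j * length P * length X ^ j ∎)
          where
          open ≤-Reasoning
          lemma : ∀ a b c → a * b * c ≡ a * c * b
          lemma = solve-∀
          X-unique : Unique X
          X-unique = unique-⊑ (sub-P X∈) P-unique
          least-filter : ∀ {R : E → Set} (R? : Decidable R) →
            expansion X * length (filter R? X) ≤ expansion (filter R? X) * length X
          least-filter R? with 1 ≤? length (filter R? X)
          ... | yes ne = least (∈-filter⁺ nonempty? (∈-subs⁺ (⊆-trans (Sub.filter-⊆ R? X) (sub-P X∈))) ne)
          ... | no  ¬ne = ≤-trans (≤-reflexive (trans (cong (expansion X *_) (n<1⇒n≡0 (≰⇒> ¬ne))) (*-zeroʳ (expansion X)))) z≤n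
          shifted : card (sums j B) ≤ card (sums j B ⊞ X)
          shifted = begin
            card (sums j B)                            ≡⟨ sym (List.length-map (_⊕ x) (dedup (sums j B))) ⟩
            length (map (_⊕ x) (dedup (sums j B)))     ≤⟨ unique-⊆⇒length≤ (Unique.map⁺ (⊕-cancelʳ x _ _) (deduplicate-! (sums j B))) sub ⟩
            card (sums j B ⊞ X)                        ∎
            where
            sub : ∀ {z} → z ∈ map (_⊕ x) (dedup (sums j B)) → z ∈ dedup (sums j B ⊞ X)
            sub z∈ with ∈-map⁻ (_⊕ x) z∈
            ... | s , s∈ , refl = ∈-dedup⁺ (∈-⊞⁺ (∈-dedup⁻ (sums j B) s∈) (here refl))

  0^n≡0 : ∀ n .{{_ : NonZero n}} → 0 ^ n ≡ 0
  0^n≡0 (suc _) = refl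

  1≤^⇒1≤ : ∀ n .{{_ : NonZero n}} {k} → 1 ≤ k ^ n → 1 ≤ k
  1≤^⇒1≤ n {zero}  h = ≤-trans h (≤-reflexive (0^n≡0 n))
  1≤^⇒1≤ n {suc _} h = s≤s z≤n

  nonempty⇒∃ : ∀ {A : Set} (xs : List A) → 1 ≤ length xs → ∃ λ x → x ∈ xs
  nonempty⇒∃ (x ∷ xs) _ = x , here refl

  𝟙¬*^≤ : ∀ {P : Set} N .{{_ : NonZero N}} {c L} (P? : Dec P) → (¬ P → c ^ N ≤ L) → (𝟙 (¬? P?) * c) ^ N ≤ L
  𝟙¬*^≤ N     (yes _) h = ≤-trans (≤-reflexive (0^n≡0 N)) z≤n
  𝟙¬*^≤ N {c} (no ¬p) h = ≤-trans (≤-reflexive (cong (_^ N) (+-identityʳ c))) (h ¬p)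

  𝟙*𝟙-mono : ∀ {P Q R : Set} (P? : Dec P) (Q? : Dec Q) (R? : Dec R) → (P → Q → R) → 𝟙 P? * 𝟙 Q? ≤ 𝟙 R?
  𝟙*𝟙-mono (no _)  Q?      R? f = z≤n
  𝟙*𝟙-mono (yes _) (no _)  R? f = z≤n
  𝟙*𝟙-mono (yes p) (yes q) R? f = ≤-reflexive (sym (𝟙-yes R? (f p q)))

  ≤-indicator : ∀ {P : Set} {n a} (P? : Dec P) → (¬ P → n ≤ a) → n ≤ n * 𝟙 P? + a
  ≤-indicator {n = n} (yes _) h = ≤-trans (≤-reflexive (sym (*-identityʳ n))) (m≤m+n _ _)
  ≤-indicator {n = n} (no ¬p) h = ≤-trans (h ¬p) (m≤n+m _ (n * 0))

  𝟙-both : ∀ {P Q : Set} (P? : Dec P) (Q? : Dec Q) → 1 ≤ 𝟙 (P? ×-dec Q?) + (𝟙 (¬? P?) + 𝟙 (¬? Q?))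
  𝟙-both (yes _) (yes _) = s≤s z≤n
  𝟙-both (yes _) (no _)  = s≤s z≤n
  𝟙-both (no _)  Q?      = s≤s z≤n

  -- The Balog-Szemerédi-Gowers argument.

  module BSG {E : Set} (_≟_ : DecidableEquality E) {_⊕_ : Op₂ E} {0# : E} {⊖_ : Op₁ E}
    (isAb : IsAbelianGroup _≡_ _⊕_ 0# ⊖_) where

    open Sumsets _≟_ isAb

    infixl 6 _⊝_
    _⊝_ : E → E → E
    x ⊝ y = x ⊕ (⊖ y)

    ⊝-⊕ : ∀ x y → (x ⊝ y) ⊕ y ≡ x
    ⊝-⊕ x y = trans (assoc x (⊖ y) y) (trans (cong (x ⊕_) (inverseˡ y)) (identityʳ x))

    ⊝-⊕-⊕ : ∀ u z w → (u ⊝ z) ⊕ (z ⊕ w) ≡ u ⊕ w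
    ⊝-⊕-⊕ u z w = trans (sym (assoc _ z w)) (cong (_⊕ w) (⊝-⊕ u z))

    ⊝-⊝ : ∀ u v z → (u ⊝ v) ⊕ (v ⊝ z) ≡ u ⊝ z
    ⊝-⊝ u v z = ⊝-⊕-⊕ u v (⊖ z)

    ⊝-cancelʳ : ∀ u z w → (u ⊕ w) ⊝ (z ⊕ w) ≡ u ⊝ z
    ⊝-cancelʳ u z w = ⊕-cancelʳ (z ⊕ w) _ _ (trans (⊝-⊕ (u ⊕ w) (z ⊕ w)) (sym (⊝-⊕-⊕ u z w)))

    reps : List E → E → ℕ
    reps X d = ∑ X (λ y → 𝟙 ((d ⊕ y) ∈? X))

    ∑-reps : ∀ {Δ} X → Unique Δ → ∑ Δ (reps X) ≤ length X * length X
    ∑-reps {Δ} X u = begin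
      ∑ Δ (λ d → ∑ X (λ y → 𝟙 ((d ⊕ y) ∈? X)))   ≡⟨ ∑-comm Δ X _ ⟩
      ∑ X (λ y → ∑ Δ (λ d → 𝟙 ((d ⊕ y) ∈? X)))   ≤⟨ ∑-mono X (λ {y} _ → row y) ⟩
      ∑ X (λ _ → length X)                       ≡⟨ ∑-const X (length X) ⟩
      length X * length X                        ∎
      where
      open ≤-Reasoning
      row : ∀ y → ∑ Δ (λ d → 𝟙 ((d ⊕ y) ∈? X)) ≤ length X
      row y = begin
        ∑ Δ (λ d → 𝟙 ((d ⊕ y) ∈? X))          ≡⟨ sym (length-filter hit? Δ) ⟩
        length (filter hit? Δ)                ≡⟨ sym (List.length-map (_⊕ y) (filter hit? Δ)) ⟩
        length (map (_⊕ y) (filter hit? Δ))   ≤⟨ unique-⊆⇒length≤ (Unique.map⁺ (⊕-cancelʳ y _ _) (Unique.filter⁺ hit? u)) sub ⟩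
        length X                              ∎
        where
        hit? : Decidable (λ d → (d ⊕ y) ∈ X)
        hit? d = (d ⊕ y) ∈? X
        sub : ∀ {z} → z ∈ map (_⊕ y) (filter hit? Δ) → z ∈ X
        sub z∈ with ∈-map⁻ (_⊕ y) z∈
        ... | d , d∈ , refl = proj₂ (∈-filter⁻ hit? {xs = Δ} d∈)

    popular-few : ∀ N .{{_ : NonZero N}} {Δ} X {c} → Unique Δ → (∀ {d} → d ∈ Δ → c ≤ reps X d ^ N) →
      length Δ ^ N * c ≤ (length X * length X) ^ N
    popular-few N X u pop = ≤-trans (∑^-lower N _ (reps X) pop) (^-monoˡ-≤ N (∑-reps X u))

    count≤reps : ∀ {S} X d (f : E → E) → Unique S → (∀ {x y} → f x ≡ f y → x ≡ y) →
      (∀ {s} → s ∈ S → f s ∈ X × d ⊕ f s ∈ X) → length S ≤ reps X d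
    count≤reps {S} X d f u inj mem = begin
      length S                                  ≡⟨ sym (List.length-map f S) ⟩
      length (map f S)                          ≤⟨ unique-⊆⇒length≤ (Unique.map⁺ inj u) sub ⟩
      length (filter (λ y → (d ⊕ y) ∈? X) X)    ≡⟨ length-filter (λ y → (d ⊕ y) ∈? X) X ⟩
      reps X d                                  ∎
      where
      open ≤-Reasoning
      sub : ∀ {z} → z ∈ map f S → z ∈ filter (λ y → (d ⊕ y) ∈? X) X
      sub z∈ with ∈-map⁻ f z∈
      ... | s , s∈ , refl = ∈-filter⁺ (λ y → (d ⊕ y) ∈? X) (proj₁ (mem s∈)) (proj₂ (mem s∈))

    -- The graph joins u and w from `V` when u + w lies in `T`. Since `V` carries multiplicities,
    -- degrees count tuples; `spread` converts a large count of tuples back into many distinct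
    -- elements.
    module _ (N : ℕ) .{{_ : NonZero N}} (V T : List E) (κ L : ℕ)
      (spread : ∀ T′ → L ≤ ∑ V (λ v → 𝟙 (v ∈? T′)) ^ N → κ < length T′ ^ N) where

      neighbour? : ∀ w → Decidable (λ u → (u ⊕ w) ∈ T)
      neighbour? w u = (u ⊕ w) ∈? T

      neighbours : E → List E
      neighbours w = filter (neighbour? w) V

      edges : ℕ
      edges = ∑ V (λ w → length (neighbours w))

      common? : ∀ u u′ → Decidable (λ w → (u ⊕ w) ∈ T × (u′ ⊕ w) ∈ T)
      common? u u′ w = ((u ⊕ w) ∈? T) ×-dec ((u′ ⊕ w) ∈? T)

      common : E → E → ℕ
      common u u′ = ∑ V (λ w → 𝟙 (common? u u′ w))

      good? : ∀ u u′ → Dec (L ≤ common u u′ ^ N)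
      good? u u′ = L ≤? common u u′ ^ N

      bad : E → E → ℕ
      bad u u′ = 𝟙 (¬? (good? u u′))

      badPairs : E → ℕ
      badPairs w = ∑ (neighbours w) (λ u → ∑ (neighbours w) (bad u))

      private
        v = length V

      ∑-badPairs : ∑ V badPairs ≡ ∑ V (λ u → ∑ V (λ u′ → bad u u′ * common u u′))
      ∑-badPairs = begin
        ∑ V (λ w → ∑ (neighbours w) (λ u → ∑ (neighbours w) (bad u)))
          ≡⟨ ∑-cong V (λ w → trans (∑-filter (neighbour? w) V _)
               (∑-cong V (λ u → cong (𝟙 (neighbour? w u) *_) (∑-filter (neighbour? w) V (bad u))))) ⟩
        ∑ V (λ w → ∑ V (λ u → 𝟙 (neighbour? w u) * ∑ V (λ u′ → 𝟙 (neighbour? w u′) * bad u u′)))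
          ≡⟨ ∑-comm V V _ ⟩
        ∑ V (λ u → ∑ V (λ w → 𝟙 (neighbour? w u) * ∑ V (λ u′ → 𝟙 (neighbour? w u′) * bad u u′)))
          ≡⟨ ∑-cong V (λ u → trans (∑-cong V (λ w → sym (∑-* V (𝟙 (neighbour? w u)) _))) (∑-comm V V _)) ⟩
        ∑ V (λ u → ∑ V (λ u′ → ∑ V (λ w → 𝟙 (neighbour? w u) * (𝟙 (neighbour? w u′) * bad u u′))))
          ≡⟨ ∑-cong V (λ u → ∑-cong V (λ u′ → trans (∑-cong V (pointwise u u′)) (∑-* V (bad u u′) _))) ⟩
        ∑ V (λ u → ∑ V (λ u′ → bad u u′ * common u u′)) ∎
        where
        open ≡-Reasoning
        pointwise : ∀ u u′ w → 𝟙 (neighbour? w u) * (𝟙 (neighbour? w u′) * bad u u′) ≡ bad u u′ * 𝟙 (common? u u′ w)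
        pointwise u u′ w with does (neighbour? w u) | does (neighbour? w u′)
        ... | true  | true  = trans (+-identityʳ _) (trans (+-identityʳ _) (sym (*-identityʳ _)))
        ... | true  | false = sym (*-zeroʳ (bad u u′))
        ... | false | _     = sym (*-zeroʳ (bad u u′))

      -- Double counting: a bad pair lies in the neighbourhoods of fewer than L^(1/N) vertices.
      badPairs-few : ∑ V badPairs ^ N ≤ v ^ N * (v ^ N * L)
      badPairs-few = ≤-trans (≤-reflexive (cong (_^ N) ∑-badPairs))
        (∑^-upper N V _ (λ {u} _ → ∑^-upper N V _ (λ {u′} _ → term u u′)))
        where
        term : ∀ u u′ → (bad u u′ * common u u′) ^ N ≤ L
        term u u′ = 𝟙¬*^≤ N (good? u u′) (λ ¬good → <⇒≤ (≰⇒> ¬good))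

      module _ {v₀ : E} (v₀∈ : v₀ ∈ V)
        (dense₁ : 64 ^ N * (v ^ N * (v ^ N * (v ^ N * L))) < (edges * edges) ^ N)
        (dense₂ : (4 * v) ^ N * L ≤ edges ^ N) where

        Rich : E → Set
        Rich w = edges ≤ 2 * v * length (neighbours w) ×
                 16 * badPairs w ≤ length (neighbours w) * length (neighbours w)

        rich? : Decidable Rich
        rich? w = (edges ≤? 2 * v * length (neighbours w)) ×-dec
                  (16 * badPairs w ≤? length (neighbours w) * length (neighbours w))

        private
          instance
            v≢0 : NonZero v
            v≢0 = >-nonZero (∈-length v₀∈)

        -- A vertex failing the first condition has few edges, and one failing only the second has
        -- many bad pairs. If all vertices failed, summing would give edges² ≤ 64 v ∑ badPairs,
        -- against `dense₁`.
        richVertex : ∃ λ w → w ∈ V × Rich w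
        richVertex with any? rich? V
        ... | yes found = find found
        ... | no  none  = ⊥-elim (<⇒≱ dense₁ (begin
          (edges * edges) ^ N                        ≤⟨ ^-monoˡ-≤ N bound ⟩
          (64 * (v * ∑ V badPairs)) ^ N              ≡⟨ trans (^-distrib-* 64 _ N) (cong (64 ^ N *_) (^-distrib-* v _ N)) ⟩
          64 ^ N * (v ^ N * ∑ V badPairs ^ N)        ≤⟨ *-monoʳ-≤ (64 ^ N) (*-monoʳ-≤ (v ^ N) badPairs-few) ⟩
          64 ^ N * (v ^ N * (v ^ N * (v ^ N * L)))   ∎))
          where
          open ≤-Reasoning
          term : ∀ {w} → w ∈ V →
            2 * v * edges * length (neighbours w) ≤ 64 * (v * v) * badPairs w + edges * edges
          term {w} w∈ with edges ≤? 2 * v * length (neighbours w) | 16 * badPairs w ≤? length (neighbours w) * length (neighbours w)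
          ... | yes e | yes b = ⊥-elim (none (lose w∈ (e , b)))
          ... | no ¬e | _ = begin
            2 * v * edges * n      ≡⟨ lemma v edges n ⟩
            edges * (2 * v * n)    ≤⟨ *-monoʳ-≤ edges (≰⇒≥ ¬e) ⟩
            edges * edges          ≤⟨ m≤n+m _ _ ⟩
            64 * (v * v) * badPairs w + edges * edges ∎
            where
            n = length (neighbours w)
            lemma : ∀ v e n → 2 * v * e * n ≡ e * (2 * v * n)
            lemma = solve-∀
          ... | yes e | no ¬b = begin
            2 * v * edges * n                ≤⟨ *-monoˡ-≤ n (*-monoʳ-≤ (2 * v) e) ⟩
            2 * v * (2 * v * n) * n          ≡⟨ lemma v n ⟩
            4 * (v * v) * (n * n)            ≤⟨ *-monoʳ-≤ (4 * (v * v)) (≰⇒≥ ¬b) ⟩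
            4 * (v * v) * (16 * badPairs w)  ≡⟨ lemma′ (v * v) (badPairs w) ⟩
            64 * (v * v) * badPairs w        ≤⟨ m≤m+n _ _ ⟩
            64 * (v * v) * badPairs w + edges * edges ∎
            where
            n = length (neighbours w)
            lemma : ∀ v n → 2 * v * (2 * v * n) * n ≡ 4 * (v * v) * (n * n)
            lemma = solve-∀
            lemma′ : ∀ v b → 4 * v * (16 * b) ≡ 64 * v * b
            lemma′ = solve-∀
          bound : edges * edges ≤ 64 * (v * ∑ V badPairs)
          bound = *-cancelˡ-≤ v (+-cancelʳ-≤ (v * (edges * edges)) _ _ (begin
            v * (edges * edges) + v * (edges * edges)
              ≡⟨ lemma v edges ⟩
            2 * v * edges * edges
              ≡⟨ sym (∑-* V (2 * v * edges) (λ w → length (neighbours w))) ⟩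
            ∑ V (λ w → 2 * v * edges * length (neighbours w))
              ≤⟨ ∑-mono V term ⟩
            ∑ V (λ w → 64 * (v * v) * badPairs w + edges * edges)
              ≡⟨ trans (∑-+ V _ _) (cong₂ _+_ (∑-* V (64 * (v * v)) badPairs) (∑-const V (edges * edges))) ⟩
            64 * (v * v) * ∑ V badPairs + v * (edges * edges)
              ≡⟨ cong (_+ v * (edges * edges)) (lemma′ v (∑ V badPairs)) ⟩
            v * (64 * (v * ∑ V badPairs)) + v * (edges * edges) ∎))
            where
            lemma : ∀ v e → v * (e * e) + v * (e * e) ≡ 2 * v * e * e
            lemma = solve-∀
            lemma′ : ∀ v b → 64 * (v * v) * b ≡ v * (64 * (v * b))
            lemma′ = solve-∀

        popularDifferences : List E
        popularDifferences = filter (λ d → suc κ ≤? reps T d ^ N) (dedup (T ⊞ map ⊖_ T))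

        popularDifferences-few : length popularDifferences ^ N * suc κ ≤ (length T * length T) ^ N
        popularDifferences-few = popular-few N T (Unique.filter⁺ popular? (deduplicate-! (T ⊞ map ⊖_ T)))
          (λ d∈ → proj₂ (∈-filter⁻ popular? {xs = dedup (T ⊞ map ⊖_ T)} d∈))
          where
          popular? : Decidable (λ d → suc κ ≤ reps T d ^ N)
          popular? d = suc κ ≤? reps T d ^ N

        -- Each common neighbour w writes u - z as (u + w) - (z + w) with both terms in `T`, and by
        -- `spread` more than κ^(1/N) of these w are distinct.
        good⇒popular : ∀ {u z} → L ≤ common u z ^ N → u ⊝ z ∈ popularDifferences
        good⇒popular {u} {z} good = ∈-filter⁺ (λ d → suc κ ≤? reps T d ^ N) difference popular
          where
          S = filter (common? u z) V
          in-S : ∀ {w} → w ∈ S → (u ⊕ w) ∈ T × (z ⊕ w) ∈ T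
          in-S w∈ = proj₂ (∈-filter⁻ (common? u z) {xs = V} w∈)
          large : suc κ ≤ card S ^ N
          large = spread (dedup S) (≤-trans good (^-monoˡ-≤ N (∑-mono V λ {w} w∈ →
            𝟙-mono (common? u z w) (w ∈? dedup S) (λ c → ∈-dedup⁺ (∈-filter⁺ (common? u z) w∈ c)))))
          popular : suc κ ≤ reps T (u ⊝ z) ^ N
          popular = ≤-trans large (^-monoˡ-≤ N (count≤reps T (u ⊝ z) (z ⊕_) (deduplicate-! S) (⊕-cancelˡ z _ _)
            (λ {w} w∈ → let uw , zw = in-S (∈-dedup⁻ S w∈) in zw , subst (_∈ T) (sym (⊝-⊕-⊕ u z w)) uw)))
          difference : u ⊝ z ∈ dedup (T ⊞ map ⊖_ T)
          difference =
            let w , w∈ = nonempty⇒∃ (dedup S) (1≤^⇒1≤ N (≤-trans (s≤s z≤n) large))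
                uw , zw = in-S (∈-dedup⁻ S w∈)
            in ∈-dedup⁺ (subst (_∈ T ⊞ map ⊖_ T) (⊝-cancelʳ u z w) (∈-⊞⁺ uw (∈-map⁺ ⊖_ zw)))

        -- Inside the neighbourhood of a rich vertex, `Q` keeps the elements that are bad with at
        -- most a quarter of it. For u, u′ in `Q`, at least half of the neighbourhood consists of z
        -- good with both, and u - u′ = (u - z) - (u′ - z) is then a difference of popular
        -- differences in more than κ^(1/N) ways. Two popularity counts give |Q - Q| ≤ |T|⁴ /
        -- κ^(3/N).
        structured : ∃ λ Q → edges ≤ 4 * v * ∑ V (λ x → 𝟙 (x ∈? Q)) × (∃ λ w → ∀ {u} → u ∈ Q → u ⊕ w ∈ T) ×
          ∃ λ Δ → (∀ {u u′} → u ∈ Q → u′ ∈ Q → u ⊝ u′ ∈ Δ) ×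
                  length Δ ^ N * (suc κ * (suc κ * suc κ)) ≤ ((length T * length T) ^ N) * ((length T * length T) ^ N)
        structured with richVertex
        ... | w , w∈ , rich , fewBad = Q , Q-large , (w , λ u∈ → proj₂ (∈-filter⁻ (neighbour? w) {xs = V} (proj₁ (∈-filter⁻ typical? {xs = W} u∈)))) , Δ , (λ u∈ u′∈ → ∈-dedup⁺ (∈-⊞⁺ u∈ (∈-map⁺ ⊖_ u′∈))) , Δ-small
          where
          open ≤-Reasoning
          W = neighbours w
          n = length W
          badAt : E → ℕ
          badAt u = ∑ W (bad u)
          typical? : Decidable (λ u → 4 * badAt u ≤ n)
          typical? u = 4 * badAt u ≤? n
          Q = filter typical? W
          Δ = dedup (Q ⊞ map ⊖_ Q)
          ∑-typical : n * n ≤ n * length Q + 4 * badPairs w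
          ∑-typical = begin
            n * n                                                   ≡⟨ sym (∑-const W n) ⟩
            ∑ W (λ _ → n)                                           ≤⟨ ∑-mono W (λ {u} _ → term u) ⟩
            ∑ W (λ u → n * 𝟙 (typical? u) + 4 * badAt u)            ≡⟨ trans (∑-+ W _ _) (cong₂ _+_ (∑-* W n _) (∑-* W 4 badAt)) ⟩
            n * ∑ W (λ u → 𝟙 (typical? u)) + 4 * badPairs w         ≡⟨ cong (λ k → n * k + 4 * badPairs w) (sym (length-filter typical? W)) ⟩
            n * length Q + 4 * badPairs w                           ∎
            where
            term : ∀ u → n ≤ n * 𝟙 (typical? u) + 4 * badAt u
            term u = ≤-indicator (typical? u) ≰⇒≥
          half′ : n * (2 * n) ≤ n * (4 * length Q)
          half′ = +-cancelʳ-≤ (n * (2 * n)) _ _ (begin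
            n * (2 * n) + n * (2 * n)                  ≡⟨ lemma₁ n ⟩
            4 * (n * n)                                ≤⟨ *-monoʳ-≤ 4 ∑-typical ⟩
            4 * (n * length Q + 4 * badPairs w)        ≡⟨ lemma₂ (n * length Q) (badPairs w) ⟩
            4 * (n * length Q) + 16 * badPairs w       ≤⟨ +-monoʳ-≤ (4 * (n * length Q)) fewBad ⟩
            4 * (n * length Q) + n * n                 ≤⟨ +-mono-≤ (≤-reflexive (lemma₃ n (length Q))) (*-monoʳ-≤ n (m≤m+n n _)) ⟩
            n * (4 * length Q) + n * (2 * n)           ∎)
            where
            lemma₁ : ∀ n → n * (2 * n) + n * (2 * n) ≡ 4 * (n * n)
            lemma₁ = solve-∀
            lemma₂ : ∀ q b → 4 * (q + 4 * b) ≡ 4 * q + 16 * b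
            lemma₂ = solve-∀
            lemma₃ : ∀ n q → 4 * (n * q) ≡ n * (4 * q)
            lemma₃ = solve-∀
          cancel-n : ∀ n k → n * (2 * n) ≤ n * (4 * k) → n ≤ 2 * k
          cancel-n zero      k _ = z≤n
          cancel-n n@(suc _) k h = *-cancelˡ-≤ 2 (≤-trans (*-cancelˡ-≤ n h) (≤-reflexive (*-assoc 2 2 k)))
          Q-large : edges ≤ 4 * v * ∑ V (λ x → 𝟙 (x ∈? Q))
          Q-large = begin
            edges                              ≤⟨ rich ⟩
            2 * v * n                          ≤⟨ *-monoʳ-≤ (2 * v) (cancel-n n (length Q) half′) ⟩
            2 * v * (2 * length Q)             ≡⟨ lemma v (length Q) ⟩
            4 * v * length Q                   ≡⟨ cong (4 * v *_) (trans (length-filter typical? W) (∑-filter (neighbour? w) V _)) ⟩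
            4 * v * ∑ V (λ x → 𝟙 (neighbour? w x) * 𝟙 (typical? x)) ≤⟨ *-monoʳ-≤ (4 * v) (∑-mono V (λ {x} x∈ → term x x∈)) ⟩
            4 * v * ∑ V (λ x → 𝟙 (x ∈? Q))     ∎
            where
            lemma : ∀ v q → 2 * v * (2 * q) ≡ 4 * v * q
            lemma = solve-∀
            term : ∀ x → x ∈ V → 𝟙 (neighbour? w x) * 𝟙 (typical? x) ≤ 𝟙 (x ∈? Q)
            term x x∈ = 𝟙*𝟙-mono (neighbour? w x) (typical? x) (x ∈? Q)
              (λ nb t → ∈-filter⁺ typical? (∈-filter⁺ (neighbour? w) x∈ nb) t)
          difference-popular : ∀ {u u′} → u ∈ Q → u′ ∈ Q → suc κ ≤ reps popularDifferences (u ⊝ u′) ^ N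
          difference-popular {u} {u′} u∈ u′∈ = ≤-trans large (^-monoˡ-≤ N
            (count≤reps popularDifferences (u ⊝ u′) (u′ ⊝_) (deduplicate-! Z) (λ eq → ⊖-injective (⊕-cancelˡ u′ _ _ eq))
              (λ {z} z∈ → let g , g′ = proj₂ (∈-filter⁻ both? {xs = W} (∈-dedup⁻ Z z∈)) in
                good⇒popular g′ , subst (_∈ popularDifferences) (sym (⊝-⊝ u u′ z)) (good⇒popular g))))
            where
            both? : Decidable (λ z → L ≤ common u z ^ N × L ≤ common u′ z ^ N)
            both? z = good? u z ×-dec good? u′ z
            Z = filter both? W
            typ : ∀ {u} → u ∈ Q → 4 * badAt u ≤ n
            typ u∈ = proj₂ (∈-filter⁻ typical? {xs = W} u∈)
            n≤ : n ≤ length Z + (badAt u + badAt u′)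
            n≤ = begin
              n                                                  ≡⟨ trans (sym (*-identityʳ n)) (sym (∑-const W 1)) ⟩
              ∑ W (λ _ → 1)                                      ≤⟨ ∑-mono W (λ {z} _ → 𝟙-both (good? u z) (good? u′ z)) ⟩
              ∑ W (λ z → 𝟙 (both? z) + (bad u z + bad u′ z))     ≡⟨ trans (∑-+ W _ _) (cong₂ _+_ (sym (length-filter both? W)) (∑-+ W (bad u) (bad u′))) ⟩
              length Z + (badAt u + badAt u′)                    ∎
            n≤2Z : n ≤ 2 * length Z
            n≤2Z = *-cancelˡ-≤ 2 (+-cancelʳ-≤ (2 * n) _ _ (begin
              2 * n + 2 * n                                      ≡⟨ lemma₁ n ⟩
              4 * n                                              ≤⟨ *-monoʳ-≤ 4 n≤ ⟩
              4 * (length Z + (badAt u + badAt u′))              ≡⟨ lemma₂ (length Z) (badAt u) (badAt u′) ⟩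
              2 * (2 * length Z) + (4 * badAt u + 4 * badAt u′)  ≤⟨ +-monoʳ-≤ (2 * (2 * length Z)) (+-mono-≤ (typ u∈) (typ u′∈)) ⟩
              2 * (2 * length Z) + (n + n)                       ≡⟨ cong (2 * (2 * length Z) +_) (cong (n +_) (sym (+-identityʳ n))) ⟩
              2 * (2 * length Z) + 2 * n                         ∎))
              where
              lemma₁ : ∀ n → 2 * n + 2 * n ≡ 4 * n
              lemma₁ = solve-∀
              lemma₂ : ∀ z a b → 4 * (z + (a + b)) ≡ 2 * (2 * z) + (4 * a + 4 * b)
              lemma₂ = solve-∀
            Z-dense : L ≤ length Z ^ N
            Z-dense = *-cancelˡ-≤ ((4 * v) ^ N) {{m^n≢0 (4 * v) N {{m*n≢0 4 v}}}} (begin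
              (4 * v) ^ N * L              ≤⟨ dense₂ ⟩
              edges ^ N                    ≤⟨ ^-monoˡ-≤ N (≤-trans (rich) (*-monoʳ-≤ (2 * v) n≤2Z)) ⟩
              (2 * v * (2 * length Z)) ^ N ≡⟨ trans (cong (_^ N) (lemma v (length Z))) (^-distrib-* (4 * v) (length Z) N) ⟩
              (4 * v) ^ N * length Z ^ N   ∎)
              where
              lemma : ∀ v q → 2 * v * (2 * q) ≡ 4 * v * q
              lemma = solve-∀
            large : suc κ ≤ card Z ^ N
            large = spread (dedup Z) (≤-trans Z-dense (^-monoˡ-≤ N (begin
              length Z                                            ≡⟨ trans (length-filter both? W) (∑-filter (neighbour? w) V _) ⟩
              ∑ V (λ z → 𝟙 (neighbour? w z) * 𝟙 (both? z))        ≤⟨ ∑-mono V (λ {z} z∈ → 𝟙*𝟙-mono (neighbour? w z) (both? z) (z ∈? dedup Z)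
                                                                      (λ nb b → ∈-dedup⁺ (∈-filter⁺ both? (∈-filter⁺ (neighbour? w) z∈ nb) b))) ⟩
              ∑ V (λ z → 𝟙 (z ∈? dedup Z))                        ∎)))
          pop : ∀ {d} → d ∈ Δ → suc κ ≤ reps popularDifferences d ^ N
          pop d∈ with ∈-⊞⁻ Q (map ⊖_ Q) (∈-dedup⁻ (Q ⊞ map ⊖_ Q) d∈)
          ... | u , _ , u∈ , y∈ , refl with ∈-map⁻ ⊖_ y∈
          ...   | u′ , u′∈ , refl = difference-popular u∈ u′∈
          Δ-small : length Δ ^ N * (suc κ * (suc κ * suc κ)) ≤ ((length T * length T) ^ N) * ((length T * length T) ^ N)
          Δ-small = begin
            length Δ ^ N * (suc κ * (suc κ * suc κ))     ≡⟨ sym (*-assoc (length Δ ^ N) (suc κ) (suc κ * suc κ)) ⟩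
            length Δ ^ N * suc κ * (suc κ * suc κ)       ≤⟨ *-monoˡ-≤ (suc κ * suc κ) (popular-few N popularDifferences (deduplicate-! (Q ⊞ map ⊖_ Q)) pop) ⟩
            (D * D) ^ N * (suc κ * suc κ)                ≡⟨ trans (cong (_* (suc κ * suc κ)) (^-distrib-* D D N)) ([m*n]*[o*p]≡[m*o]*[n*p] (D ^ N) (D ^ N) (suc κ) (suc κ)) ⟩
            (D ^ N * suc κ) * (D ^ N * suc κ)            ≤⟨ *-mono-≤ popularDifferences-few popularDifferences-few ⟩
            ((length T * length T) ^ N) * ((length T * length T) ^ N) ∎
            where
            D = length popularDifferences

  -- A dense subset with small iterated sumsets.

  module Structure {E : Set} (_≟_ : DecidableEquality E) {_⊕_ : Op₂ E} {0# : E} {⊖_ : Op₁ E}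
    (isAb : IsAbelianGroup _≡_ _⊕_ 0# ⊖_) where

    open Sumsets _≟_ isAb
    open BSG _≟_ isAb

    hits : ℕ → List E → List E → ℕ
    hits ℓ A T = ∑ (sums ℓ A) (λ s → 𝟙 (s ∈? T))

    ∑-sums-+ : ∀ a b A (f : E → ℕ) →
      ∑ (sums (a + b) A) f ≡ ∑ (sums a A) (λ u → ∑ (sums b A) (λ w → f (u ⊕ w)))
    ∑-sums-+ zero    b A f = trans (∑-cong (sums b A) (λ w → cong f (sym (identityˡ w)))) (sym (+-identityʳ _))
    ∑-sums-+ (suc a) b A f = begin
      ∑ (A ⊞ sums (a + b) A) f
        ≡⟨ ∑-⊞ A (sums (a + b) A) f ⟩
      ∑ A (λ x → ∑ (sums (a + b) A) (λ s → f (x ⊕ s)))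
        ≡⟨ ∑-cong A (λ x → trans (∑-sums-+ a b A _)
             (∑-cong (sums a A) (λ u → ∑-cong (sums b A) (λ w → cong f (sym (assoc x u w)))))) ⟩
      ∑ A (λ x → ∑ (sums a A) (λ u → ∑ (sums b A) (λ w → f ((x ⊕ u) ⊕ w))))
        ≡⟨ sym (∑-⊞ A (sums a A) _) ⟩
      ∑ (A ⊞ sums a A) (λ u → ∑ (sums b A) (λ w → f (u ⊕ w))) ∎
      where open ≡-Reasoning

    module _ (N : ℕ) .{{_ : NonZero N}} (A : List E) (A-unique : Unique A) (m : ℕ) (T : List E) (κ L : ℕ)
      (spread : ∀ T′ → L ≤ hits (suc m) A T′ ^ N → κ < length T′ ^ N)
      {a₀ : E} (a₀∈ : a₀ ∈ A)
      (dense₁ : 64 ^ N * ((length A ^ suc m) ^ N * ((length A ^ suc m) ^ N * ((length A ^ suc m) ^ N * L))) <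
                (hits (suc m + suc m) A T * hits (suc m + suc m) A T) ^ N)
      (dense₂ : (4 * length A ^ suc m) ^ N * L ≤ hits (suc m + suc m) A T ^ N) where

      private
        v = length A ^ suc m
        e = hits (suc m + suc m) A T
        V = sums (suc m) A

        length-V : length V ≡ v
        length-V = length-sums (suc m) A

        edges≡ : edges N V T κ L spread ≡ e
        edges≡ = begin
          ∑ V (λ w → length (filter (λ u → (u ⊕ w) ∈? T) V))
            ≡⟨ ∑-cong V (λ w → length-filter (λ u → (u ⊕ w) ∈? T) V) ⟩
          ∑ V (λ w → ∑ V (λ u → 𝟙 ((u ⊕ w) ∈? T)))
            ≡⟨ ∑-comm V V _ ⟩
          ∑ V (λ u → ∑ V (λ w → 𝟙 ((u ⊕ w) ∈? T)))
            ≡⟨ sym (∑-sums-+ (suc m) (suc m) A (λ s → 𝟙 (s ∈? T))) ⟩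
          e ∎
          where open ≡-Reasoning

        V-nonempty : ∃ λ x → x ∈ V
        V-nonempty = nonempty⇒∃ V (subst (1 ≤_) (sym length-V) (m^n>0 (length A) {{>-nonZero (∈-length a₀∈)}} (suc m)))

      Subset : Set
      Subset = ∃ λ A′ → Unique A′ × (∀ {x} → x ∈ A′ → x ∈ A) ×
        e ≤ 4 * v * (length A ^ m * length A′) ×
        (∀ j → card (sums j A′) ^ N * suc κ ^ (4 * j) ≤ length T ^ N * (length T ^ N) ^ (4 * j))

      private
        instance
          α≢0 : NonZero (length A)
          α≢0 = >-nonZero (∈-length a₀∈)
          v≢0 : NonZero (4 * v)
          v≢0 = m*n≢0 4 v {{_}} {{m^n≢0 (length A) (suc m)}}

        sums-nonempty : ∃ λ x → x ∈ sums m A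
        sums-nonempty = nonempty⇒∃ (sums m A) (subst (1 ≤_) (sym (length-sums m A)) (m^n>0 (length A) m))

        -- Freezing the last m summands at `u₀`, where the fibre is at least average, gives A′ with
        -- A′ + u₀ inside `Q`; so A′ - Q is a translate of a part of Q - Q. Petridis' inequality is
        -- applied to P = -Q, whose size exceeds κ^(1/N) by `spread` and is at most |T| because Q +
        -- w lies in `T`.
        build : ∀ Q w Δ u₀ → edges N V T κ L spread ≤ 4 * length V * hits (suc m) A Q →
          (∀ {u} → u ∈ Q → u ⊕ w ∈ T) → (∀ {u u′} → u ∈ Q → u′ ∈ Q → u ⊝ u′ ∈ Δ) →
          length Δ ^ N * (suc κ * (suc κ * suc κ)) ≤ ((length T * length T) ^ N) * ((length T * length T) ^ N) →
          ∑ (sums m A) (λ u → ∑ A (λ x → 𝟙 ((x ⊕ u) ∈? Q))) ≤ length (sums m A) * ∑ A (λ x → 𝟙 ((x ⊕ u₀) ∈? Q)) →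
          Subset
        build Q w Δ u₀ Q-large Q+w differences Δ-small fibre =
          A′ , Unique.filter⁺ in? A-unique , (λ x∈ → proj₁ (∈-filter⁻ in? {xs = A} x∈)) , large , small
          where
          open ≤-Reasoning
          in? : Decidable (λ x → (x ⊕ u₀) ∈ Q)
          in? x = (x ⊕ u₀) ∈? Q
          A′ = filter in? A
          hits-Q : e ≤ 4 * v * hits (suc m) A Q
          hits-Q = subst₂ (λ v e → e ≤ 4 * v * hits (suc m) A Q) length-V edges≡ Q-large
          large : e ≤ 4 * v * (length A ^ m * length A′)
          large = begin
            e                                                                  ≤⟨ hits-Q ⟩
            4 * v * hits (suc m) A Q                                           ≡⟨ cong (4 * v *_) (trans (∑-⊞ A (sums m A) _) (∑-comm A (sums m A) _)) ⟩
            4 * v * ∑ (sums m A) (λ u → ∑ A (λ x → 𝟙 ((x ⊕ u) ∈? Q)))          ≤⟨ *-monoʳ-≤ (4 * v) fibre ⟩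
            4 * v * (length (sums m A) * ∑ A (λ x → 𝟙 ((x ⊕ u₀) ∈? Q)))        ≡⟨ cong₂ (λ a b → 4 * v * (a * b)) (length-sums m A) (sym (length-filter in? A)) ⟩
            4 * v * (length A ^ m * length A′)                                 ∎
          P = dedup (map ⊖_ Q)
          P-large : suc κ ≤ length P ^ N
          P-large = ≤-trans (spread P′ (*-cancelˡ-≤ ((4 * v) ^ N) {{m^n≢0 (4 * v) N}} (begin
              (4 * v) ^ N * L                          ≤⟨ dense₂ ⟩
              e ^ N                                    ≤⟨ ^-monoˡ-≤ N hits-Q ⟩
              (4 * v * hits (suc m) A Q) ^ N           ≡⟨ ^-distrib-* (4 * v) _ N ⟩
              (4 * v) ^ N * hits (suc m) A Q ^ N       ≤⟨ *-monoʳ-≤ ((4 * v) ^ N) (^-monoˡ-≤ N (∑-mono V (λ {x} _ → 𝟙-mono (x ∈? Q) (x ∈? P′) into))) ⟩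
              (4 * v) ^ N * hits (suc m) A P′ ^ N      ∎)))
              (^-monoˡ-≤ N (≤-reflexive (List.length-map ⊖_ P)))
            where
            P′ = map ⊖_ P
            into : ∀ {x} → x ∈ Q → x ∈ P′
            into {x} x∈ = subst (_∈ P′) (⊖-involutive x) (∈-map⁺ ⊖_ (∈-dedup⁺ (∈-map⁺ ⊖_ x∈)))
          P≤T : length P ≤ length T
          P≤T = begin
            length P                          ≡⟨ sym (List.length-map (λ x → (⊖ x) ⊕ w) P) ⟩
            length (map (λ x → (⊖ x) ⊕ w) P)  ≤⟨ unique-⊆⇒length≤ (Unique.map⁺ (λ eq → ⊖-injective (⊕-cancelʳ w _ _ eq)) (deduplicate-! (map ⊖_ Q))) sub ⟩
            length T                          ∎
            where
            sub : ∀ {z} → z ∈ map (λ x → (⊖ x) ⊕ w) P → z ∈ T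
            sub z∈ with ∈-map⁻ (λ x → (⊖ x) ⊕ w) z∈
            ... | x , x∈ , refl with ∈-map⁻ ⊖_ (∈-dedup⁻ (map ⊖_ Q) x∈)
            ...   | q , q∈ , refl = subst (λ y → y ⊕ w ∈ T) (sym (⊖-involutive q)) (Q+w q∈)
          expansion≤ : expansion A′ P ≤ length Δ
          expansion≤ = begin
            card (P ⊞ A′)                            ≡⟨ sym (List.length-map (_⊕ u₀) (dedup (P ⊞ A′))) ⟩
            length (map (_⊕ u₀) (dedup (P ⊞ A′)))    ≤⟨ unique-⊆⇒length≤ (Unique.map⁺ (⊕-cancelʳ u₀ _ _) (deduplicate-! (P ⊞ A′))) sub ⟩
            length Δ                                 ∎
            where
            sub : ∀ {z} → z ∈ map (_⊕ u₀) (dedup (P ⊞ A′)) → z ∈ Δ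
            sub z∈ with ∈-map⁻ (_⊕ u₀) z∈
            ... | y , y∈ , refl with ∈-⊞⁻ P A′ (∈-dedup⁻ (P ⊞ A′) y∈)
            ...   | x , a , x∈ , a∈ , refl with ∈-map⁻ ⊖_ (∈-dedup⁻ (map ⊖_ Q) x∈)
            ...     | q , q∈ , refl = subst (_∈ Δ) (trans (comm (a ⊕ u₀) (⊖ q)) (sym (assoc (⊖ q) a u₀)))
                        (differences (proj₂ (∈-filter⁻ in? {xs = A} a∈)) q∈)
          small : ∀ j → card (sums j A′) ^ N * suc κ ^ (4 * j) ≤ length T ^ N * (length T ^ N) ^ (4 * j)
          small j = begin
            c ^ N * suc κ ^ (4 * j)
              ≡⟨ cong (c ^ N *_) (trans (sym (^-*-assoc (suc κ) 4 j)) (trans (cong (_^ j) (lemma₁ (suc κ))) (^-distrib-* (suc κ) _ j))) ⟩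
            c ^ N * (suc κ ^ j * (suc κ * (suc κ * suc κ)) ^ j)
              ≤⟨ *-monoʳ-≤ (c ^ N) (*-monoˡ-≤ _ (^-monoˡ-≤ j P-large)) ⟩
            c ^ N * ((length P ^ N) ^ j * (suc κ * (suc κ * suc κ)) ^ j)
              ≡⟨ sym (*-assoc (c ^ N) _ _) ⟩
            c ^ N * (length P ^ N) ^ j * (suc κ * (suc κ * suc κ)) ^ j
              ≤⟨ *-monoˡ-≤ _ power ⟩
            (length Δ ^ N) ^ j * length T ^ N * (suc κ * (suc κ * suc κ)) ^ j
              ≡⟨ lemma₂ ((length Δ ^ N) ^ j) (length T ^ N) _ ⟩
            length T ^ N * ((length Δ ^ N) ^ j * (suc κ * (suc κ * suc κ)) ^ j)
              ≡⟨ cong (length T ^ N *_) (sym (^-distrib-* (length Δ ^ N) _ j)) ⟩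
            length T ^ N * (length Δ ^ N * (suc κ * (suc κ * suc κ))) ^ j
              ≤⟨ *-monoʳ-≤ (length T ^ N) (^-monoˡ-≤ j Δ-small) ⟩
            length T ^ N * ((length T * length T) ^ N * (length T * length T) ^ N) ^ j
              ≡⟨ cong (λ k → length T ^ N * (k * k) ^ j) (^-distrib-* (length T) (length T) N) ⟩
            length T ^ N * ((length T ^ N * length T ^ N) * (length T ^ N * length T ^ N)) ^ j
              ≡⟨ cong (λ k → length T ^ N * k ^ j) (lemma₃ (length T ^ N)) ⟩
            length T ^ N * ((length T ^ N) ^ 4) ^ j
              ≡⟨ cong (length T ^ N *_) (^-*-assoc (length T ^ N) 4 j) ⟩
            length T ^ N * (length T ^ N) ^ (4 * j) ∎
            where
            c = card (sums j A′)
            lemma₁ : ∀ k → k ^ 4 ≡ k * (k * (k * k))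
            lemma₁ k = cong (λ z → k * (k * (k * z))) (*-identityʳ k)
            lemma₂ : ∀ a b c → a * b * c ≡ b * (a * c)
            lemma₂ = solve-∀
            lemma₃ : ∀ t → (t * t) * (t * t) ≡ t ^ 4
            lemma₃ t = trans (*-assoc t t (t * t)) (sym (lemma₁ t))
            swap^ : ∀ x → (x ^ N) ^ j ≡ (x ^ j) ^ N
            swap^ x = trans (^-*-assoc x N j) (trans (cong (x ^_) (*-comm N j)) (sym (^-*-assoc x j N)))
            P-nonempty : ∃ λ x → x ∈ P
            P-nonempty = nonempty⇒∃ P (1≤^⇒1≤ N (≤-trans (s≤s z≤n) P-large))
            power : c ^ N * (length P ^ N) ^ j ≤ (length Δ ^ N) ^ j * length T ^ N
            power = begin
              c ^ N * (length P ^ N) ^ j          ≡⟨ trans (cong (c ^ N *_) (swap^ (length P))) (sym (^-distrib-* c _ N)) ⟩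
              (c * length P ^ j) ^ N              ≤⟨ ^-monoˡ-≤ N (iteratedSumset A′ P (proj₂ P-nonempty) (deduplicate-! (map ⊖_ Q)) j) ⟩
              (expansion A′ P ^ j * length P) ^ N ≤⟨ ^-monoˡ-≤ N (*-mono-≤ (^-monoˡ-≤ j expansion≤) P≤T) ⟩
              (length Δ ^ j * length T) ^ N       ≡⟨ trans (^-distrib-* (length Δ ^ j) (length T) N) (cong (_* length T ^ N) (sym (swap^ (length Δ)))) ⟩
              (length Δ ^ N) ^ j * length T ^ N   ∎

      structuredSubset : Subset
      structuredSubset =
        let Q , Q-large , (w , Q+w) , Δ , differences , Δ-small = structured N V T κ L spread (proj₂ V-nonempty)
               (subst₂ (λ v e → 64 ^ N * (v ^ N * (v ^ N * (v ^ N * L))) < (e * e) ^ N) (sym length-V) (sym edges≡) dense₁)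
               (subst₂ (λ v e → (4 * v) ^ N * L ≤ e ^ N) (sym length-V) (sym edges≡) dense₂)
            u₀ , _ , fibre = ∑-max (sums m A) (λ u → ∑ A (λ x → 𝟙 ((x ⊕ u) ∈? Q))) (proj₂ sums-nonempty)
        in build Q w Δ u₀ Q-large Q+w differences Δ-small fibre

  -- Sums over tuples and over their subsequences.

  module _ {A : Set} where

    tupleSum : ℕ → List A → (List A → ℕ) → ℕ
    tupleSum zero    X f = f []
    tupleSum (suc j) X f = ∑ X (λ x → tupleSum j X (λ t → f (x ∷ t)))

    tupleSum-mono : ∀ j X {f g} → (∀ t → length t ≡ j → (∀ {x} → x ∈ t → x ∈ X) → f t ≤ g t) →
      tupleSum j X f ≤ tupleSum j X g
    tupleSum-mono zero    X le = le [] refl (λ ())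
    tupleSum-mono (suc j) X le = ∑-mono X λ {x} x∈ → tupleSum-mono j X λ t len sub →
      le (x ∷ t) (cong suc len) (λ { (here refl) → x∈ ; (there y∈) → sub y∈ })

    tupleSum-+ : ∀ j X f g → tupleSum j X (λ t → f t + g t) ≡ tupleSum j X f + tupleSum j X g
    tupleSum-+ zero    X f g = refl
    tupleSum-+ (suc j) X f g = trans (∑-cong X (λ x → tupleSum-+ j X _ _)) (∑-+ X _ _)

    tupleSum-* : ∀ j X c f → tupleSum j X (λ t → c * f t) ≡ c * tupleSum j X f
    tupleSum-* zero    X c f = refl
    tupleSum-* (suc j) X c f = trans (∑-cong X (λ x → tupleSum-* j X c _)) (∑-* X c _)

    tupleSum-∑ : ∀ {B : Set} j X (ys : List B) (f : List A → B → ℕ) →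
      tupleSum j X (λ t → ∑ ys (f t)) ≡ ∑ ys (λ y → tupleSum j X (λ t → f t y))
    tupleSum-∑ zero    X ys f = refl
    tupleSum-∑ (suc j) X ys f = trans (∑-cong X (λ x → tupleSum-∑ j X ys _)) (∑-comm X ys _)

    tupleSum-const : ∀ j X c → tupleSum j X (λ _ → c) ≡ length X ^ j * c
    tupleSum-const zero    X c = sym (+-identityʳ c)
    tupleSum-const (suc j) X c = trans (∑-cong X (λ _ → tupleSum-const j X c))
      (trans (∑-const X _) (sym (*-assoc (length X) (length X ^ j) c)))

    ∑-<⇒∃ : ∀ {B : Set} (xs : List B) {f g : B → ℕ} → ∑ xs f < ∑ xs g → ∃ λ x → x ∈ xs × f x < g x
    ∑-<⇒∃ (x ∷ xs) {f} {g} lt with f x <? g x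
    ... | yes fx<gx = x , here refl , fx<gx
    ... | no  fx≮gx = let y , y∈ , fy<gy = ∑-<⇒∃ xs (≰⇒> λ le → <⇒≱ lt (+-mono-≤ (≮⇒≥ fx≮gx) le))
                      in y , there y∈ , fy<gy

    tupleSum-<⇒∃ : ∀ j X {f g} → tupleSum j X f < tupleSum j X g →
      ∃ λ t → length t ≡ j × (∀ {x} → x ∈ t → x ∈ X) × f t < g t
    tupleSum-<⇒∃ zero    X lt = [] , refl , (λ ()) , lt
    tupleSum-<⇒∃ (suc j) X lt =
      let x , x∈ , lt₁ = ∑-<⇒∃ X lt
          t , len , sub , lt₂ = tupleSum-<⇒∃ j X lt₁
      in x ∷ t , cong suc len , (λ { (here refl) → x∈ ; (there y∈) → sub y∈ }) , lt₂

    subsequenceSum : ℕ → List A → (List A → ℕ) → ℕ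
    subsequenceSum zero    v       g = g []
    subsequenceSum (suc j) []      g = 0
    subsequenceSum (suc j) (x ∷ v) g = subsequenceSum j v (λ t → g (x ∷ t)) + subsequenceSum (suc j) v g

    -- The union bound for a uniformly random b-tuple, with denominators cleared: it has at most b^j
    -- subsequences of length j, each a uniformly random j-tuple.
    tupleSum-subsequence : ∀ b j X g →
      length X ^ j * tupleSum b X (λ v → subsequenceSum j v g) ≤ b ^ j * length X ^ b * tupleSum j X g
    tupleSum-subsequence b       zero    X g = ≤-reflexive (trans (cong (1 *_) (tupleSum-const b X (g []))) (sym (*-assoc 1 (length X ^ b) (g []))))
    tupleSum-subsequence zero    (suc j) X g = ≤-trans (≤-reflexive (*-zeroʳ (length X ^ suc j))) z≤n
    tupleSum-subsequence (suc b) (suc j) X g = begin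
      α ^ suc j * ∑ X (λ x → tupleSum b X (λ v → subsequenceSum j v (λ t → g (x ∷ t)) + subsequenceSum (suc j) v g))
        ≡⟨ cong (α ^ suc j *_) (trans (∑-cong X (λ x → tupleSum-+ b X _ _)) (trans (∑-+ X _ _) (cong (S₁ +_) (∑-const X S₂)))) ⟩
      α ^ suc j * (S₁ + α * S₂)
        ≡⟨ lemma₁ α (α ^ j) S₁ S₂ ⟩
      α * (α ^ j * S₁) + α * (α ^ suc j * S₂)
        ≤⟨ +-mono-≤ (*-monoʳ-≤ α first) (*-monoʳ-≤ α (tupleSum-subsequence b (suc j) X g)) ⟩
      α * (b ^ j * α ^ b * G) + α * (b ^ suc j * α ^ b * G)
        ≡⟨ lemma₂ α (b ^ j) b (α ^ b) G ⟩
      suc b * b ^ j * α ^ suc b * G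
        ≤⟨ *-monoˡ-≤ G (*-monoˡ-≤ (α ^ suc b) (*-monoʳ-≤ (suc b) (^-monoˡ-≤ j (n≤1+n b)))) ⟩
      suc b ^ suc j * α ^ suc b * G ∎
      where
      open ≤-Reasoning
      α = length X
      G = tupleSum (suc j) X g
      S₁ = ∑ X (λ x → tupleSum b X (λ v → subsequenceSum j v (λ t → g (x ∷ t))))
      S₂ = tupleSum b X (λ v → subsequenceSum (suc j) v g)
      first : α ^ j * S₁ ≤ b ^ j * α ^ b * G
      first = begin
        α ^ j * S₁
          ≡⟨ sym (∑-* X (α ^ j) _) ⟩
        ∑ X (λ x → α ^ j * tupleSum b X (λ v → subsequenceSum j v (λ t → g (x ∷ t))))
          ≤⟨ ∑-mono X (λ {x} _ → tupleSum-subsequence b j X (λ t → g (x ∷ t))) ⟩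
        ∑ X (λ x → b ^ j * α ^ b * tupleSum j X (λ t → g (x ∷ t)))
          ≡⟨ ∑-* X (b ^ j * α ^ b) _ ⟩
        b ^ j * α ^ b * G ∎
      lemma₁ : ∀ a aj s t → a * aj * (s + a * t) ≡ a * (aj * s) + a * (a * aj * t)
      lemma₁ = solve-∀
      lemma₂ : ∀ a bj b ab g → a * (bj * ab * g) + a * (b * bj * ab * g) ≡ suc b * bj * (a * ab) * g
      lemma₂ = solve-∀

    subsequence-filter : ∀ {R : A → Set} (R? : Decidable R) j v g → subsequenceSum j v g ≡ 0 →
      length (filter R? v) ≡ j → g (filter R? v) ≡ 0
    subsequence-filter R? zero    []      g s len = s
    subsequence-filter R? zero    (x ∷ v) g s len with does (R? x)
    ... | false = subsequence-filter R? zero v g s len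
    subsequence-filter R? (suc j) (x ∷ v) g s len with does (R? x)
    ... | true  = subsequence-filter R? j v (λ t → g (x ∷ t)) (m+n≡0⇒m≡0 _ s) (suc-injective len)
    ... | false = subsequence-filter R? (suc j) v g (m+n≡0⇒n≡0 (subsequenceSum j v (λ t → g (x ∷ t))) s) len

  -- Robust sums and their representations.

  module Robustness {E : Set} (_≟_ : DecidableEquality E) {_⊕_ : Op₂ E} {0# : E} {⊖_ : Op₁ E}
    (isAb : IsAbelianGroup _≡_ _⊕_ 0# ⊖_) (p : ℕ) .{{_ : NonZero p}} (X : List E) (X-unique : Unique X) where

    open Sumsets _≟_ isAb
    open BSG _≟_ isAb
    open Structure _≟_ isAb
    open ListSums isAb public

    represents? : ∀ s → Decidable (λ t → Unique t × esum t ≡ s)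
    represents? s t = unique? _≟_ t ×-dec (esum t ≟ s)

    represents-with? : ∀ w s → Decidable (λ t → (Unique t × esum t ≡ s) × w ∈ t)
    represents-with? w s t = represents? s t ×-dec (w ∈? t)

    tuplesTo : ℕ → E → ℕ
    tuplesTo j s = tupleSum j X (λ t → 𝟙 (represents? s t))

    tuplesThrough : ℕ → E → E → ℕ
    tuplesThrough j w s = tupleSum j X (λ t → 𝟙 (represents-with? w s t))

    -- Ensures that any p elements together meet at most half of the representations of s.
    Robust : ℕ → E → Set
    Robust j s = 1 ≤ tuplesTo j s × All (λ w → 2 * p * tuplesThrough j w s ≤ tuplesTo j s) X

    robust? : ∀ j s → Dec (Robust j s)
    robust? j s = (1 ≤? tuplesTo j s) ×-dec All.all? (λ w → 2 * p * tuplesThrough j w s ≤? tuplesTo j s) X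

    avoiding : ∀ {j s} → Robust j s → ∀ W → length W ≤ p →
      ∃ λ t → length t ≡ j × (∀ {x} → x ∈ t → x ∈ X) × Unique t × esum t ≡ s × (∀ {w} → w ∈ W → w ∉ t)
    avoiding {j} {s} (1≤r , light) W W≤p =
      let t , len , sub , lt = found ; u , eq , avoids = conclude t lt in t , len , sub , u , eq , avoids
      where
      open ≤-Reasoning
      r = tuplesTo j s
      light′ : ∀ w → 2 * p * tuplesThrough j w s ≤ r
      light′ w with w ∈? X
      ... | yes w∈ = All.lookup light w∈
      ... | no  w∉ = ≤-trans (≤-reflexive (trans (cong (2 * p *_) (n≤0⇒n≡0 (≤-trans
              (tupleSum-mono j X (λ t _ sub → ≤-reflexive (𝟙-no (represents-with? w s t) (λ c → w∉ (sub (proj₂ c))))))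
              (≤-reflexive (trans (tupleSum-const j X 0) (*-zeroʳ (length X ^ j))))))) (*-zeroʳ (2 * p)))) z≤n
      few : ∑ W (λ w → tuplesThrough j w s) < r
      few = *-cancelˡ-< (2 * p) _ _ (begin-strict
        2 * p * ∑ W (λ w → tuplesThrough j w s)     ≡⟨ sym (∑-* W (2 * p) _) ⟩
        ∑ W (λ w → 2 * p * tuplesThrough j w s)     ≤⟨ ∑-mono W (λ {w} _ → light′ w) ⟩
        ∑ W (λ _ → r)                               ≡⟨ ∑-const W r ⟩
        length W * r                                ≤⟨ *-monoˡ-≤ r W≤p ⟩
        p * r                                       <⟨ m<m+n (p * r) (*-mono-≤ (>-nonZero⁻¹ p) 1≤r) ⟩
        p * r + p * r                               ≡⟨ lemma p r ⟩
        2 * p * r                                   ∎)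
        where
        lemma : ∀ p r → p * r + p * r ≡ 2 * p * r
        lemma = solve-∀
      found = tupleSum-<⇒∃ j X {λ t → ∑ W (λ w → 𝟙 (represents-with? w s t))} {λ t → 𝟙 (represents? s t)}
                (subst (_< r) (sym (tupleSum-∑ j X W _)) few)
      conclude : ∀ t → ∑ W (λ w → 𝟙 (represents-with? w s t)) < 𝟙 (represents? s t) →
        Unique t × esum t ≡ s × (∀ {w} → w ∈ W → w ∉ t)
      conclude t lt = proj₁ rep , proj₂ rep , λ {w} w∈ w∈t → <⇒≱ lt (≤-trans (𝟙≤1 (represents? s t)) (≤-trans
          (≤-reflexive (sym (𝟙-yes (represents-with? w s t) (rep , w∈t)))) (∑-∈ (λ w → 𝟙 (represents-with? w s t)) w∈)))
        where
        rep : Unique t × esum t ≡ s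
        rep = 𝟙-positive (represents? s t) (≤-<-trans z≤n lt)

    tupleSum-esum : ∀ j (g : E → ℕ) → tupleSum j X (λ t → g (esum t)) ≡ ∑ (sums j X) g
    tupleSum-esum zero    g = sym (+-identityʳ (g 0#))
    tupleSum-esum (suc j) g = trans (∑-cong X (λ x → tupleSum-esum j (λ s → g (x ⊕ s)))) (sym (∑-⊞ X (sums j X) g))

    ∑-𝟙≡ : ∀ {S} z → Unique S → ∑ S (λ s → 𝟙 (z ≟ s)) ≤ 1
    ∑-𝟙≡ {S} z u = begin
      ∑ S (λ s → 𝟙 (z ≟ s))          ≡⟨ sym (length-filter (z ≟_) S) ⟩
      length (filter (z ≟_) S)       ≤⟨ unique-⊆⇒length≤ {ys = z ∷ []} (Unique.filter⁺ (z ≟_) u) (λ x∈ → here (sym (proj₂ (∈-filter⁻ (z ≟_) {xs = S} x∈)))) ⟩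
      length (z ∷ [])                ∎
      where open ≤-Reasoning

    -- A union bound over the `suc j` places where w may stand: the first place, or a place in the
    -- tail by recursion.
    tupleSum-through : ∀ j w (g : E → ℕ) →
      tupleSum (suc j) X (λ t → 𝟙 (w ∈? t) * g (esum t)) ≤ suc j * ∑ (sums j X) (λ u → g (w ⊕ u))
    tupleSum-through j w g = begin
      ∑ X (λ x → tupleSum j X (λ t → 𝟙 (w ∈? (x ∷ t)) * g (x ⊕ esum t)))
        ≤⟨ ∑-mono X (λ {x} _ → tupleSum-mono j X (λ t _ _ → split x t)) ⟩
      ∑ X (λ x → tupleSum j X (λ t → 𝟙 (w ≟ x) * g (w ⊕ esum t) + 𝟙 (w ∈? t) * g (x ⊕ esum t)))
        ≡⟨ trans (∑-cong X (λ x → trans (tupleSum-+ j X _ _) (cong (_+ R x) (trans (tupleSum-* j X (𝟙 (w ≟ x)) _)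
             (cong (𝟙 (w ≟ x) *_) (tupleSum-esum j (λ u → g (w ⊕ u)))))))) (∑-+ X _ R) ⟩
      ∑ X (λ x → 𝟙 (w ≟ x) * G) + ∑ X R
        ≤⟨ +-mono-≤ here-part (there-part j) ⟩
      G + j * G ∎
      where
      open ≤-Reasoning
      G = ∑ (sums j X) (λ u → g (w ⊕ u))
      R : E → ℕ
      R x = tupleSum j X (λ t → 𝟙 (w ∈? t) * g (x ⊕ esum t))
      split : ∀ x t → 𝟙 (w ∈? (x ∷ t)) * g (x ⊕ esum t) ≤ 𝟙 (w ≟ x) * g (w ⊕ esum t) + 𝟙 (w ∈? t) * g (x ⊕ esum t)
      split x t = split′ (w ∈? (x ∷ t)) (w ≟ x) (w ∈? t)
        where
        split′ : ∀ (a : Dec (w ∈ x ∷ t)) (b : Dec (w ≡ x)) (c : Dec (w ∈ t)) →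
          𝟙 a * g (x ⊕ esum t) ≤ 𝟙 b * g (w ⊕ esum t) + 𝟙 c * g (x ⊕ esum t)
        split′ (no _)   b          c        = z≤n
        split′ (yes _)  (yes refl) c        = m≤m+n _ _
        split′ (yes w∈) (no w≢x)   (yes _)  = ≤-refl
        split′ (yes (here e))   (no w≢x) (no w∉) = ⊥-elim (w≢x e)
        split′ (yes (there w∈)) (no w≢x) (no w∉) = ⊥-elim (w∉ w∈)
      here-part : ∑ X (λ x → 𝟙 (w ≟ x) * G) ≤ G
      here-part = begin
        ∑ X (λ x → 𝟙 (w ≟ x) * G)   ≡⟨ trans (∑-cong X (λ x → *-comm (𝟙 (w ≟ x)) G)) (∑-* X G _) ⟩
        G * ∑ X (λ x → 𝟙 (w ≟ x))   ≤⟨ *-monoʳ-≤ G (∑-𝟙≡ w X-unique) ⟩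
        G * 1                       ≡⟨ *-identityʳ G ⟩
        G                           ∎
      there-part : ∀ j → ∑ X (λ x → tupleSum j X (λ t → 𝟙 (w ∈? t) * g (x ⊕ esum t))) ≤ j * ∑ (sums j X) (λ u → g (w ⊕ u))
      there-part zero    = ≤-reflexive (∑-zero X)
      there-part (suc j) = begin
        ∑ X (λ x → tupleSum (suc j) X (λ t → 𝟙 (w ∈? t) * g (x ⊕ esum t)))
          ≤⟨ ∑-mono X (λ {x} _ → tupleSum-through j w (λ s → g (x ⊕ s))) ⟩
        ∑ X (λ x → suc j * ∑ (sums j X) (λ u → g (x ⊕ (w ⊕ u))))
          ≡⟨ ∑-* X (suc j) _ ⟩
        suc j * ∑ X (λ x → ∑ (sums j X) (λ u → g (x ⊕ (w ⊕ u))))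
          ≡⟨ cong (suc j *_) (trans (∑-cong X (λ x → ∑-cong (sums j X) (λ u → cong g
               (trans (sym (assoc x w u)) (trans (cong (_⊕ u) (comm x w)) (assoc w x u))))))
               (sym (∑-⊞ X (sums j X) _))) ⟩
        suc j * ∑ (sums (suc j) X) (λ u → g (w ⊕ u)) ∎

    tuplesThrough≤ : ∀ j w s → tuplesThrough (suc j) w s ≤ suc j * ∑ (sums j X) (λ u → 𝟙 ((w ⊕ u) ≟ s))
    tuplesThrough≤ j w s = ≤-trans (tupleSum-mono (suc j) X (λ t _ _ → term (unique? _≟_ t) (esum t ≟ s) (w ∈? t)))
      (tupleSum-through j w (λ z → 𝟙 (z ≟ s)))
      where
      term : ∀ {P Q R : Set} (P? : Dec P) (Q? : Dec Q) (R? : Dec R) → 𝟙 ((P? ×-dec Q?) ×-dec R?) ≤ 𝟙 R? * 𝟙 Q?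
      term (no _)  Q?      R?      = z≤n
      term (yes _) (no _)  R?      = z≤n
      term (yes _) (yes _) (no _)  = z≤n
      term (yes _) (yes _) (yes _) = ≤-refl

  unique-↭ : ∀ {A : Set} {xs ys : List A} → Unique xs → Unique ys →
    (∀ {x} → x ∈ xs → x ∈ ys) → (∀ {x} → x ∈ ys → x ∈ xs) → xs ↭ ys
  unique-↭ u v to from = ∼bag⇒↭ (unique∧set⇒bag u v (mk⇔ to from))

  -- Fragile tuples, and random samples without them.

  module Sampling {E : Set} (_≟_ : DecidableEquality E) {_⊕_ : Op₂ E} {0# : E} {⊖_ : Op₁ E}
    (isAb : IsAbelianGroup _≡_ _⊕_ 0# ⊖_) (p : ℕ) .{{_ : NonZero p}} (X : List E) (X-unique : Unique X) where

    open Sumsets _≟_ isAb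
    open BSG _≟_ isAb
    open Structure _≟_ isAb
    open Robustness _≟_ isAb p X X-unique

    fragile : ℕ → List E → ℕ
    fragile j t = 𝟙 (unique? _≟_ t ×-dec ¬? (robust? j (esum t)))

    esum-∈-sums : ∀ t → (∀ {x} → x ∈ t → x ∈ X) → esum t ∈ sums (length t) X
    esum-∈-sums []      sub = here refl
    esum-∈-sums (x ∷ t) sub = ∈-⊞⁺ (sub (here refl)) (esum-∈-sums t (sub ∘ there))

    module _ (N : ℕ) .{{_ : NonZero N}} (Λ : ℕ) (1≤Λ : 1 ≤ Λ) (i : ℕ) where

      private
        j = suc i
        S = dedup (sums j X)

      multiplicity : E → ℕ
      multiplicity u = ∑ (sums i X) (λ u′ → 𝟙 (u ≟ u′))

      heavy? : Decidable (λ u → Λ ≤ (2 * p * j * multiplicity u) ^ N)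
      heavy? u = Λ ≤? (2 * p * j * multiplicity u) ^ N

      heavySums : List E
      heavySums = filter heavy? (dedup (sums i X))

      rare? : ∀ s → Dec (tuplesTo j s ^ N < Λ)
      rare? s = tuplesTo j s ^ N <? Λ

      rareCount : E → ℕ
      rareCount s = 𝟙 (rare? s) * tuplesTo j s

      heavyCount : E → ℕ
      heavyCount s = 2 * p * j * ∑ X (λ w → ∑ heavySums (λ u → multiplicity u * 𝟙 ((w ⊕ u) ≟ s)))

      -- If s is not robust and not rare, some w lies in more than 1/(2p) of its representations.
      -- Deleting w from them gives many i-tuples with sum s - w, so s - w is a heavy sum. The
      -- second count is indexed by pairs of w and a heavy u.
      fragile≤ : tupleSum j X (fragile j) ≤ ∑ S rareCount + ∑ S heavyCount
      fragile≤ = begin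
        tupleSum j X (fragile j)
          ≤⟨ tupleSum-mono j X term ⟩
        tupleSum j X (λ t → ∑ S (λ s → 𝟙 (¬? (robust? j s)) * 𝟙 (represents? s t)))
          ≡⟨ trans (tupleSum-∑ j X S (λ t s → 𝟙 (¬? (robust? j s)) * 𝟙 (represents? s t)))
               (∑-cong S (λ s → tupleSum-* j X (𝟙 (¬? (robust? j s))) (λ t → 𝟙 (represents? s t)))) ⟩
        ∑ S (λ s → 𝟙 (¬? (robust? j s)) * tuplesTo j s)
          ≤⟨ ∑-mono S (λ {s} _ → classify s (robust? j s) (rare? s)) ⟩
        ∑ S (λ s → rareCount s + heavyCount s)
          ≡⟨ ∑-+ S rareCount heavyCount ⟩
        ∑ S rareCount + ∑ S heavyCount ∎
        where
        open ≤-Reasoning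
        term : ∀ t → length t ≡ j → (∀ {x} → x ∈ t → x ∈ X) →
          fragile j t ≤ ∑ S (λ s → 𝟙 (¬? (robust? j s)) * 𝟙 (represents? s t))
        term t len sub = ≤-trans (≤-reflexive (same (unique? _≟_ t) (¬? (robust? j (esum t)))))
          (∑-∈ (λ s → 𝟙 (¬? (robust? j s)) * 𝟙 (represents? s t))
            (∈-dedup⁺ (subst (λ k → esum t ∈ sums k X) len (esum-∈-sums t sub))))
          where
          same : ∀ {P Q : Set} (P? : Dec P) (Q? : Dec Q) → 𝟙 (P? ×-dec Q?) ≡ 𝟙 Q? * 𝟙 (P? ×-dec (esum t ≟ esum t))
          same P? Q? with esum t ≟ esum t
          ... | no ≢ = ⊥-elim (≢ refl)
          same (yes _) (yes _) | yes _ = refl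
          same (yes _) (no _)  | yes _ = refl
          same (no _)  (yes _) | yes _ = refl
          same (no _)  (no _)  | yes _ = refl
        frequentCase : ∀ s → ¬ Robust j s → ¬ (tuplesTo j s ^ N < Λ) → tuplesTo j s ≤ heavyCount s
        frequentCase s fragile frequent
          with All.all? (λ w → 2 * p * tuplesThrough j w s ≤? tuplesTo j s) X
        ... | yes light = ⊥-elim (fragile (1≤^⇒1≤ N (≤-trans 1≤Λ (≮⇒≥ frequent)) , light))
        ... | no ¬light with find (All.¬All⇒Any¬ (λ w → 2 * p * tuplesThrough j w s ≤? tuplesTo j s) X ¬light)
        ...   | w , w∈ , ¬le = begin
          tuplesTo j s
            ≤⟨ bound ⟩
          2 * p * j * multiplicity u
            ≡⟨ cong (2 * p * j *_) (sym (trans (cong (multiplicity u *_) (𝟙-yes ((w ⊕ u) ≟ s) w⊕u≡s)) (*-identityʳ _))) ⟩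
          2 * p * j * (multiplicity u * 𝟙 ((w ⊕ u) ≟ s))
            ≤⟨ *-monoʳ-≤ (2 * p * j) (≤-trans (∑-∈ (λ u → multiplicity u * 𝟙 ((w ⊕ u) ≟ s)) u∈)
                 (∑-∈ (λ w → ∑ heavySums (λ u → multiplicity u * 𝟙 ((w ⊕ u) ≟ s))) w∈)) ⟩
          heavyCount s ∎
          where
          u = s ⊝ w
          w⊕u≡s : w ⊕ u ≡ s
          w⊕u≡s = trans (comm w u) (⊝-⊕ s w)
          bound : tuplesTo j s ≤ 2 * p * j * multiplicity u
          bound = begin
            tuplesTo j s                                              ≤⟨ ≰⇒≥ ¬le ⟩
            2 * p * tuplesThrough j w s                               ≤⟨ *-monoʳ-≤ (2 * p) (tuplesThrough≤ i w s) ⟩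
            2 * p * (j * ∑ (sums i X) (λ u′ → 𝟙 ((w ⊕ u′) ≟ s)))      ≤⟨ *-monoʳ-≤ (2 * p) (*-monoʳ-≤ j (∑-mono (sums i X) (λ {u′} _ →
                                                                           𝟙-mono ((w ⊕ u′) ≟ s) (u ≟ u′) (λ eq → ⊕-cancelˡ w _ _ (trans w⊕u≡s (sym eq)))))) ⟩
            2 * p * (j * multiplicity u)                              ≡⟨ sym (*-assoc (2 * p) j (multiplicity u)) ⟩
            2 * p * j * multiplicity u                                ∎
          heavy : Λ ≤ (2 * p * j * multiplicity u) ^ N
          heavy = ≤-trans (≮⇒≥ frequent) (^-monoˡ-≤ N bound)
          u∈ : u ∈ heavySums
          u∈ with u ∈? dedup (sums i X)
          ... | yes u∈ = ∈-filter⁺ heavy? u∈ heavy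
          ... | no u∉ = ⊥-elim (n≮0 (≤-trans 1≤Λ (≤-trans heavy (≤-reflexive (trans (cong (_^ N)
                  (trans (cong (2 * p * j *_) none) (*-zeroʳ (2 * p * j)))) (0^n≡0 N))))))
            where
            none : multiplicity u ≡ 0
            none = trans (∑-cong∈ (sums i X) (λ {u′} u′∈ → 𝟙-no (u ≟ u′) (λ { refl → u∉ (∈-dedup⁺ u′∈) }))) (∑-zero (sums i X))
        classify : ∀ s (r : Dec (Robust j s)) (q : Dec (tuplesTo j s ^ N < Λ)) →
          𝟙 (¬? r) * tuplesTo j s ≤ 𝟙 q * tuplesTo j s + heavyCount s
        classify s (yes _) q        = z≤n
        classify s (no _)  (yes _)  = m≤m+n _ _
        classify s (no f)  (no q)   = ≤-trans (≤-reflexive (+-identityʳ _)) (frequentCase s f q)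

      heavy-hits : ∑ heavySums multiplicity ≤ hits i X heavySums
      heavy-hits = begin
        ∑ heavySums (λ u → ∑ (sums i X) (λ u′ → 𝟙 (u ≟ u′)))   ≡⟨ ∑-comm heavySums (sums i X) _ ⟩
        ∑ (sums i X) (λ u′ → ∑ heavySums (λ u → 𝟙 (u ≟ u′)))   ≤⟨ ∑-mono (sums i X) (λ {u′} _ → term u′) ⟩
        ∑ (sums i X) (λ u′ → 𝟙 (u′ ∈? heavySums))              ∎
        where
        open ≤-Reasoning
        term : ∀ u′ → ∑ heavySums (λ u → 𝟙 (u ≟ u′)) ≤ 𝟙 (u′ ∈? heavySums)
        term u′ with u′ ∈? heavySums
        ... | yes _ = ≤-trans (∑-mono heavySums (λ {u} _ → 𝟙-mono (u ≟ u′) (u′ ≟ u) sym))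
                        (∑-𝟙≡ u′ (Unique.filter⁺ heavy? (deduplicate-! (sums i X))))
        ... | no u′∉ = ≤-reflexive (trans (∑-cong∈ heavySums (λ {u} u∈ → 𝟙-no (u ≟ u′) (λ { refl → u′∉ u∈ }))) (∑-zero heavySums))

      rareCount-few : ∑ S rareCount ^ N ≤ card (sums j X) ^ N * Λ
      rareCount-few = ∑^-upper N S rareCount (λ {s} _ → term (rare? s))
        where
        term : ∀ {c} (q : Dec (c ^ N < Λ)) → (𝟙 q * c) ^ N ≤ Λ
        term {c} (yes lt) = ≤-trans (≤-reflexive (cong (_^ N) (+-identityʳ c))) (<⇒≤ lt)
        term     (no _)   = ≤-trans (≤-reflexive (0^n≡0 N)) z≤n

      heavyCount-few : ∑ S heavyCount ≤ 2 * p * j * (length X * hits i X heavySums)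
      heavyCount-few = begin
        ∑ S heavyCount
          ≡⟨ trans (∑-* S (2 * p * j) _) (cong (2 * p * j *_) (∑-comm S X _)) ⟩
        2 * p * j * ∑ X (λ w → ∑ S (λ s → ∑ heavySums (λ u → multiplicity u * 𝟙 ((w ⊕ u) ≟ s))))
          ≤⟨ *-monoʳ-≤ (2 * p * j) (∑-mono X (λ {w} _ → column w)) ⟩
        2 * p * j * ∑ X (λ _ → hits i X heavySums)
          ≡⟨ cong (2 * p * j *_) (∑-const X _) ⟩
        2 * p * j * (length X * hits i X heavySums) ∎
        where
        open ≤-Reasoning
        column : ∀ w → ∑ S (λ s → ∑ heavySums (λ u → multiplicity u * 𝟙 ((w ⊕ u) ≟ s))) ≤ hits i X heavySums
        column w = begin
          ∑ S (λ s → ∑ heavySums (λ u → multiplicity u * 𝟙 ((w ⊕ u) ≟ s)))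
            ≡⟨ trans (∑-comm S heavySums _) (∑-cong heavySums (λ u → ∑-* S (multiplicity u) _)) ⟩
          ∑ heavySums (λ u → multiplicity u * ∑ S (λ s → 𝟙 ((w ⊕ u) ≟ s)))
            ≤⟨ ∑-mono heavySums (λ {u} _ → ≤-trans (*-monoʳ-≤ (multiplicity u) (∑-𝟙≡ (w ⊕ u) (deduplicate-! (sums j X)))) (≤-reflexive (*-identityʳ _))) ⟩
          ∑ heavySums multiplicity
            ≤⟨ heavy-hits ⟩
          hits i X heavySums ∎

      -- Markov's inequality over the |X|^i tuples.
      heavySums-few : length heavySums ^ N * Λ ≤ (2 * p * j * length X ^ i) ^ N
      heavySums-few = begin
        length heavySums ^ N * Λ
          ≤⟨ ∑^-lower N heavySums _ (λ {u} u∈ → proj₂ (∈-filter⁻ heavy? {xs = dedup (sums i X)} u∈)) ⟩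
        ∑ heavySums (λ u → 2 * p * j * multiplicity u) ^ N
          ≡⟨ cong (_^ N) (∑-* heavySums (2 * p * j) multiplicity) ⟩
        (2 * p * j * ∑ heavySums multiplicity) ^ N
          ≤⟨ ^-monoˡ-≤ N (*-monoʳ-≤ (2 * p * j) (≤-trans heavy-hits (≤-trans
               (∑-mono (sums i X) (λ {s} _ → 𝟙≤1 (s ∈? heavySums))) (≤-reflexive
               (trans (∑-const (sums i X) 1) (trans (*-identityʳ _) (length-sums i X))))))) ⟩
        (2 * p * j * length X ^ i) ^ N ∎
        where open ≤-Reasoning

    pairs : List E → ℕ
    pairs (x ∷ y ∷ []) = 𝟙 (x ≟ y)
    pairs _            = 0

    private
      ∑-pairs : tupleSum 2 X pairs ≤ length X * 1
      ∑-pairs = ≤-trans (∑-mono X (λ {x} _ → ∑-𝟙≡ x X-unique)) (≤-reflexive (∑-const X 1))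

      noPairs : ∀ v → subsequenceSum 2 v pairs ≡ 0 → Unique v
      noPairs []      _ = []
      noPairs (x ∷ v) s = All.tabulate fresh ∷ noPairs v (m+n≡0⇒n≡0 (subsequenceSum 1 v (λ t → pairs (x ∷ t))) s)
        where
        single : ∀ v {y} → y ∈ v → 𝟙 (x ≟ y) ≤ subsequenceSum 1 v (λ t → pairs (x ∷ t))
        single (z ∷ v) (here refl) = m≤m+n _ _
        single (z ∷ v) (there y∈)  = ≤-trans (single v y∈) (m≤n+m _ (𝟙 (x ≟ z)))
        fresh : ∀ {y} → y ∈ v → x ≢ y
        fresh {y} y∈ x≡y = n≮0 (≤-trans (≤-reflexive (sym (𝟙-yes (x ≟ y) x≡y))) (≤-trans (single v y∈)
          (≤-reflexive (m+n≡0⇒m≡0 _ s))))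

    RobustOn : List E → ℕ → Set
    RobustOn v j = ∀ t → Unique t → (∀ {x} → x ∈ t → x ∈ v) → length t ≡ j → Robust j (esum t)

    module _ {x₀ : E} (x₀∈ : x₀ ∈ X) where

      private
        α = length X
        instance
          α≢0 : NonZero α
          α≢0 = >-nonZero (∈-length x₀∈)

        share : ∀ b j g → 4 * (b ^ j * tupleSum j X g) ≤ α ^ j →
          4 * tupleSum b X (λ v → subsequenceSum j v g) ≤ α ^ b
        share b j g h = *-cancelˡ-≤ (α ^ j) {{m^n≢0 α j}} (begin
          α ^ j * (4 * tupleSum b X (λ v → subsequenceSum j v g))  ≡⟨ lemma₁ (α ^ j) _ ⟩
          4 * (α ^ j * tupleSum b X (λ v → subsequenceSum j v g))  ≤⟨ *-monoʳ-≤ 4 (tupleSum-subsequence b j X g) ⟩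
          4 * (b ^ j * α ^ b * tupleSum j X g)                     ≡⟨ lemma₂ (b ^ j) (α ^ b) (tupleSum j X g) ⟩
          4 * (b ^ j * tupleSum j X g) * α ^ b                     ≤⟨ *-monoˡ-≤ (α ^ b) h ⟩
          α ^ j * α ^ b                                            ∎)
          where
          open ≤-Reasoning
          lemma₁ : ∀ a s → a * (4 * s) ≡ 4 * (a * s)
          lemma₁ = solve-∀
          lemma₂ : ∀ b a g → 4 * (b * a * g) ≡ 4 * (b * g) * a
          lemma₂ = solve-∀

      -- Over a uniformly random b-tuple, equal pairs, fragile j₁-subsequences and fragile
      -- j₂-subsequences each have expected number at most 1/4, so some tuple has none of them. A
      -- list `t` of distinct elements of v is a subsequence only up to order; robustness passes
      -- through the rearrangement because it depends on the sum alone.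
      robustSample : ∀ b j₁ j₂ → 4 * (b ^ 2 * (α * 1)) ≤ α ^ 2 →
        4 * (b ^ j₁ * tupleSum j₁ X (fragile j₁)) ≤ α ^ j₁ → 4 * (b ^ j₂ * tupleSum j₂ X (fragile j₂)) ≤ α ^ j₂ →
        ∃ λ v → length v ≡ b × Unique v × (∀ {x} → x ∈ v → x ∈ X) × RobustOn v j₁ × RobustOn v j₂
      robustSample b j₁ j₂ h₀ h₁ h₂ =
        let v , len , sub , lt = tupleSum-<⇒∃ b X {Ψ} {λ _ → 1} small
            zero₀ = m+n≡0⇒m≡0 (ψ₀ v) (m+n≡0⇒m≡0 (ψ₀ v + ψ₁ v) (n<1⇒n≡0 lt))
            zero₁ = m+n≡0⇒n≡0 (ψ₀ v) (m+n≡0⇒m≡0 (ψ₀ v + ψ₁ v) (n<1⇒n≡0 lt))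
            zero₂ = m+n≡0⇒n≡0 (ψ₀ v + ψ₁ v) (n<1⇒n≡0 lt)
            u = noPairs v zero₀
        in v , len , u , sub , robustOn v u j₁ zero₁ , robustOn v u j₂ zero₂
        where
        open ≤-Reasoning
        ψ₀ ψ₁ ψ₂ Ψ : List E → ℕ
        ψ₀ v = subsequenceSum 2 v pairs
        ψ₁ v = subsequenceSum j₁ v (fragile j₁)
        ψ₂ v = subsequenceSum j₂ v (fragile j₂)
        Ψ v = ψ₀ v + ψ₁ v + ψ₂ v
        small : tupleSum b X Ψ < tupleSum b X (λ _ → 1)
        small = *-cancelˡ-< 4 _ _ (begin-strict
          4 * tupleSum b X Ψ
            ≡⟨ cong (4 *_) (trans (tupleSum-+ b X _ ψ₂) (cong (_+ tupleSum b X ψ₂) (tupleSum-+ b X ψ₀ ψ₁))) ⟩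
          4 * (tupleSum b X ψ₀ + tupleSum b X ψ₁ + tupleSum b X ψ₂)
            ≡⟨ lemma (tupleSum b X ψ₀) (tupleSum b X ψ₁) (tupleSum b X ψ₂) ⟩
          4 * tupleSum b X ψ₀ + 4 * tupleSum b X ψ₁ + 4 * tupleSum b X ψ₂
            ≤⟨ +-mono-≤ (+-mono-≤ (share b 2 pairs (≤-trans (*-monoʳ-≤ 4 (*-monoʳ-≤ (b ^ 2) ∑-pairs)) h₀)) (share b j₁ _ h₁)) (share b j₂ _ h₂) ⟩
          α ^ b + α ^ b + α ^ b
            <⟨ m<m+n _ (m^n>0 α b) ⟩
          α ^ b + α ^ b + α ^ b + α ^ b
            ≡⟨ lemma′ (α ^ b) ⟩
          4 * (α ^ b * 1)
            ≡⟨ cong (4 *_) (sym (tupleSum-const b X 1)) ⟩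
          4 * tupleSum b X (λ _ → 1) ∎)
          where
          lemma : ∀ a b c → 4 * (a + b + c) ≡ 4 * a + 4 * b + 4 * c
          lemma = solve-∀
          lemma′ : ∀ a → a + a + a + a ≡ 4 * (a * 1)
          lemma′ = solve-∀
        robustOn : ∀ v → Unique v → ∀ j → subsequenceSum j v (fragile j) ≡ 0 → RobustOn v j
        robustOn v u j zeroSum t t-unique t⊆v len = subst (Robust j) (esum-↭ t↭) (robust-t′ (robust? j (esum t′)) refl)
          where
          t′ = filter (_∈? t) v
          t′-unique = Unique.filter⁺ (_∈? t) u
          t↭ : t′ ↭ t
          t↭ = unique-↭ t′-unique t-unique (λ x∈ → proj₂ (∈-filter⁻ (_∈? t) {xs = v} x∈)) (λ x∈ → ∈-filter⁺ (_∈? t) (t⊆v x∈) x∈)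
          none : fragile j t′ ≡ 0
          none = subsequence-filter (_∈? t) j v (fragile j) zeroSum (trans (↭-length t↭) len)
          robust-t′ : ∀ (r : Dec (Robust j (esum t′))) → robust? j (esum t′) ≡ r → Robust j (esum t′)
          robust-t′ (yes r) _ = r
          robust-t′ (no ¬r) _ = ⊥-elim (1+n≢0 (trans (sym (𝟙-yes (unique? _≟_ t′ ×-dec ¬? (robust? j (esum t′))) (t′-unique , ¬r))) none))

  ∑-⊆ : ∀ {A : Set} {xs ys : List A} (f : A → ℕ) → Unique xs → (∀ {x} → x ∈ xs → x ∈ ys) → ∑ xs f ≤ ∑ ys f
  ∑-⊆ {xs = []}     f []       sub = z≤n
  ∑-⊆ {xs = x ∷ xs} f (x∉ ∷ u) sub with ∈-∃++ (sub (here refl))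
  ... | as , bs , refl = begin
    f x + ∑ xs f               ≤⟨ +-monoʳ-≤ (f x) (∑-⊆ f u sub′) ⟩
    f x + ∑ (as ++ bs) f       ≡⟨ cong (f x +_) (∑-++ as bs f) ⟩
    f x + (∑ as f + ∑ bs f)    ≡⟨ lemma (f x) (∑ as f) (∑ bs f) ⟩
    ∑ as f + (f x + ∑ bs f)    ≡⟨ sym (∑-++ as (x ∷ bs) f) ⟩
    ∑ (as ++ x ∷ bs) f         ∎
    where
    open ≤-Reasoning
    lemma : ∀ a b c → a + (b + c) ≡ b + (a + c)
    lemma = solve-∀
    sub′ : ∀ {z} → z ∈ xs → z ∈ as ++ bs
    sub′ z∈ with ∈-++⁻ as (sub (there z∈))
    ... | inj₁ z∈as         = ∈-++⁺ˡ z∈as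
    ... | inj₂ (here refl)  = ⊥-elim (All.lookup x∉ z∈ refl)
    ... | inj₂ (there z∈bs) = ∈-++⁺ʳ as z∈bs

  ∈-take : ∀ {A : Set} k (xs : List A) {x} → x ∈ take k xs → x ∈ xs
  ∈-take (suc k) (x ∷ xs) (here e)  = here e
  ∈-take (suc k) (x ∷ xs) (there i) = there (∈-take k xs i)

  ∈-drop : ∀ {A : Set} k (xs : List A) {x} → x ∈ drop k xs → x ∈ xs
  ∈-drop zero    xs       i = i
  ∈-drop (suc k) (x ∷ xs) i = there (∈-drop k xs i)

  take-drop-disjoint : ∀ {A : Set} k {xs : List A} → Unique xs → ∀ {x} → x ∈ take k xs → x ∉ drop k xs
  take-drop-disjoint (suc k) (x∉ ∷ u) (here refl) x∈ = All.lookup x∉ (∈-drop k _ x∈) refl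
  take-drop-disjoint (suc k) (x∉ ∷ u) (there i)   x∈ = take-drop-disjoint k u i x∈

  -- Replacing groups of elements by disjoint representations of their sums.

  module Realization {E : Set} (_≟_ : DecidableEquality E) {_⊕_ : Op₂ E} {0# : E} {⊖_ : Op₁ E}
    (isAb : IsAbelianGroup _≡_ _⊕_ 0# ⊖_) (p : ℕ) .{{_ : NonZero p}} (X : List E) (X-unique : Unique X)
    (B : List E) (h : ℕ) where

    open Sumsets _≟_ isAb
    open Robustness _≟_ isAb p X X-unique
    open Sampling _≟_ isAb p X X-unique

    -- A half of a tuple of length 2h, possibly enlarged by one left-over element; hence the two
    -- sizes.
    record Group′ (g : List E) : Set where
      field
        unique : Unique g
        subset : ∀ {x} → x ∈ g → x ∈ B
        size   : length g ≡ h ⊎ length g ≡ suc h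

    module _ (robust₁ : RobustOn B h) (robust₂ : RobustOn B (suc h)) where

      -- Greedy choice: fewer than p or exactly p vectors have been used by the other groups, and a
      -- robust sum has a representation avoiding all of them.
      realize : ∀ groups → All Group′ groups → length (concat groups) ≤ p →
        ∃ λ ys → Unique ys × (∀ {x} → x ∈ ys → x ∈ X) × length ys ≡ length (concat groups) ×
                 esum ys ≡ esum (concat groups)
      realize []       []       _  = [] , [] , (λ ()) , refl , refl
      realize (g ∷ gs) (G ∷ Gs) ≤p =
        let ys , ys-unique , ys⊆ , ys-len , ys-sum = realize gs Gs (≤-trans (≤-trans (m≤n+m _ (length g)) (≤-reflexive (sym (List.length-++ g)))) ≤p)
            j , len , robust = robust-group
            t , t-len , t⊆ , t-unique , t-sum , t-avoids = avoiding robust ys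
              (≤-trans (≤-reflexive ys-len) (≤-trans (≤-trans (m≤n+m _ (length g)) (≤-reflexive (sym (List.length-++ g)))) ≤p))
        in t ++ ys , Unique.++⁺ t-unique ys-unique (λ { (x∈t , x∈ys) → t-avoids x∈ys x∈t }) ,
           (λ x∈ → [ t⊆ , ys⊆ ]′ (∈-++⁻ t x∈)) ,
           trans (List.length-++ t) (trans (cong₂ _+_ (trans t-len (sym len)) ys-len) (sym (List.length-++ g))) ,
           trans (esum-++ t ys) (trans (cong₂ _⊕_ t-sum ys-sum) (sym (esum-++ g (concat gs))))
        where
        robust-group : ∃ λ j → length g ≡ j × Robust j (esum g)
        robust-group with Group′.size G
        ... | inj₁ len = _ , len , robust₁ g (Group′.unique G) (Group′.subset G) len
        ... | inj₂ len = _ , len , robust₂ g (Group′.unique G) (Group′.subset G) len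

      -- A left-over element joins a half of its tuple not containing it.
      regroup : ∀ tups left → All (λ t → length t ≡ h + h × Unique t × (∀ {x} → x ∈ t → x ∈ B)) tups →
        (∀ {x} → x ∈ left → x ∈ B) → length left ≤ length tups →
        ∃ λ groups → All Group′ groups × length (concat groups) ≡ length (concat tups ++ left) ×
                     esum (concat groups) ≡ esum (concat tups ++ left)
      regroup []         []         []                    _     _    = [] , [] , refl , refl
      regroup (t ∷ tups) left ((len , u , t⊆) ∷ T) left⊆ few = attach left left⊆ few
        where
        t₁ = take h t
        t₂ = drop h t
        t₁-len : length t₁ ≡ h
        t₁-len = trans (List.length-take h t) (trans (cong (h ⊓_) len) (m≤n⇒m⊓n≡m (m≤m+n h h)))
        t₂-len : length t₂ ≡ h
        t₂-len = trans (List.length-drop h t) (trans (cong (_∸ h) len) (m+n∸n≡m h h))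
        G₁ : Group′ t₁
        G₁ = record { unique = Unique.take⁺ h u ; subset = λ x∈ → t⊆ (∈-take h t x∈) ; size = inj₁ t₁-len }
        G₂ : Group′ t₂
        G₂ = record { unique = Unique.drop⁺ h u ; subset = λ x∈ → t⊆ (∈-drop h t x∈) ; size = inj₁ t₂-len }
        length-t : ∀ ys → length (t₁ ++ t₂ ++ ys) ≡ length t + length ys
        length-t ys = trans (cong length (trans (sym (List.++-assoc t₁ t₂ ys)) (cong (_++ ys) (List.take++drop≡id h t)))) (List.length-++ t)
        esum-t : ∀ ys → esum (t₁ ++ t₂ ++ ys) ≡ esum t ⊕ esum ys
        esum-t ys = trans (cong esum (trans (sym (List.++-assoc t₁ t₂ ys)) (cong (_++ ys) (List.take++drop≡id h t)))) (esum-++ t ys)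
        extend : ∀ {g x} → Group′ g → length g ≡ h → x ∈ B → x ∉ g → Group′ (x ∷ g)
        extend {g} G len x∈ x∉ = record
          { unique = All.¬Any⇒All¬ g x∉ ∷ Group′.unique G
          ; subset = λ { (here refl) → x∈ ; (there y∈) → Group′.subset G y∈ }
          ; size   = inj₂ (cong suc len) }
        cons-length : ∀ x left → length (concat (t ∷ tups) ++ x ∷ left) ≡ suc (length t + length (concat tups ++ left))
        cons-length x left = trans (cong length (List.++-assoc t (concat tups) (x ∷ left))) (trans (List.length-++ t) (trans
          (cong (length t +_) (trans (List.length-++ (concat tups)) (trans (+-suc _ _) (cong suc (sym (List.length-++ (concat tups)))))))
          (+-suc _ _)))
        cons-sum : ∀ x left → esum (concat (t ∷ tups) ++ x ∷ left) ≡ x ⊕ (esum t ⊕ esum (concat tups ++ left))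
        cons-sum x left = trans (cong esum (List.++-assoc t (concat tups) (x ∷ left))) (trans (esum-++ t _) (trans
          (cong (esum t ⊕_) (trans (esum-++ (concat tups) (x ∷ left)) (trans (⊕-left-comm _ x _) (cong (x ⊕_) (sym (esum-++ (concat tups) left))))))
          (⊕-left-comm _ x _)))
        attach : ∀ left → (∀ {x} → x ∈ left → x ∈ B) → length left ≤ length (t ∷ tups) →
          ∃ λ groups → All Group′ groups × length (concat groups) ≡ length (concat (t ∷ tups) ++ left) ×
                       esum (concat groups) ≡ esum (concat (t ∷ tups) ++ left)
        attach [] left⊆ few =
          let gs , Gs , l , s = regroup tups [] T (λ ()) z≤n
          in t₁ ∷ t₂ ∷ gs , G₁ ∷ G₂ ∷ Gs ,
             trans (length-t (concat gs)) (trans (cong (length t +_) l) (sym (whole-length []))) ,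
             trans (esum-t (concat gs)) (trans (cong (esum t ⊕_) s) (sym (whole-sum [])))
          where
          whole-length : ∀ ys → length (concat (t ∷ tups) ++ ys) ≡ length t + length (concat tups ++ ys)
          whole-length ys = trans (cong length (List.++-assoc t (concat tups) ys)) (List.length-++ t)
          whole-sum : ∀ ys → esum (concat (t ∷ tups) ++ ys) ≡ esum t ⊕ esum (concat tups ++ ys)
          whole-sum ys = trans (cong esum (List.++-assoc t (concat tups) ys)) (esum-++ t _)
        attach (x ∷ left) left⊆ (s≤s few) with regroup tups left T (left⊆ ∘ there) few
        ... | gs , Gs , l , s with x ∈? t₁
        ...   | no x∉ = (x ∷ t₁) ∷ t₂ ∷ gs , extend G₁ t₁-len (left⊆ (here refl)) x∉ ∷ G₂ ∷ Gs ,
                  trans (cong suc (trans (length-t (concat gs)) (cong (length t +_) l))) (sym (cons-length x left)) ,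
                  trans (cong (x ⊕_) (trans (esum-t (concat gs)) (cong (esum t ⊕_) s))) (sym (cons-sum x left))
        ...   | yes x∈ = t₁ ∷ (x ∷ t₂) ∷ gs , G₁ ∷ extend G₂ t₂-len (left⊆ (here refl)) (take-drop-disjoint h u x∈) ∷ Gs ,
                  trans (trans (List.length-++ t₁) (trans (+-suc _ _) (cong suc (trans (sym (List.length-++ t₁)) (trans (length-t (concat gs)) (cong (length t +_) l))))))
                    (sym (cons-length x left)) ,
                  trans (trans (esum-++ t₁ _) (trans (⊕-left-comm _ x _) (cong (x ⊕_) (trans (sym (esum-++ t₁ _)) (trans (esum-t (concat gs)) (cong (esum t ⊕_) s))))))
                    (sym (cons-sum x left))

      groupable : (∀ ys → Unique ys → (∀ {x} → x ∈ ys → x ∈ X) → length ys ≡ p → esum ys ≢ 0#) →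
        ∀ tups left → All (λ t → length t ≡ h + h × Unique t × (∀ {x} → x ∈ t → x ∈ B)) tups →
        (∀ {x} → x ∈ left → x ∈ B) → length left ≤ length tups → length (concat tups ++ left) ≡ p →
        esum (concat tups ++ left) ≢ 0#
      groupable noZeroSum tups left T left⊆ few total zero-sum =
        let gs , Gs , l , s = regroup tups left T left⊆ few
            ys , u , ys⊆ , yl , ysum = realize gs Gs (≤-reflexive (trans l total))
        in noZeroSum ys u ys⊆ (trans yl (trans l total)) (trans ysum (trans s zero-sum))

  -- Choice of parameters, and the exclusion of large robust samples.

  ^-cancelˡ-≤ : ∀ N .{{_ : NonZero N}} {x y} → x ^ N ≤ y ^ N → x ≤ y
  ^-cancelˡ-≤ N {x} {y} le with x ≤? y
  ... | yes x≤y = x≤y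
  ... | no  x≰y = ⊥-elim (<⇒≱ (^-monoˡ-< N (≰⇒> x≰y)) le)

  -- This is 64 (H + 1) H² for H = 2h, the τ with q₀ = p / τ in `noRobustSet`. With U₀ = 4H² q₀ it
  -- makes 8 (H + 1)(U₀ + 1) at most p, and it does not involve p.
  slack : ℕ → ℕ
  slack h = 64 * suc (h + h) * ((h + h) * (h + h))

  -- The length demanded by `momentSublist` for d + 1 = 2τn: exponential in n with a base depending
  -- on h only, times p.
  sampleSize : ℕ → ℕ → ℕ → ℕ
  sampleSize p n h = 2 ^ (n + pred (2 * slack h * n)) * p

  module Exponents (α N : ℕ) .{{_ : NonZero α}} .{{_ : NonZero N}} where

    α^+ : ∀ a b → α ^ (a + b) ≡ α ^ a * α ^ b
    α^+ = ^-distribˡ-+-* α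

    α^-mono : ∀ {a b} → a ≤ b → α ^ a ≤ α ^ b
    α^-mono = ^-monoʳ-≤ α

    α^-cancel : ∀ k {x y} → x * α ^ k ≤ y * α ^ k → x ≤ y
    α^-cancel k = *-cancelʳ-≤ _ _ (α ^ k) {{m^n≢0 α k}}

    ^^ : ∀ x j → (x ^ j) ^ N ≡ x ^ (j * N)
    ^^ x j = ^-*-assoc x j N

  module Core (p : ℕ) (isPrime : Prime p) {E : Set} (_≟_ : DecidableEquality E)
    {_⊕_ : Op₂ E} {0# : E} {⊖_ : Op₁ E} (isAb : IsAbelianGroup _≡_ _⊕_ 0# ⊖_)
    (n : ℕ) (φ : Fin n → E → ℤ)
    (φ-+ : ∀ r x y → ℤ.+ p ℤ.∣ φ r (x ⊕ y) ℤ.- (φ r x ℤ.+ φ r y))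
    (φ-0 : ∀ r → ℤ.+ p ℤ.∣ φ r 0#)
    (φ-kernel : ∀ x → (∀ r → ℤ.+ p ℤ.∣ φ r x) → x ≡ 0#)
    (A : List E) (A-unique : Unique A)
    (noZeroSum : ∀ ys → Unique ys → (∀ {x} → x ∈ ys → x ∈ A) → length ys ≡ p → ListSums.esum isAb ys ≢ 0#) where

    instance
      p≢0 : NonZero p
      p≢0 = prime⇒nonZero isPrime

    open Sumsets _≟_ isAb
    open Structure _≟_ isAb
    open ListSums isAb
    open Modular.Moments p isPrime isAb n φ φ-+ φ-0 φ-kernel using (momentSublist)
    open Modular.GoodSolutions p isPrime _≟_ isAb n φ φ-+ φ-0 φ-kernel using (noGood)
    open Modular.Distinct using (Tuple)

    module _ (X : List E) (X-unique : Unique X) (X⊆A : ∀ {x} → x ∈ X → x ∈ A) (i : ℕ) where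

      open Robustness _≟_ isAb p X X-unique using (Robust)
      open Sampling _≟_ isAb p X X-unique

      private
        h = suc i
        H = h + h
        τ = slack h
        q₀ = p / τ

      -- Since q₀ ≥ 1, p is at most 2τq₀, and with d + 1 = 2τn this is the degree condition `low`. A
      -- sublist of B with vanishing moments then meets the hypotheses of `noGood`: a solution of
      -- the excluded shape would, by robustness, become p distinct elements of A with sum zero.
      noRobustSet : 1 ≤ n → τ ≤ p → ∀ B → Unique B → RobustOn B h → RobustOn B (suc h) →
        sampleSize p n h ≤ length B → ⊥
      noRobustSet 1≤n τ≤p B B-unique robust₁ robust₂ big = refute (momentSublist d B big)
        where
        open ≤-Reasoning
        d = pred (2 * τ * n)
        instance
          n≢0 : NonZero n
          n≢0 = >-nonZero 1≤n
          2τn≢0 : NonZero (2 * τ * n)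
          2τn≢0 = m*n≢0 (2 * τ) n
        1≤q₀ : 1 ≤ q₀
        1≤q₀ = m≥n⇒m/n>0 τ≤p
        low : n * pred p < q₀ * suc d
        low = begin-strict
          n * pred p            <⟨ *-monoʳ-< n (≤-reflexive (suc-pred p)) ⟩
          n * p                 ≤⟨ *-monoʳ-≤ n (begin
            p                     ≡⟨ m≡m%n+[m/n]*n p τ ⟩
            p % τ + q₀ * τ  ≤⟨ +-monoˡ-≤ (q₀ * τ) (≤-trans (<⇒≤ (m%n<n p τ)) (≤-trans (≤-reflexive (sym (*-identityˡ τ))) (*-monoˡ-≤ τ 1≤q₀))) ⟩
            q₀ * τ + q₀ * τ       ≡⟨ lemma q₀ τ ⟩
            q₀ * (2 * τ)          ∎) ⟩
          n * (q₀ * (2 * τ))    ≡⟨ lemma′ n q₀ (2 * τ) ⟩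
          q₀ * (2 * τ * n)      ≡⟨ cong (q₀ *_) (sym (suc-pred (2 * τ * n))) ⟩
          q₀ * suc d            ∎
          where
          lemma : ∀ q t → q * t + q * t ≡ q * (2 * t)
          lemma = solve-∀
          lemma′ : ∀ n q t → n * (q * t) ≡ q * (t * n)
          lemma′ = solve-∀
        large : 8 * suc H * suc (q₀ * (4 * (H * H))) ≤ p
        large = begin
          8 * suc H * suc (q₀ * (4 * (H * H)))
            ≡⟨ lemma (suc H) q₀ (H * H) ⟩
          8 * suc H * 1 + 32 * (suc H * (q₀ * (H * H)))
            ≤⟨ +-monoˡ-≤ _ (≤-trans (*-mono-≤ (*-monoˡ-≤ (suc H) (m≤m+n 8 24)) (*-mono-≤ 1≤q₀ (s≤s z≤n))) (≤-reflexive (lemma″ (suc H) q₀ (H * H)))) ⟩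
          32 * (suc H * (q₀ * (H * H))) + 32 * (suc H * (q₀ * (H * H)))
            ≡⟨ lemma′ (suc H) q₀ (H * H) ⟩
          q₀ * τ
            ≤⟨ m/n*n≤m p τ ⟩
          p ∎
          where
          lemma : ∀ s q h → 8 * s * suc (q * (4 * h)) ≡ 8 * s * 1 + 32 * (s * (q * h))
          lemma = solve-∀
          lemma″ : ∀ s q h → 32 * s * (q * h) ≡ 32 * (s * (q * h))
          lemma″ = solve-∀
          lemma′ : ∀ s q h → 32 * (s * (q * h)) + 32 * (s * (q * h)) ≡ q * (64 * s * h)
          lemma′ = solve-∀
        length-concat : ∀ {Y u} → ∀ tups → All (Tuple _≟_ isAb Y u H) tups → length (concat tups) ≡ H * length tups
        length-concat []         []      = sym (*-zeroʳ H)
        length-concat (t ∷ tups) (T ∷ Ts) = trans (List.length-++ t)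
          (trans (cong₂ _+_ (Tuple.len T) (length-concat tups Ts)) (sym (*-suc H (length tups))))
        refute : (∃ λ Y → Y ⊑ B × Y ≢ [] × Modular.Moments.HasMoments p isPrime isAb n φ φ-+ φ-0 φ-kernel d Y) → ⊥
        refute ([]        , _    , Y≢ , _)       = Y≢ refl
        refute (Y@(y ∷ _) , Y⊑B , _  , moments) =
          noGood Y (unique-⊑ Y⊑B B-unique) {d} moments (i + suc i) q₀ (q₀ * (4 * (H * H))) low ≤-refl large
            good (here refl)
          where
          Y⊆B : ∀ {x} → x ∈ Y → x ∈ B
          Y⊆B = ⊑-lookup Y⊑B
          inB : ∀ {t} → Tuple _≟_ isAb Y (unique-⊑ Y⊑B B-unique) H t → length t ≡ h + h × Unique t × (∀ {x} → x ∈ t → x ∈ B)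
          inB t = Tuple.len t , Tuple.unique t , λ x∈ → Y⊆B (Tuple.subset t x∈)
          good : ∀ tups left → All (Tuple _≟_ isAb Y (unique-⊑ Y⊑B B-unique) H) tups → (∀ {y} → y ∈ left → y ∈ Y) →
            H * length tups + length left ≡ p → length left ≤ length tups → esum (concat tups ++ left) ≢ 0#
          good tups left T left⊆ total few =
            Realization.groupable _≟_ isAb p X X-unique B h robust₁ robust₂
              (λ ys u ys⊆ → noZeroSum ys u (λ x∈ → X⊆A (ys⊆ x∈))) tups left
              (All.map inB T) (λ x∈ → Y⊆B (left⊆ x∈)) few
              (trans (List.length-++ (concat tups)) (trans (cong (_+ length left) (length-concat tups T)) total))

  -- Few tuples of a dense subset are fragile.

  module CoreStep (p : ℕ) (isPrime : Prime p) {E : Set} (_≟_ : DecidableEquality E)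
    {_⊕_ : Op₂ E} {0# : E} {⊖_ : Op₁ E} (isAb : IsAbelianGroup _≡_ _⊕_ 0# ⊖_)
    (n : ℕ) (φ : Fin n → E → ℤ)
    (φ-+ : ∀ r x y → ℤ.+ p ℤ.∣ φ r (x ⊕ y) ℤ.- (φ r x ℤ.+ φ r y))
    (φ-0 : ∀ r → ℤ.+ p ℤ.∣ φ r 0#)
    (φ-kernel : ∀ x → (∀ r → ℤ.+ p ℤ.∣ φ r x) → x ≡ 0#)
    (A : List E) (A-unique : Unique A)
    (noZeroSum : ∀ ys → Unique ys → (∀ {x} → x ∈ ys → x ∈ A) → length ys ≡ p → ListSums.esum isAb ys ≢ 0#) where

    open Core p isPrime _≟_ isAb n φ φ-+ φ-0 φ-kernel A A-unique noZeroSum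
    open Sumsets _≟_ isAb
    open Structure _≟_ isAb

    hits-⊆ : ∀ {X} i T → Unique X → (∀ {x} → x ∈ X → x ∈ A) → hits i X T ≤ hits i A T
    hits-⊆ {X} i T u sub = go i (λ s → 𝟙 (s ∈? T))
      where
      go : ∀ i (f : E → ℕ) → ∑ (sums i X) f ≤ ∑ (sums i A) f
      go zero    f = ≤-refl
      go (suc i) f = begin
        ∑ (X ⊞ sums i X) f                                    ≡⟨ ∑-⊞ X (sums i X) f ⟩
        ∑ X (λ x → ∑ (sums i X) (λ s → f (x ⊕ s)))            ≤⟨ ∑-mono X (λ {x} _ → go i (λ s → f (x ⊕ s))) ⟩
        ∑ X (λ x → ∑ (sums i A) (λ s → f (x ⊕ s)))            ≤⟨ ∑-⊆ _ u sub ⟩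
        ∑ A (λ x → ∑ (sums i A) (λ s → f (x ⊕ s)))            ≡⟨ sym (∑-⊞ A (sums i A) f) ⟩
        ∑ (A ⊞ sums i A) f                                    ∎
        where open ≤-Reasoning

    private
      α = length A

    module _ (N : ℕ) .{{_ : NonZero N}} {a₀ : E} (a₀∈ : a₀ ∈ A) where

      private
        instance
          α≢0 : NonZero α
          α≢0 = >-nonZero (∈-length a₀∈)

      open Exponents α N

      -- k and δ are exponents of α in units of 1/N.
      Spread : ℕ → ℕ → ℕ → Set
      Spread i k δ = ∀ T → length T ^ N ≤ α ^ k → hits i A T ^ N * α ^ δ < α ^ (i * N)

      -- Fix the first summand where the count is largest and translate `T` by it; the translate has
      -- the same size.
      spread-suc : ∀ {i k δ} → Spread i k δ → Spread (suc i) k δ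
      spread-suc {i} {k} {δ} spread T T-small = begin-strict
        hits (suc i) A T ^ N * α ^ δ
          ≤⟨ *-monoˡ-≤ (α ^ δ) (^-monoˡ-≤ N step) ⟩
        (α * hits i A T′) ^ N * α ^ δ
          ≡⟨ trans (cong (_* α ^ δ) (^-distrib-* α (hits i A T′) N)) (*-assoc (α ^ N) _ (α ^ δ)) ⟩
        α ^ N * (hits i A T′ ^ N * α ^ δ)
          <⟨ *-monoʳ-< (α ^ N) {{m^n≢0 α N}} (spread T′ (subst (λ l → l ^ N ≤ α ^ k) (sym (List.length-map ((⊖ x₀) ⊕_) T)) T-small)) ⟩
        α ^ N * α ^ (i * N)
          ≡⟨ sym (α^+ N (i * N)) ⟩
        α ^ (suc i * N) ∎
        where
        open ≤-Reasoning
        best = ∑-max A (λ x → ∑ (sums i A) (λ s → 𝟙 ((x ⊕ s) ∈? T))) a₀∈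
        x₀ = proj₁ best
        T′ = map ((⊖ x₀) ⊕_) T
        step : hits (suc i) A T ≤ α * hits i A T′
        step = begin
          ∑ (A ⊞ sums i A) (λ s → 𝟙 (s ∈? T))                     ≡⟨ ∑-⊞ A (sums i A) _ ⟩
          ∑ A (λ x → ∑ (sums i A) (λ s → 𝟙 ((x ⊕ s) ∈? T)))       ≤⟨ proj₂ (proj₂ best) ⟩
          α * ∑ (sums i A) (λ s → 𝟙 ((x₀ ⊕ s) ∈? T))              ≤⟨ *-monoʳ-≤ α (∑-mono (sums i A) (λ {s} _ →
            𝟙-mono ((x₀ ⊕ s) ∈? T) (s ∈? T′) (λ m → subst (_∈ T′) (cancel s) (∈-map⁺ ((⊖ x₀) ⊕_) m)))) ⟩
          α * hits i A T′                                         ∎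
          where
          cancel : ∀ s → (⊖ x₀) ⊕ (x₀ ⊕ s) ≡ s
          cancel s = trans (sym (assoc (⊖ x₀) x₀ s)) (trans (cong (_⊕ s) (inverseˡ x₀)) (identityˡ s))

      -- Otherwise the list of all sums of i-tuples would be admissible as `T`, and every tuple hits
      -- it.
      spread-bound : ∀ {i k δ} → Spread i k δ → k < i * N
      spread-bound {i} {k} {δ} spread with k <? i * N
      ... | yes k< = k<
      ... | no  k≮ = ⊥-elim (<⇒≱ (spread (sums i A) (subst (λ l → l ^ N ≤ α ^ k) (sym (length-sums i A))
                       (≤-trans (≤-reflexive (^^ α i)) (α^-mono (≮⇒≥ k≮)))))
                     (≤-trans (≤-reflexive (trans (sym (^^ α i)) (cong (_^ N) (sym everything)))) (m≤m*n _ (α ^ δ) {{m^n≢0 α δ}})))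
        where
        everything : hits i A (sums i A) ≡ α ^ i
        everything = trans (∑-cong∈ (sums i A) (λ {s} s∈ → 𝟙-yes (s ∈? sums i A) s∈))
          (trans (∑-const (sums i A) 1) (trans (*-identityʳ _) (length-sums i A)))

      -- By `dense`, |X| is at least α^(1 - 2/N), so j-tuples of X are scarcer than those of A by a
      -- factor up to α^(2j/N). The lower bounds on `δ₁` and `δ` pay for this and for the constants,
      -- each of which costs one factor α in N-th powers.
      module _ (X : List E) (X-unique : Unique X) (X⊆A : ∀ {x} → x ∈ X → x ∈ A)
        (dense : α ^ N ≤ α ^ 2 * length X ^ N) (b i s δ₁ k δ : ℕ)
        (fewSums : card (sums (suc i) X) ^ N ≤ α ^ s) (spread : Spread i k δ)
        (room : 1 + s + δ₁ ≤ k + N) (δ₁-large : 1 + 2 * suc i ≤ δ₁) (δ-large : 2 + 2 * suc i ≤ δ)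
        (const₁ : (8 * b ^ suc i) ^ N ≤ α) (const₂ : (2 * p * suc i) ^ N ≤ α) where

        open Robustness _≟_ isAb p X X-unique using (Robust; tupleSum-esum)
        open Sampling _≟_ isAb p X X-unique

        private
          j = suc i
          β = length X
          -- The largest threshold for rarity that keeps |jX| Λ^(1/N) below α^j by the margin `δ₁`.
          -- By `room` it is still high enough for the heavy sums to number at most α^(k/N), so that
          -- `spread` applies to them.
          ℓ = j * N ∸ (s + δ₁)
          s+δ₁≤ : s + δ₁ ≤ j * N
          s+δ₁≤ = ≤-trans (n≤1+n _) (≤-trans room (≤-trans (≤-reflexive (+-comm k N)) (+-monoʳ-≤ N (<⇒≤ (spread-bound {i} {k} {δ} spread)))))
          ℓ+ : ℓ + (s + δ₁) ≡ j * N
          ℓ+ = m∸n+n≡m s+δ₁≤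
          Λ = α ^ ℓ
          1≤Λ : 1 ≤ Λ
          1≤Λ = m^n>0 α ℓ
          c₁ = 8 * b ^ j
          c₂ = 2 * p * j
          rare heavy : ℕ
          rare  = ∑ (dedup (sums j X)) (rareCount N Λ 1≤Λ i)
          heavy = ∑ (dedup (sums j X)) (heavyCount N Λ 1≤Λ i)
          T = heavySums N Λ 1≤Λ i

          dense-j : α ^ (j * N) ≤ α ^ (2 * j) * β ^ (j * N)
          dense-j = begin
            α ^ (j * N)                ≡⟨ trans (cong (α ^_) (*-comm j N)) (sym (^-*-assoc α N j)) ⟩
            (α ^ N) ^ j                ≤⟨ ^-monoˡ-≤ j dense ⟩
            (α ^ 2 * β ^ N) ^ j        ≡⟨ ^-distrib-* (α ^ 2) (β ^ N) j ⟩
            (α ^ 2) ^ j * (β ^ N) ^ j  ≡⟨ cong₂ _*_ (^-*-assoc α 2 j) (trans (^-*-assoc β N j) (cong (β ^_) (*-comm N j))) ⟩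
            α ^ (2 * j) * β ^ (j * N)  ∎
            where open ≤-Reasoning

          conclude : ∀ {x} d e → (x ^ N) * α ^ e ≤ α ^ (d + j * N) → d + 2 * j ≤ e → x ≤ β ^ j
          conclude {x} d e h d+2j≤e = ^-cancelˡ-≤ N (≤-trans (α^-cancel e (begin
            x ^ N * α ^ e                          ≤⟨ h ⟩
            α ^ (d + j * N)                        ≡⟨ α^+ d (j * N) ⟩
            α ^ d * α ^ (j * N)                    ≤⟨ *-monoʳ-≤ (α ^ d) dense-j ⟩
            α ^ d * (α ^ (2 * j) * β ^ (j * N))    ≡⟨ trans (sym (*-assoc (α ^ d) _ _)) (cong (_* β ^ (j * N)) (sym (α^+ d (2 * j)))) ⟩
            α ^ (d + 2 * j) * β ^ (j * N)          ≤⟨ *-monoˡ-≤ (β ^ (j * N)) (α^-mono d+2j≤e) ⟩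
            α ^ e * β ^ (j * N)                    ≡⟨ *-comm (α ^ e) _ ⟩
            β ^ (j * N) * α ^ e                    ∎)) (≤-reflexive (sym (^-*-assoc β j N))))
            where open ≤-Reasoning

          rare-small : c₁ * rare ≤ β ^ j
          rare-small = conclude 1 δ₁ (begin
            (c₁ * rare) ^ N * α ^ δ₁               ≡⟨ cong (_* α ^ δ₁) (^-distrib-* c₁ rare N) ⟩
            c₁ ^ N * rare ^ N * α ^ δ₁             ≤⟨ *-monoˡ-≤ (α ^ δ₁) (*-mono-≤ const₁ (≤-trans (rareCount-few N Λ 1≤Λ i) (*-monoˡ-≤ Λ fewSums))) ⟩
            α * (α ^ s * α ^ ℓ) * α ^ δ₁           ≡⟨ trans (*-assoc α _ (α ^ δ₁)) (cong (α *_) (trans (cong (_* α ^ δ₁) (sym (α^+ s ℓ))) (sym (α^+ (s + ℓ) δ₁)))) ⟩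
            α ^ (1 + (s + ℓ + δ₁))                 ≡⟨ cong (λ k → α ^ suc k) (trans (lemma s ℓ δ₁) ℓ+) ⟩
            α ^ (1 + j * N)                        ∎) δ₁-large
            where
            open ≤-Reasoning
            lemma : ∀ s l d → s + l + d ≡ l + (s + d)
            lemma = solve-∀

          T-small : length T ^ N ≤ α ^ k
          T-small = *-cancelʳ-≤ _ _ Λ {{m^n≢0 α ℓ}} (begin
            length T ^ N * Λ                       ≤⟨ heavySums-few N Λ 1≤Λ i ⟩
            (c₂ * β ^ i) ^ N                       ≤⟨ ^-monoˡ-≤ N (*-monoʳ-≤ c₂ (^-monoˡ-≤ i (unique-⊆⇒length≤ X-unique X⊆A))) ⟩
            (c₂ * α ^ i) ^ N                       ≡⟨ trans (^-distrib-* c₂ (α ^ i) N) (cong (c₂ ^ N *_) (^^ α i)) ⟩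
            c₂ ^ N * α ^ (i * N)                   ≤⟨ *-monoˡ-≤ (α ^ (i * N)) const₂ ⟩
            α ^ (1 + i * N)                        ≤⟨ α^-mono fits ⟩
            α ^ (k + ℓ)                            ≡⟨ α^+ k ℓ ⟩
            α ^ k * Λ                              ∎)
            where
            open ≤-Reasoning
            fits : 1 + i * N ≤ k + ℓ
            fits = +-cancelʳ-≤ (s + δ₁) _ _ (begin
              1 + i * N + (s + δ₁)      ≡⟨ lemma (i * N) s δ₁ ⟩
              i * N + (1 + s + δ₁)      ≤⟨ +-monoʳ-≤ (i * N) room ⟩
              i * N + (k + N)           ≡⟨ lemma′ (i * N) k N ⟩
              k + j * N                 ≡⟨ cong (k +_) (sym ℓ+) ⟩
              k + (ℓ + (s + δ₁))        ≡⟨ sym (+-assoc k ℓ _) ⟩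
              k + ℓ + (s + δ₁)          ∎)
              where
              lemma : ∀ a s d → 1 + a + (s + d) ≡ a + (1 + s + d)
              lemma = solve-∀
              lemma′ : ∀ a k n → a + (k + n) ≡ k + (n + a)
              lemma′ = solve-∀

          heavy-small : c₁ * heavy ≤ β ^ j
          heavy-small = conclude 2 δ (begin
            (c₁ * heavy) ^ N * α ^ δ
              ≤⟨ *-monoˡ-≤ (α ^ δ) (^-monoˡ-≤ N (*-monoʳ-≤ c₁ (≤-trans (heavyCount-few N Λ 1≤Λ i)
                   (*-monoʳ-≤ c₂ (*-mono-≤ (unique-⊆⇒length≤ X-unique X⊆A) (hits-⊆ i T X-unique X⊆A)))))) ⟩
            (c₁ * (c₂ * (α * g))) ^ N * α ^ δ
              ≡⟨ cong (_* α ^ δ) (trans (^-distrib-* c₁ _ N) (cong (c₁ ^ N *_) (trans (^-distrib-* c₂ _ N) (cong (c₂ ^ N *_) (^-distrib-* α g N))))) ⟩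
            c₁ ^ N * (c₂ ^ N * (α ^ N * g ^ N)) * α ^ δ
              ≤⟨ *-monoˡ-≤ (α ^ δ) (*-mono-≤ const₁ (*-monoˡ-≤ (α ^ N * g ^ N) const₂)) ⟩
            α * (α * (α ^ N * g ^ N)) * α ^ δ
              ≡⟨ lemma α (α ^ N) (g ^ N) (α ^ δ) ⟩
            α * (α * (α ^ N * (g ^ N * α ^ δ)))
              ≤⟨ *-monoʳ-≤ α (*-monoʳ-≤ α (*-monoʳ-≤ (α ^ N) (<⇒≤ (spread T T-small)))) ⟩
            α * (α * (α ^ N * α ^ (i * N)))
              ≡⟨ cong (λ k → α * (α * k)) (sym (α^+ N (i * N))) ⟩
            α ^ (2 + j * N) ∎) δ-large
            where
            open ≤-Reasoning
            g = hits i A T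
            lemma : ∀ a n g d → a * (a * (n * g)) * d ≡ a * (a * (n * (g * d)))
            lemma = solve-∀

        fragile-few : 4 * (b ^ j * tupleSum j X (fragile j)) ≤ β ^ j
        fragile-few = *-cancelˡ-≤ 2 (begin
          2 * (4 * (b ^ j * tupleSum j X (fragile j)))  ≡⟨ lemma (b ^ j) _ ⟩
          c₁ * tupleSum j X (fragile j)                 ≤⟨ *-monoʳ-≤ c₁ (fragile≤ N Λ 1≤Λ i) ⟩
          c₁ * (rare + heavy)                           ≡⟨ *-distribˡ-+ c₁ rare heavy ⟩
          c₁ * rare + c₁ * heavy                        ≤⟨ +-mono-≤ rare-small heavy-small ⟩
          β ^ j + β ^ j                                 ≡⟨ cong (β ^ j +_) (sym (+-identityʳ (β ^ j))) ⟩
          2 * β ^ j                                     ∎)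
          where
          open ≤-Reasoning
          lemma : ∀ b f → 2 * (4 * (b * f)) ≡ 8 * b * f
          lemma = solve-∀

  -- Raising the exponent of a free set.

  module Increment (p : ℕ) (isPrime : Prime p) {E : Set} (_≟_ : DecidableEquality E)
    {_⊕_ : Op₂ E} {0# : E} {⊖_ : Op₁ E} (isAb : IsAbelianGroup _≡_ _⊕_ 0# ⊖_)
    (n : ℕ) (φ : Fin n → E → ℤ)
    (φ-+ : ∀ r x y → ℤ.+ p ℤ.∣ φ r (x ⊕ y) ℤ.- (φ r x ℤ.+ φ r y))
    (φ-0 : ∀ r → ℤ.+ p ℤ.∣ φ r 0#)
    (φ-kernel : ∀ x → (∀ r → ℤ.+ p ℤ.∣ φ r x) → x ≡ 0#)
    (A : List E) (A-unique : Unique A)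
    (noZeroSum : ∀ ys → Unique ys → (∀ {x} → x ∈ ys → x ∈ A) → length ys ≡ p → ListSums.esum isAb ys ≢ 0#)
    (N : ℕ) .{{_ : NonZero N}} {a₀ : E} (a₀∈ : a₀ ∈ A) (m i : ℕ)
    (1≤n : 1 ≤ n) (τ≤p : slack (suc i) ≤ p) (3≤N : 3 ≤ N) (2≤α : 2 ≤ length A)
    (const₁ : (8 * sampleSize p n (suc i) ^ suc (suc i)) ^ N ≤ length A)
    (const₂ : (2 * p * suc (suc i)) ^ N ≤ length A) (const₃ : 64 ^ N ≤ length A) where

    open Core p isPrime _≟_ isAb n φ φ-+ φ-0 φ-kernel A A-unique noZeroSum
    open CoreStep p isPrime _≟_ isAb n φ φ-+ φ-0 φ-kernel A A-unique noZeroSum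
    open Sumsets _≟_ isAb
    open Structure _≟_ isAb

    private instance
      α≢0 : NonZero (length A)
      α≢0 = >-nonZero (∈-length a₀∈)
      b≢0 : NonZero (sampleSize p n (suc i))
      b≢0 = m*n≢0 (2 ^ (n + pred (2 * slack (suc i) * n))) p {{m^n≢0 2 (n + pred (2 * slack (suc i) * n))}}

    open Exponents (length A) N

    module _ (K e δ K′ δ′ δ₁ : ℕ) (spread : Spread N a₀∈ (suc m) K δ) (spread′ : Spread N a₀∈ i K′ δ′)
      (4≤δ : 4 ≤ δ) (δ≤ : δ ≤ (suc m) * N) (room : 1 + (K + e + e * (4 * (suc (suc i)))) + δ₁ ≤ K′ + N)
      (δ₁-large : 1 + 2 * (suc (suc i)) ≤ δ₁) (δ′-large : 2 + 2 * (suc (suc i)) ≤ δ′) where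

      module _ (T : List E) (T-small : length T ^ N ≤ (length A) ^ (K + e))
        (many : (length A) ^ (((suc m) + (suc m)) * N) ≤ hits ((suc m) + (suc m)) A T ^ N * (length A)) where

        private
          open ≤-Reasoning
          -- With these values the contrapositive of `Spread` is the hypothesis of the
          -- Balog-Szemerédi-Gowers argument.
          L = (length A) ^ ((suc m) * N ∸ δ)
          κ = (length A) ^ K
          V = (length A) ^ ((suc m) * N)
          v = (length A) ^ (suc m)
          g = hits ((suc m) + (suc m)) A T

          L*α^δ : L * (length A) ^ δ ≡ V
          L*α^δ = trans (sym (α^+ ((suc m) * N ∸ δ) δ)) (cong ((length A) ^_) (m∸n+n≡m δ≤))

          v^N : v ^ N ≡ V
          v^N = ^^ (length A) (suc m)

          spreadL : ∀ T′ → L ≤ hits (suc m) A T′ ^ N → κ < length T′ ^ N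
          spreadL T′ L≤ with κ <? length T′ ^ N
          ... | yes κ< = κ<
          ... | no  κ≮ = ⊥-elim (<⇒≱ (spread T′ (≮⇒≥ κ≮))
                           (≤-trans (≤-reflexive (sym L*α^δ)) (*-monoˡ-≤ ((length A) ^ δ) L≤)))

          VV : V * V ≤ g ^ N * (length A)
          VV = ≤-trans (≤-reflexive (trans (sym (α^+ ((suc m) * N) ((suc m) * N))) (cong ((length A) ^_) (sym (*-distribʳ-+ N (suc m) (suc m)))))) many

          g^N≢0 : NonZero (g ^ N)
          g^N≢0 = >-nonZero (1≤product (g ^ N) (≤-trans (*-mono-≤ (m^n>0 (length A) ((suc m) * N)) (m^n>0 (length A) ((suc m) * N))) VV))
            where
            1≤product : ∀ x → 1 ≤ x * (length A) → 1 ≤ x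
            1≤product (suc x) _ = s≤s z≤n

          -- In `dense₁` one factor α absorbs 64^N, and the two uses of `VV` cost one each; hence δ
          -- ≥ 4.
          α³< : (length A) * ((length A) * (length A)) < (length A) ^ δ
          α³< = begin-strict
            (length A) * ((length A) * (length A))         ≡⟨ cong (λ k → (length A) * ((length A) * k)) (sym (*-identityʳ (length A))) ⟩
            (length A) ^ 3               <⟨ m<m+n ((length A) ^ 3) (m^n>0 (length A) 3) ⟩
            (length A) ^ 3 + (length A) ^ 3       ≡⟨ cong ((length A) ^ 3 +_) (sym (+-identityʳ ((length A) ^ 3))) ⟩
            2 * (length A) ^ 3           ≤⟨ *-monoˡ-≤ ((length A) ^ 3) 2≤α ⟩
            (length A) ^ 4               ≤⟨ α^-mono 4≤δ ⟩
            (length A) ^ δ               ∎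

          dense₁ : 64 ^ N * (v ^ N * (v ^ N * (v ^ N * L))) < (g * g) ^ N
          dense₁ = *-cancelʳ-< ((length A) ^ δ) _ _ (begin-strict
            64 ^ N * (v ^ N * (v ^ N * (v ^ N * L))) * (length A) ^ δ
              ≡⟨ cong (λ k → 64 ^ N * (k * (k * (k * L))) * (length A) ^ δ) v^N ⟩
            64 ^ N * (V * (V * (V * L))) * (length A) ^ δ
              ≡⟨ lemma₁ (64 ^ N) V L ((length A) ^ δ) ⟩
            64 ^ N * ((V * V) * (V * (L * (length A) ^ δ)))
              ≡⟨ cong (λ k → 64 ^ N * ((V * V) * (V * k))) L*α^δ ⟩
            64 ^ N * ((V * V) * (V * V))
              ≤⟨ *-mono-≤ const₃ (*-mono-≤ VV VV) ⟩
            (length A) * ((g ^ N * (length A)) * (g ^ N * (length A)))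
              ≡⟨ lemma₂ (length A) (g ^ N) ⟩
            (g ^ N * g ^ N) * ((length A) * ((length A) * (length A)))
              <⟨ *-monoʳ-< (g ^ N * g ^ N) {{m*n≢0 (g ^ N) (g ^ N) {{g^N≢0}} {{g^N≢0}}}} α³< ⟩
            (g ^ N * g ^ N) * (length A) ^ δ
              ≡⟨ cong (_* (length A) ^ δ) (sym (^-distrib-* g g N)) ⟩
            (g * g) ^ N * (length A) ^ δ ∎)
            where
            lemma₁ : ∀ c v l d → c * (v * (v * (v * l))) * d ≡ c * ((v * v) * (v * (l * d)))
            lemma₁ = solve-∀
            lemma₂ : ∀ a g → a * ((g * a) * (g * a)) ≡ (g * g) * (a * (a * a))
            lemma₂ = solve-∀

          4^N≤α : 4 ^ N ≤ (length A)
          4^N≤α = ≤-trans (^-monoˡ-≤ N (m≤m+n 4 60)) const₃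

          dense₂ : (4 * v) ^ N * L ≤ g ^ N
          dense₂ = α^-cancel δ (begin
            (4 * v) ^ N * L * (length A) ^ δ          ≡⟨ cong (λ k → k * L * (length A) ^ δ) (trans (^-distrib-* 4 v N) (cong (4 ^ N *_) v^N)) ⟩
            4 ^ N * V * L * (length A) ^ δ            ≡⟨ lemma₁ (4 ^ N) V L ((length A) ^ δ) ⟩
            4 ^ N * (V * (L * (length A) ^ δ))        ≡⟨ cong (λ k → 4 ^ N * (V * k)) L*α^δ ⟩
            4 ^ N * (V * V)                  ≤⟨ *-mono-≤ 4^N≤α VV ⟩
            (length A) * (g ^ N * (length A))                  ≡⟨ lemma₂ (length A) (g ^ N) ⟩
            g ^ N * ((length A) * (length A))                  ≤⟨ *-monoʳ-≤ (g ^ N) (≤-trans (m≤n*m ((length A) * (length A)) (length A)) (<⇒≤ α³<)) ⟩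
            g ^ N * (length A) ^ δ                    ∎)
            where
            lemma₁ : ∀ c v l d → c * v * l * d ≡ c * (v * (l * d))
            lemma₁ = solve-∀
            lemma₂ : ∀ a g → a * (g * a) ≡ g * (a * a)
            lemma₂ = solve-∀

        refuted : ⊥
        refuted = finish (structuredSubset N A A-unique m T κ L spreadL a₀∈ dense₁ dense₂)
          where
          finish : Subset N A A-unique m T κ L spreadL a₀∈ dense₁ dense₂ → ⊥
          finish (X , X-unique , X⊆A , large , sums-small) =
            -- The sample must be robust for the lengths h and h + 1. The second needs the bound on
            -- (h - 1)-tuples moved up to h-tuples, which is `spread-suc`.
            let B , B-len , B-unique , B⊆X , robust₁ , robust₂ = Sampling.robustSample _≟_ isAb p X X-unique (proj₂ X-nonempty) (sampleSize p n (suc i)) (suc i) (suc (suc i)) pairs-few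
                  (fragile-few N a₀∈ X X-unique X⊆A dense (sampleSize p n (suc i)) i (K + e + e * (4 * (suc i))) δ₁ K′ δ′ (fewSums (suc i)) spread′
                    (≤-trans (+-monoˡ-≤ δ₁ (+-monoʳ-≤ 1 (+-monoʳ-≤ (K + e) (*-monoʳ-≤ e (*-monoʳ-≤ 4 (n≤1+n (suc i))))))) room)
                    (≤-trans (+-monoʳ-≤ 1 (*-monoʳ-≤ 2 (n≤1+n (suc i)))) δ₁-large)
                    (≤-trans (+-monoʳ-≤ 2 (*-monoʳ-≤ 2 (n≤1+n (suc i)))) δ′-large)
                    (≤-trans (^-monoˡ-≤ N (*-monoʳ-≤ 8 (^-monoʳ-≤ (sampleSize p n (suc i)) (n≤1+n (suc i))))) const₁)
                    (≤-trans (^-monoˡ-≤ N (*-monoʳ-≤ (2 * p) (n≤1+n (suc i)))) const₂))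
                  (fragile-few N a₀∈ X X-unique X⊆A dense (sampleSize p n (suc i)) (suc i) (K + e + e * (4 * (suc (suc i)))) δ₁ K′ δ′ (fewSums (suc (suc i)))
                    (spread-suc N a₀∈ {i} {K′} {δ′} spread′) room δ₁-large δ′-large const₁ const₂)
            in noRobustSet X X-unique X⊆A i 1≤n τ≤p B B-unique robust₁ robust₂ (≤-reflexive (sym B-len))
            where
            β = length X
            -- The loss of two factors α: one is allowed by `many`, the other absorbs 4^N.
            dense : (length A) ^ N ≤ (length A) ^ 2 * β ^ N
            dense = *-cancelˡ-≤ (V * (length A) ^ (m * N)) {{m*n≢0 V ((length A) ^ (m * N)) {{m^n≢0 (length A) ((suc m) * N)}} {{m^n≢0 (length A) (m * N)}}}} (begin
              V * (length A) ^ (m * N) * (length A) ^ N                       ≡⟨ trans (*-assoc V _ _) (cong (V *_) (trans (*-comm ((length A) ^ (m * N)) ((length A) ^ N)) (sym (α^+ N (m * N))))) ⟩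
              V * V                                         ≤⟨ VV ⟩
              g ^ N * (length A)                                     ≤⟨ *-monoˡ-≤ (length A) (^-monoˡ-≤ N large) ⟩
              (4 * v * ((length A) ^ m * β)) ^ N * (length A)                 ≡⟨ cong (_* (length A)) (trans (^-distrib-* (4 * v) _ N) (cong₂ _*_ (trans (^-distrib-* 4 v N) (cong (4 ^ N *_) v^N))
                                                                (trans (^-distrib-* ((length A) ^ m) β N) (cong (_* β ^ N) (^^ (length A) m))))) ⟩
              4 ^ N * V * ((length A) ^ (m * N) * β ^ N) * (length A)         ≤⟨ *-monoˡ-≤ (length A) (*-monoˡ-≤ ((length A) ^ (m * N) * β ^ N) (*-monoˡ-≤ V 4^N≤α)) ⟩
              (length A) * V * ((length A) ^ (m * N) * β ^ N) * (length A)             ≡⟨ lemma (length A) V ((length A) ^ (m * N)) (β ^ N) ⟩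
              V * (length A) ^ (m * N) * ((length A) * ((length A) * 1) * β ^ N)       ∎)
              where
              lemma : ∀ a v m b → a * v * (m * b) * a ≡ v * m * (a * (a * 1) * b)
              lemma = solve-∀
            β-large : (length A) ≤ β ^ N
            β-large = *-cancelˡ-≤ ((length A) ^ 2) {{m^n≢0 (length A) 2}} (begin
              (length A) ^ 2 * (length A)              ≡⟨ *-comm ((length A) ^ 2) (length A) ⟩
              (length A) ^ 3                  ≤⟨ α^-mono 3≤N ⟩
              (length A) ^ N                  ≤⟨ dense ⟩
              (length A) ^ 2 * β ^ N          ∎)
            X-nonempty : ∃ λ x → x ∈ X
            X-nonempty = nonempty⇒∃ X (1≤^⇒1≤ N (≤-trans (≤-trans (s≤s z≤n) 2≤α) β-large))
            pairs-few : 4 * ((sampleSize p n (suc i)) ^ 2 * (β * 1)) ≤ β ^ 2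
            pairs-few = begin
              4 * ((sampleSize p n (suc i)) ^ 2 * (β * 1))      ≡⟨ lemma ((sampleSize p n (suc i)) ^ 2) β ⟩
              4 * (sampleSize p n (suc i)) ^ 2 * β              ≤⟨ *-monoˡ-≤ β (^-cancelˡ-≤ N (≤-trans (^-monoˡ-≤ N (*-mono-≤ (m≤m+n 4 4) (^-monoʳ-≤ (sampleSize p n (suc i)) (s≤s (s≤s (z≤n {i})))))) (≤-trans const₁ β-large))) ⟩
              β * β                      ≡⟨ cong (β *_) (sym (*-identityʳ β)) ⟩
              β ^ 2                      ∎
              where
              lemma : ∀ b x → 4 * (b * (x * 1)) ≡ 4 * b * x
              lemma = solve-∀
            -- Dividing by κ^(4ι) removes K from the 4ι factors of size α^(K + e), so the number of
            -- summands multiplies only the increment `e`.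
            fewSums : ∀ ι → card (sums ι X) ^ N ≤ (length A) ^ (K + e + e * (4 * ι))
            fewSums ι = *-cancelʳ-≤ _ _ ((length A) ^ (K * (4 * ι))) {{m^n≢0 (length A) (K * (4 * ι))}} (begin
              card (sums ι X) ^ N * (length A) ^ (K * (4 * ι))             ≡⟨ cong (card (sums ι X) ^ N *_) (sym (^-*-assoc (length A) K (4 * ι))) ⟩
              card (sums ι X) ^ N * κ ^ (4 * ι)                   ≤⟨ *-monoʳ-≤ (card (sums ι X) ^ N) (^-monoˡ-≤ (4 * ι) (n≤1+n κ)) ⟩
              card (sums ι X) ^ N * suc κ ^ (4 * ι)               ≤⟨ sums-small ι ⟩
              length T ^ N * (length T ^ N) ^ (4 * ι)             ≤⟨ *-mono-≤ T-small (^-monoˡ-≤ (4 * ι) T-small) ⟩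
              (length A) ^ (K + e) * ((length A) ^ (K + e)) ^ (4 * ι)               ≡⟨ cong ((length A) ^ (K + e) *_) (^-*-assoc (length A) (K + e) (4 * ι)) ⟩
              (length A) ^ (K + e) * (length A) ^ ((K + e) * (4 * ι))               ≡⟨ sym (α^+ (K + e) _) ⟩
              (length A) ^ (K + e + (K + e) * (4 * ι))                     ≡⟨ cong ((length A) ^_) (lemma K e (4 * ι)) ⟩
              (length A) ^ (K + e + e * (4 * ι) + K * (4 * ι))             ≡⟨ α^+ (K + e + e * (4 * ι)) _ ⟩
              (length A) ^ (K + e + e * (4 * ι)) * (length A) ^ (K * (4 * ι))       ∎)
              where
              lemma : ∀ k e j → k + e + (k + e) * j ≡ k + e + e * j + k * j
              lemma = solve-∀

      increment : Spread N a₀∈ ((suc m) + (suc m)) (K + e) 1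
      increment T T-small with hits ((suc m) + (suc m)) A T ^ N * (length A) ^ 1 <? (length A) ^ (((suc m) + (suc m)) * N)
      ... | yes lt = lt
      ... | no ¬lt = ⊥-elim (refuted T T-small (≤-trans (≮⇒≥ ¬lt) (≤-reflexive (cong (hits ((suc m) + (suc m)) A T ^ N *_) (*-identityʳ (length A))))))

  -- The induction on the exponent.

  module Space (p n : ℕ) .{{p≢0 : NonZero p}} where
    open VectorGroup.VectorSpace p public
    isAb = +ᵥ-isAbelianGroup n
    _≟ᵥ_ = ≡-dec {n = n} (Fin._≟_ {p})
    open Sumsets _≟ᵥ_ isAb public
    open Structure _≟ᵥ_ isAb public
    open ListSums isAb public

    NoZeroSum : List (Vecₚ p n) → Set
    NoZeroSum A = ∀ ys → Unique ys → (∀ {x} → x ∈ ys → x ∈ A) → length ys ≡ p → esum ys ≢ 0ᵥ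

  -- The induction hypothesis for the exponent κ = a/q, with M = suc m and δ = 1/d.
  record Thin (a q : ℕ) : Set where
    field
      m d C p₀ : ℕ
      1≤d : 1 ≤ d
      1≤C : 1 ≤ C
      thin : (p : ℕ) .{{_ : NonZero p}} → Prime p → p₀ ≤ p → Σ ℕ λ D → 1 ≤ D ×
        ((n : ℕ) → 1 ≤ n → (A : List (Vecₚ p n)) → Unique A → D * C ^ n ≤ length A →
          Space.NoZeroSum p n A → ∀ T → length T ^ q ≤ length A ^ a →
          Space.hits p n (suc m) A T ^ d * length A < length A ^ (suc m * d))

  open Thin

  -- Exponent 1/2, for single vectors: at most |T| ≤ α^(1/2) elements of A hit `T`, so the fourth
  -- power of the count times α is at most α³. The factor D = 2 ensures α ≥ 2 for strictness.
  thin-base : Thin 1 2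
  thin-base = record
    { m = 0 ; d = 4 ; C = 1 ; p₀ = 0 ; 1≤d = s≤s z≤n ; 1≤C = s≤s z≤n
    ; thin = λ p _ _ → 2 , s≤s z≤n , λ n _ A A-unique big _ T T-small → base p n A A-unique big T T-small }
    where
    open ≤-Reasoning
    base : ∀ p n .{{_ : NonZero p}} (A : List (Vecₚ p n)) → Unique A → 2 * 1 ^ n ≤ length A → ∀ T → length T ^ 2 ≤ length A ^ 1 →
      Space.hits p n 1 A T ^ 4 * length A < length A ^ 4
    base p n A A-unique big T T-small = begin-strict
      r ^ 4 * α            ≡⟨ cong (_* α) (sym (^-*-assoc r 2 2)) ⟩
      (r ^ 2) ^ 2 * α      ≤⟨ *-monoˡ-≤ α (^-monoˡ-≤ 2 (≤-trans (^-monoˡ-≤ 2 r≤) (≤-trans T-small (≤-reflexive (*-identityʳ α))))) ⟩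
      α ^ 2 * α            ≡⟨ *-comm (α ^ 2) α ⟩
      α ^ 3                <⟨ ^-monoʳ-< α 2≤α {3} {4} ≤-refl ⟩
      α ^ 4                ∎
      where
      open Space p n
      α = length A
      r = hits 1 A T
      2≤α : 2 ≤ α
      2≤α = ≤-trans (≤-reflexive (cong (2 *_) (sym (^-zeroˡ n)))) big
      in? : ∀ x → Dec (x ∈ T)
      in? x = x ∈? T
      r≤ : r ≤ length T
      r≤ = begin
        ∑ (A ⊞ (0ᵥ ∷ [])) (λ s → 𝟙 (s ∈? T))     ≡⟨ ∑-⊞ A (0ᵥ ∷ []) (λ s → 𝟙 (s ∈? T)) ⟩
        ∑ A (λ x → 𝟙 ((x +ᵥ 0ᵥ) ∈? T) + 0)       ≡⟨ ∑-cong A (λ x → trans (+-identityʳ _) (cong (λ s → 𝟙 (s ∈? T)) (identityʳ x))) ⟩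
        ∑ A (λ x → 𝟙 (x ∈? T))                   ≡⟨ sym (length-filter in? A) ⟩
        length (filter in? A)                    ≤⟨ unique-⊆⇒length≤ (Unique.filter⁺ in? A-unique) (λ x∈ → proj₂ (∈-filter⁻ in? {xs = A} x∈)) ⟩
        length T                                 ∎

  -- The same exponent over a larger denominator, so that a step of 1/q can be made as small as
  -- `fine` demands.
  thin-scale : ∀ {a q a₁ q₁} r .{{_ : NonZero r}} → a * r ≡ a₁ → q * r ≡ q₁ → Thin a q → Thin a₁ q₁
  thin-scale {a} {q} r refl refl t = record
    { m = m t ; d = d t ; C = C t ; p₀ = p₀ t ; 1≤d = 1≤d t ; 1≤C = 1≤C t
    ; thin = λ p pr p≥ → let D , 1≤D , h = thin t p pr p≥ in D , 1≤D , λ n 1≤n A u big nz T T-small →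
        h n 1≤n A u big nz T (^-cancelˡ-≤ r (≤-trans (≤-reflexive (^-*-assoc (length T) q r))
          (≤-trans T-small (≤-reflexive (sym (^-*-assoc (length A) a r)))))) }

  -- The statement `t` for κ = a/q drives the Balog-Szemerédi-Gowers argument; `t′` for κ′ = a′/q,
  -- with κ at most κ′ + 1/2, limits the heavy sums. The demand `fine` on the step involves the
  -- tuple length of `t′` only, not that of `t`.
  module Step {a a′ q : ℕ} (t : Thin a q) (t′ : Thin a′ q) (near : 2 * a ≤ 2 * a′ + q)
    (fine : 8 * (1 + 4 * suc (suc (suc (m t′)))) ≤ q) where

    private
      j = suc (suc (suc (m t′)))
      i = suc (m t′)
      M = suc (m t)
      R = 2 + 2 * j
      d₁ = d t
      d₂ = d t′
      -- In units of 1/N the step 1/q is `e`, while the savings 1/d₁ and 1/d₂ are the integers `δ`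
      -- and `δ′`. The factor 8R makes N/8, the value of `δ₁`, an integer multiple of the loss `R`.
      e = d₁ * d₂ * (8 * R)
      N = q * e
      τ = slack (suc i)

      instance
        d₁≢0 : NonZero d₁
        d₁≢0 = >-nonZero (1≤d t)
        d₂≢0 : NonZero d₂
        d₂≢0 = >-nonZero (1≤d t′)
        q≢0 : NonZero q
        q≢0 = >-nonZero (≤-trans (s≤s z≤n) fine)
        d₁₂≢0 : NonZero (d₁ * d₂)
        d₁₂≢0 = m*n≢0 d₁ d₂
        e≢0 : NonZero e
        e≢0 = m*n≢0 (d₁ * d₂) (8 * R)
        N≢0 : NonZero N
        N≢0 = m*n≢0 q e

      δ = q * d₂ * (8 * R)
      δ′ = q * d₁ * (8 * R)
      δ₁ = q * (d₁ * d₂) * R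

      N≡δ : N ≡ d₁ * δ
      N≡δ = lemma q d₁ d₂ (8 * R)
        where
        lemma : ∀ q a b r → q * (a * b * r) ≡ a * (q * b * r)
        lemma = solve-∀

      N≡δ′ : N ≡ d₂ * δ′
      N≡δ′ = lemma q d₁ d₂ (8 * R)
        where
        lemma : ∀ q a b r → q * (a * b * r) ≡ b * (q * a * r)
        lemma = solve-∀

      N≡8δ₁ : N ≡ 8 * δ₁
      N≡8δ₁ = lemma q (d₁ * d₂) R
        where
        lemma : ∀ q d r → q * (d * (8 * r)) ≡ 8 * (q * d * r)
        lemma = solve-∀

      8R≤δ : 8 * R ≤ δ
      8R≤δ = m≤n*m (8 * R) (q * d₂) {{m*n≢0 q d₂}}

      R≤δ₁ : R ≤ δ₁
      R≤δ₁ = m≤n*m R (q * (d₁ * d₂)) {{m*n≢0 q (d₁ * d₂)}}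

      R≤δ′ : R ≤ δ′
      R≤δ′ = ≤-trans (m≤n*m R 8) (m≤n*m (8 * R) (q * d₁) {{m*n≢0 q d₁}})

      4≤8R : 4 ≤ 8 * R
      4≤8R = ≤-trans (m≤m+n 4 12) (*-monoʳ-≤ 8 {2} {R} (s≤s (s≤s z≤n)))

      -- Of the N/2 that `near` leaves over, 1 + δ₁ takes at most 2δ₁ and the loss e (1 + 4j) at
      -- most δ₁ by `fine`: together 3N/8.
      room : 1 + (a * e + e + e * (4 * j)) + δ₁ ≤ a′ * e + N
      room = *-cancelˡ-≤ 2 (begin
        2 * (1 + (a * e + e + e * (4 * j)) + δ₁)
          ≡⟨ lemma₁ a e j δ₁ ⟩
        2 * a * e + (2 * (1 + δ₁) + 2 * (e * (1 + 4 * j)))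
          ≤⟨ +-mono-≤ (*-monoˡ-≤ e near) (+-mono-≤ (*-monoʳ-≤ 2 (+-monoˡ-≤ δ₁ (≤-trans (s≤s z≤n) R≤δ₁))) (*-monoʳ-≤ 2 e-small)) ⟩
        (2 * a′ + q) * e + (2 * (δ₁ + δ₁) + 2 * δ₁)
          ≤⟨ +-monoʳ-≤ ((2 * a′ + q) * e) (≤-trans (m≤m+n _ (2 * δ₁)) (≤-reflexive (trans (lemma₂ δ₁) (sym N≡8δ₁)))) ⟩
        (2 * a′ + q) * e + N
          ≡⟨ lemma₃ a′ q e ⟩
        2 * (a′ * e + N) ∎)
        where
        open ≤-Reasoning
        lemma₁ : ∀ a e j d → 2 * (1 + (a * e + e + e * (4 * j)) + d) ≡ 2 * a * e + (2 * (1 + d) + 2 * (e * (1 + 4 * j)))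
        lemma₁ = solve-∀
        lemma₂ : ∀ d → 2 * (d + d) + 2 * d + 2 * d ≡ 8 * d
        lemma₂ = solve-∀
        lemma₃ : ∀ a q e → (2 * a + q) * e + q * e ≡ 2 * (a * e + q * e)
        lemma₃ = solve-∀
        e-small : e * (1 + 4 * j) ≤ δ₁
        e-small = *-cancelˡ-≤ 8 (begin
          8 * (e * (1 + 4 * j))   ≡⟨ lemma e (1 + 4 * j) ⟩
          8 * (1 + 4 * j) * e     ≤⟨ *-monoˡ-≤ e fine ⟩
          N                       ≡⟨ N≡8δ₁ ⟩
          8 * δ₁                  ∎)
          where
          lemma : ∀ e k → 8 * (e * k) ≡ 8 * k * e
          lemma = solve-∀

      growth = 2 ^ (1 + 2 * τ)
      C₃ = growth ^ (j * N)

      -- The bound D′ C′^n is a product of three bounds, each at least 1, so it implies them all: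
      -- those of `t` and `t′`, and one for the numerical constants. Powers of p go into D₃; the
      -- part of the sample size exponential in n goes into C₃, which is free of p.
      module Bounds (p D₁ D₂ : ℕ) .{{_ : NonZero p}} (1≤D₁ : 1 ≤ D₁) (1≤D₂ : 1 ≤ D₂) where

        D₃ D′ C′ : ℕ
        D₃ = (8 * p ^ j) ^ N * ((2 * p * j) ^ N * 64 ^ N)
        D′ = D₁ * (D₂ * D₃)
        C′ = C t * (C t′ * C₃)

        1≤8p : 1 ≤ (8 * p ^ j) ^ N
        1≤8p = m^n>0 (8 * p ^ j) {{m*n≢0 8 (p ^ j) {{_}} {{m^n≢0 p j}}}} N

        1≤2pj : 1 ≤ (2 * p * j) ^ N
        1≤2pj = m^n>0 (2 * p * j) {{m*n≢0 (2 * p) j {{m*n≢0 2 p}}}} N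

        1≤64 : 1 ≤ 64 ^ N
        1≤64 = m^n>0 64 N

        1≤D₃ : 1 ≤ D₃
        1≤D₃ = *-mono-≤ 1≤8p (*-mono-≤ 1≤2pj 1≤64)

        1≤C₃ : 1 ≤ C₃
        1≤C₃ = m^n>0 growth {{m^n≢0 2 (1 + 2 * τ)}} (j * N)

        1≤D′ : 1 ≤ D′
        1≤D′ = *-mono-≤ 1≤D₁ (*-mono-≤ 1≤D₂ 1≤D₃)

        module _ (n α : ℕ) (big : D′ * C′ ^ n ≤ α) where

          open ≤-Reasoning

          private
            f₁ = D₁ * C t ^ n
            f₂ = D₂ * C t′ ^ n
            f₃ = D₃ * C₃ ^ n

            factor : D′ * C′ ^ n ≡ f₁ * (f₂ * f₃)
            factor = trans (cong (D′ *_) (trans (^-distrib-* (C t) _ n) (cong (C t ^ n *_) (^-distrib-* (C t′) C₃ n))))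
              (lemma D₁ D₂ D₃ (C t ^ n) (C t′ ^ n) (C₃ ^ n))
              where
              lemma : ∀ a b c x y z → a * (b * c) * (x * (y * z)) ≡ (a * x) * ((b * y) * (c * z))
              lemma = solve-∀

            pos : ∀ {D C} → 1 ≤ D → 1 ≤ C → NonZero (D * C ^ n)
            pos {D} {C} 1≤D 1≤C = >-nonZero (*-mono-≤ 1≤D (m^n>0 C {{>-nonZero 1≤C}} n))

            instance
              f₁≢0 : NonZero f₁
              f₁≢0 = pos 1≤D₁ (1≤C t)
              f₂≢0 : NonZero f₂
              f₂≢0 = pos 1≤D₂ (1≤C t′)
              f₃≢0 : NonZero f₃
              f₃≢0 = pos 1≤D₃ 1≤C₃
              f₂₃≢0 : NonZero (f₂ * f₃)
              f₂₃≢0 = m*n≢0 f₂ f₃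

            total : f₁ * (f₂ * f₃) ≤ α
            total = ≤-trans (≤-reflexive (sym factor)) big

            f₃≤α : f₃ ≤ α
            f₃≤α = ≤-trans (≤-trans (m≤n*m f₃ f₂) (m≤n*m (f₂ * f₃) f₁)) total

            C₃^n≢0 : NonZero (C₃ ^ n)
            C₃^n≢0 = m^n≢0 C₃ n {{>-nonZero 1≤C₃}}

            D₃≤α : D₃ ≤ α
            D₃≤α = ≤-trans (m≤m*n D₃ (C₃ ^ n) {{C₃^n≢0}}) f₃≤α

          big₁ : f₁ ≤ α
          big₁ = ≤-trans (m≤m*n f₁ (f₂ * f₃)) total

          big₂ : f₂ ≤ α
          big₂ = ≤-trans (≤-trans (m≤m*n f₂ f₃) (m≤n*m (f₂ * f₃) f₁)) total

          const₂ : (2 * p * j) ^ N ≤ α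
          const₂ = ≤-trans (≤-trans (m≤m*n _ (64 ^ N) {{>-nonZero 1≤64}}) (m≤n*m _ ((8 * p ^ j) ^ N) {{>-nonZero 1≤8p}})) D₃≤α

          const₃ : 64 ^ N ≤ α
          const₃ = ≤-trans (≤-trans (m≤n*m _ ((2 * p * j) ^ N) {{>-nonZero 1≤2pj}}) (m≤n*m _ ((8 * p ^ j) ^ N) {{>-nonZero 1≤8p}})) D₃≤α

          2≤α : 2 ≤ α
          2≤α = ≤-trans (≤-trans (m≤m+n 2 62) (≤-trans (≤-reflexive (sym (*-identityʳ 64))) (^-monoʳ-≤ 64 (>-nonZero⁻¹ N)))) const₃

          const₁ : (8 * sampleSize p n (suc i) ^ j) ^ N ≤ α
          const₁ = begin
            (8 * sampleSize p n (suc i) ^ j) ^ N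
              ≤⟨ ^-monoˡ-≤ N (*-monoʳ-≤ 8 (^-monoˡ-≤ j (*-monoˡ-≤ p (^-monoʳ-≤ 2 exponent)))) ⟩
            (8 * (2 ^ ((1 + 2 * τ) * n) * p) ^ j) ^ N
              ≡⟨ cong (λ k → (8 * (k * p) ^ j) ^ N) (sym (^-*-assoc 2 (1 + 2 * τ) n)) ⟩
            (8 * (growth ^ n * p) ^ j) ^ N
              ≡⟨ cong (λ k → (8 * k) ^ N) (trans (^-distrib-* (growth ^ n) p j) (*-comm _ (p ^ j))) ⟩
            (8 * (p ^ j * (growth ^ n) ^ j)) ^ N
              ≡⟨ trans (cong (_^ N) (sym (*-assoc 8 (p ^ j) _))) (^-distrib-* (8 * p ^ j) _ N) ⟩
            (8 * p ^ j) ^ N * ((growth ^ n) ^ j) ^ N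
              ≡⟨ cong ((8 * p ^ j) ^ N *_) (trans (^-*-assoc (growth ^ n) j N) (trans (^-*-assoc growth n (j * N))
                   (trans (cong (growth ^_) (*-comm n (j * N))) (sym (^-*-assoc growth (j * N) n))))) ⟩
            (8 * p ^ j) ^ N * C₃ ^ n
              ≤⟨ *-monoˡ-≤ (C₃ ^ n) (m≤m*n ((8 * p ^ j) ^ N) ((2 * p * j) ^ N * 64 ^ N) {{>-nonZero (*-mono-≤ 1≤2pj 1≤64)}}) ⟩
            f₃
              ≤⟨ f₃≤α ⟩
            α ∎
            where
            exponent : n + pred (2 * τ * n) ≤ (1 + 2 * τ) * n
            exponent = +-monoʳ-≤ n pred[n]≤n

    thin-step : Thin (suc a) q
    thin-step = record
      { m = m t + M ; d = N ; C = C t * (C t′ * C₃) ; p₀ = p₀ t ⊔ (p₀ t′ ⊔ τ)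
      ; 1≤d = >-nonZero⁻¹ N
      ; 1≤C = *-mono-≤ (1≤C t) (*-mono-≤ (1≤C t′) (m^n>0 growth {{m^n≢0 2 (1 + 2 * τ)}} (j * N)))
      ; thin = λ p pr p≥ →
          let D₁ , 1≤D₁ , h₁ = thin t p pr (≤-trans (m≤m⊔n _ _) p≥)
              D₂ , 1≤D₂ , h₂ = thin t′ p pr (≤-trans (≤-trans (m≤m⊔n (p₀ t′) τ) (m≤n⊔m (p₀ t) _)) p≥)
              open Bounds p D₁ D₂ 1≤D₁ 1≤D₂
          in D′ , 1≤D′ , λ n 1≤n A A-unique big nz T T-small →
               body p pr n 1≤n A A-unique nz (≤-trans (≤-trans (m≤n⊔m (p₀ t′) τ) (m≤n⊔m (p₀ t) _)) p≥)
                 (2≤α n (length A) big) (const₁ n (length A) big) (const₂ n (length A) big) (const₃ n (length A) big)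
                 (h₁ n 1≤n A A-unique (big₁ n (length A) big) nz) (h₂ n 1≤n A A-unique (big₂ n (length A) big) nz) T T-small }
      where
      open ≤-Reasoning

      body : ∀ p .{{_ : NonZero p}} (pr : Prime p) n → 1 ≤ n → (A : List (Vecₚ p n)) (A-unique : Unique A) → Space.NoZeroSum p n A →
        τ ≤ p → (let α = length A) →
        2 ≤ α → (8 * sampleSize p n (suc i) ^ j) ^ N ≤ α → (2 * p * j) ^ N ≤ α → 64 ^ N ≤ α →
        (∀ T → length T ^ q ≤ α ^ a → Space.hits p n M A T ^ d₁ * α < α ^ (M * d₁)) →
        (∀ T → length T ^ q ≤ α ^ a′ → Space.hits p n i A T ^ d₂ * α < α ^ (i * d₂)) →
        ∀ T → length T ^ q ≤ α ^ suc a → Space.hits p n (M + M) A T ^ N * α < α ^ ((M + M) * N)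
      body p pr n 1≤n A A-unique nz τ≤p 2≤α c₁ c₂ c₃ h₁ h₂ T T-small = result (nonempty⇒∃ A (≤-trans (s≤s z≤n) 2≤α))
        where
        open Space p n
        α = length A
        rescale : ∀ a₀ T → length T ^ N ≤ α ^ (a₀ * e) → length T ^ q ≤ α ^ a₀
        rescale a₀ T h = ^-cancelˡ-≤ e (≤-trans (≤-reflexive (^-*-assoc (length T) q e)) (≤-trans h (≤-reflexive (sym (^-*-assoc α a₀ e)))))
        result : (∃ λ a₀ → a₀ ∈ A) → hits (M + M) A T ^ N * α < α ^ ((M + M) * N)
        result (a₀ , a₀∈) = subst (λ k → hits (M + M) A T ^ N * k < α ^ ((M + M) * N)) (*-identityʳ α)
          (Increment.increment p pr _≟ᵥ_ isAb n (coord n) (coord-+ n) (coord-0 n) (coord-kernel n) A A-unique nz N a₀∈ (m t) i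
            1≤n τ≤p 3≤N 2≤α c₁ c₂ c₃ (a * e) e δ (a′ * e) δ′ δ₁
            (λ T h → raise M {hits M A T} {d₁} δ (≤-trans (s≤s z≤n) (≤-trans 4≤8R 8R≤δ)) N≡δ (h₁ T (rescale a T h)))
            (λ T h → raise i {hits i A T} {d₂} δ′ (≤-trans (s≤s z≤n) R≤δ′) N≡δ′ (h₂ T (rescale a′ T h)))
            (≤-trans 4≤8R 8R≤δ) δ≤ room (≤-trans (n≤1+n _) R≤δ₁) R≤δ′ T
            (≤-trans (≤-reflexive (sym (^-*-assoc (length T) q e))) (≤-trans (^-monoˡ-≤ e T-small)
              (≤-reflexive (trans (^-*-assoc α (suc a) e) (cong (α ^_) (+-comm e (a * e))))))))
          where
          raise : ∀ M {h d₀} δ₀ → 1 ≤ δ₀ → N ≡ d₀ * δ₀ → h ^ d₀ * α < α ^ (M * d₀) → h ^ N * α ^ δ₀ < α ^ (M * N)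
          raise M {h} {d₀} δ₀ 1≤δ₀ N≡ lt = begin-strict
            h ^ N * α ^ δ₀               ≡⟨ cong (_* α ^ δ₀) (trans (cong (h ^_) N≡) (sym (^-*-assoc h d₀ δ₀))) ⟩
            (h ^ d₀) ^ δ₀ * α ^ δ₀       ≡⟨ sym (^-distrib-* (h ^ d₀) α δ₀) ⟩
            (h ^ d₀ * α) ^ δ₀            <⟨ ^-monoˡ-< δ₀ {{>-nonZero 1≤δ₀}} lt ⟩
            (α ^ (M * d₀)) ^ δ₀          ≡⟨ trans (^-*-assoc α (M * d₀) δ₀) (cong (α ^_) (trans (*-assoc M d₀ δ₀) (cong (M *_) (sym N≡)))) ⟩
            α ^ (M * N)                  ∎
          δ≤ : δ ≤ M * N
          δ≤ = ≤-trans (m≤n*m δ d₁) (≤-trans (≤-reflexive (sym N≡δ)) (m≤n*m N M))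
          3≤N : 3 ≤ N
          3≤N = ≤-trans (≤-trans (n≤1+n 3) (≤-trans 4≤8R 8R≤δ)) (≤-trans (m≤n*m δ d₁) (≤-reflexive (sym N≡δ)))

  -- All steps use the same `t′`, so `fine` is needed only once, although the tuple length of the
  -- climbing statement doubles each time. The bound on s is what `near` allows before the last
  -- step.
  thin-climb : ∀ {a′ q} (t′ : Thin a′ q) → 8 * (1 + 4 * suc (suc (suc (m t′)))) ≤ q → ∀ s → 2 * s ≤ q + 2 → Thin (s + a′) q
  thin-climb t′ fine zero    _  = t′
  thin-climb {a′} {q} t′ fine (suc s) s≤ =
    Step.thin-step (thin-climb t′ fine s (≤-trans (*-monoʳ-≤ 2 (n≤1+n s)) s≤)) t′ near fine
    where
    open ≤-Reasoning
    near : 2 * (s + a′) ≤ 2 * a′ + q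
    near = +-cancelʳ-≤ 2 _ _ (begin
      2 * (s + a′) + 2     ≡⟨ lemma s a′ ⟩
      2 * a′ + 2 * suc s   ≤⟨ +-monoʳ-≤ (2 * a′) s≤ ⟩
      2 * a′ + (q + 2)     ≡⟨ sym (+-assoc (2 * a′) q 2) ⟩
      2 * a′ + q + 2       ∎)
      where
      lemma : ∀ s a → 2 * (s + a) + 2 ≡ 2 * a + 2 * suc s
      lemma = solve-∀

  thin-scaled-m : ∀ {a q a₁ q₁} r .{{_ : NonZero r}} (eq : a * r ≡ a₁) (eq′ : q * r ≡ q₁) (t : Thin a q) →
    m (thin-scale r eq eq′ t) ≡ m t
  thin-scaled-m r refl refl t = refl

  -- The exponent is (k + 1)/2. Each half unit refines the denominator by an `r` fitted to the tuple
  -- length reached so far, and then takes q r steps of size 1/(2 q r).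
  thin-all : ∀ k → ∃ λ q → 1 ≤ q × Thin (suc k * q) (2 * q)
  thin-all zero    = 1 , s≤s z≤n , thin-base
  thin-all (suc k) =
    let q , 1≤q , t = thin-all k
        r = 8 * (1 + 4 * suc (suc (suc (m t))))
        t′ = thin-scale r (*-assoc (suc k) q r) (*-assoc 2 q r) t
        fine = ≤-trans (≤-reflexive (cong (λ m → 8 * (1 + 4 * suc (suc (suc m)))) (thin-scaled-m r (*-assoc (suc k) q r) (*-assoc 2 q r) t)))
                 (≤-trans (m≤n*m r q {{>-nonZero 1≤q}}) (m≤n*m (q * r) 2))
    in q * r , *-mono-≤ 1≤q (s≤s z≤n) , thin-climb t′ fine (q * r) (m≤m+n _ 2)

  -- From the exclusion of free sets to an explicit zero-sum family.

  module Extraction (p n : ℕ) .{{p≢0 : NonZero p}} where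
    open Space p n

    sums≡ : ∀ ℓ A → sums ℓ A ≡ Defs.sums ℓ A
    sums≡ zero    A = refl
    sums≡ (suc ℓ) A = cong (λ S → concatMap (λ x → map (x +ᵥ_) S) A) (sums≡ ℓ A)

    sumFam-lookup : ∀ ys → sumFam (length ys) (lookup ys) ≡ esum ys
    sumFam-lookup []       = refl
    sumFam-lookup (y ∷ ys) = cong (y +ᵥ_) (sumFam-lookup ys)

    lookup-injective : ∀ {ys : List (Vecₚ p n)} → Unique ys → ∀ {i j} → lookup ys i ≡ lookup ys j → i ≡ j
    lookup-injective (y∉ ∷ u) {Fin.zero}  {Fin.zero}  eq = refl
    lookup-injective {_ ∷ ys} (y∉ ∷ u) {Fin.zero}  {Fin.suc j} eq = ⊥-elim (All.lookup y∉ (∈-lookup {xs = ys} j) eq)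
    lookup-injective {_ ∷ ys} (y∉ ∷ u) {Fin.suc i} {Fin.zero}  eq = ⊥-elim (All.lookup y∉ (∈-lookup {xs = ys} i) (sym eq))
    lookup-injective (y∉ ∷ u) {Fin.suc i} {Fin.suc j} eq = cong Fin.suc (lookup-injective u eq)

    Family : List (Vecₚ p n) → ℕ → Set
    Family A k = Σ (Fin k → Vecₚ p n) λ x → Injective _≡_ _≡_ x × ((i : Fin k) → x i ∈ A) × sumFam k x ≡ 0ᵥ

    family : ∀ {A k} ys → Unique ys → (∀ {x} → x ∈ ys → x ∈ A) → length ys ≡ k → esum ys ≡ 0ᵥ → Family A k
    family ys u sub refl zeroSum =
      lookup ys , lookup-injective u , (λ i → sub (∈-lookup {xs = ys} i)) , trans (sumFam-lookup ys) zeroSum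

    -- A finite search over sublists turns the refutation of freeness into a witness. Distinct
    -- elements of A in arbitrary order need not form a sublist, but filtering A by them gives a
    -- rearrangement with the same sum.
    search : ∀ A → Unique A → (NoZeroSum A → ⊥) → Family A p
    search A A-unique ¬none with any? (λ ys → (length ys ≟ p) ×-dec (esum ys ≟ᵥ 0ᵥ)) (subs A)
    ... | yes found =
      let ys , ys∈ , len , zeroSum = find found
      in family ys (unique-⊑ (∈-subs⁻ ys∈) A-unique) (⊑-lookup (∈-subs⁻ ys∈)) len zeroSum
    ... | no none = ⊥-elim (¬none λ ys u sub len zeroSum →
      let ys′ = filter (_∈? ys) A
          ↭ : ys′ ↭ ys
          ↭ = unique-↭ (Unique.filter⁺ (_∈? ys) A-unique) u (λ x∈ → proj₂ (∈-filter⁻ (_∈? ys) {xs = A} x∈))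
                (λ x∈ → ∈-filter⁺ (_∈? ys) (sub x∈) x∈)
      in none (lose (∈-subs⁺ (Sub.filter-⊆ (_∈? ys) A)) (trans (↭-length ↭) len , trans (esum-↭ ↭) zeroSum)))

  -- For c = a/b the exponent a + 1/2 suffices: |ℓA|^b ≤ α^a already gives |ℓA| ≤ α^a. The set of
  -- all ℓ-fold sums is then small enough for `thin`, yet every ℓ-tuple hits it, so A cannot be
  -- free.
  zeroSumFamily : ∀ a b .{{_ : NonZero b}} →
    Σ ℕ λ ℓ → 1 ≤ ℓ × Σ ℕ λ C → 1 ≤ C × Σ ℕ λ p₀ →
    (p : ℕ) .{{_ : NonZero p}} → Prime p → p₀ ≤ p →
    Σ ℕ λ D → 1 ≤ D ×
    ((n : ℕ) → 1 ≤ n → (A : List (Vecₚ p n)) → Unique A →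
    D * C ^ n ≤ length A → sumsetCard ℓ A ^ b ≤ length A ^ a → Extraction.Family p n A p)
  zeroSumFamily a b =
    let q , 1≤q , t = thin-all (2 * a)
    in suc (m t) , s≤s z≤n , C t , 1≤C t , p₀ t , λ p pr p≥ →
       let D , 1≤D , h = thin t p pr p≥
       in D , 1≤D , λ n 1≤n A A-unique big small →
          let 1≤A = ≤-trans (*-mono-≤ 1≤D (m^n>0 (C t) {{>-nonZero (1≤C t)}} n)) big in
          Extraction.search p n A A-unique (λ none → full p n (suc (m t)) (d t) A 1≤A
            (h n 1≤n A A-unique big none (deduplicate (≡-dec Fin._≟_) (Defs.sums (suc (m t)) A))
              (exponents q a 1≤q (root≤ b small) 1≤A)))
    where
    open ≤-Reasoning
    root≤ : ∀ b .{{_ : NonZero b}} {x k} → x ^ b ≤ k → x ≤ k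
    root≤ (suc b) {zero}  h = z≤n
    root≤ (suc b) {suc x} h = ≤-trans (m≤m*n (suc x) (suc x ^ b) {{m^n≢0 (suc x) b}}) h

    exponents : ∀ q a {x α} → 1 ≤ q → x ≤ α ^ a → 1 ≤ α → x ^ (2 * q) ≤ α ^ (suc (2 * a) * q)
    exponents q a {x} {α} 1≤q x≤ 1≤α = begin
      x ^ (2 * q)                ≤⟨ ^-monoˡ-≤ (2 * q) x≤ ⟩
      (α ^ a) ^ (2 * q)          ≡⟨ ^-*-assoc α a (2 * q) ⟩
      α ^ (a * (2 * q))          ≤⟨ ^-monoʳ-≤ α {{>-nonZero 1≤α}} (≤-trans (≤-reflexive (lemma a q)) (m≤n+m (2 * a * q) q)) ⟩
      α ^ (suc (2 * a) * q)      ∎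
      where
      lemma : ∀ a q → a * (2 * q) ≡ 2 * a * q
      lemma = solve-∀

    full : ∀ p n .{{_ : NonZero p}} ℓ d A → 1 ≤ length A →
      Space.hits p n ℓ A (deduplicate (≡-dec Fin._≟_) (Defs.sums ℓ A)) ^ d * length A < length A ^ (ℓ * d) → ⊥
    full p n ℓ d A 1≤A lt = <⇒≱ lt (begin
      length A ^ (ℓ * d)                  ≡⟨ sym (^-*-assoc (length A) ℓ d) ⟩
      (length A ^ ℓ) ^ d                  ≡⟨ cong (_^ d) (sym everything) ⟩
      hits ℓ A S ^ d                      ≤⟨ m≤m*n _ (length A) {{>-nonZero 1≤A}} ⟩
      hits ℓ A S ^ d * length A           ∎)
      where
      open Space p n
      S = deduplicate (≡-dec Fin._≟_) (Defs.sums ℓ A)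
      everything : hits ℓ A S ≡ length A ^ ℓ
      everything = trans (∑-cong∈ (sums ℓ A) (λ {s} s∈ → 𝟙-yes (s ∈? S)
          (∈-deduplicate⁺ (≡-dec Fin._≟_) (subst (s ∈_) (Extraction.sums≡ p n ℓ A) s∈))))
        (trans (∑-const (sums ℓ A) 1) (trans (*-identityʳ _) (length-sums ℓ A)))

open import Data.Integer using (∣_∣)
open import Data.Nat using (_*_; _^_; _≤_)
open import Data.Rational using (ℚ; 1ℚ; _<_; ↥_; ↧ₙ_)

theorem2p1 : (c : ℚ) → 1ℚ < c →
    Σ ℕ λ ℓ → 1 ≤ ℓ × Σ ℕ λ C → 1 ≤ C × Σ ℕ λ p₀ →
    (p : ℕ) .{{_ : NonZero p}} → Prime p → p₀ ≤ p →
    Σ ℕ λ D → 1 ≤ D ×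
    ((n : ℕ) → 1 ≤ n → (A : List (Vecₚ p n)) → Unique A →
    D * C ^ n ≤ length A →
    sumsetCard ℓ A ≤ length A ^^ c →
    Σ (Fin p → Vecₚ p n) λ x →
    Injective _≡_ _≡_ x × ((i : Fin p) → x i ∈ A) × sumFam p x ≡ 0ᵥ)
theorem2p1 c _ = Additive.zeroSumFamily ∣ ↥ c ∣ (↧ₙ c)
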